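{- Let $A\in\mathbb{H}_n$ be a rank-$r$ correlation matrix that admits a sign component decomposition $$A=\sum_{i=1}^r \tau_i\, s_i s_i^{\mathsf t},\qquad s_i\in\{\pm1\}^n,\quad (\tau_1,\dots,\tau_r)\in\Delta_r^+,$$ where the family $\{s_1,\dots,s_r\}$ of sign components is Schur independent. Then the sign component decomposition of $A$ is unique, i.e. uniquely determined up to the trivial symmetries (permutation of the terms and sign flips $s_i\mapsto -s_i$). Moreover, the algorithm SignComponentDecomposition (described in the context), applied to $A$, computes this decomposition (with probability one over its random draws), in time polynomial in $n$: its output is the unordered set of pairs $\{(\tau_i,\xi_i s_i):1\le i\le r\}$ for some signs $\xi_i\in\{\pm1\}$.
   Context: $\mathbb{H}_n$ is the space of real symmetric $n\times n$ matrices; $X\succcurlyeq 0$ means positive semidefinite; ${}^{\mathsf t}$ is transpose; $\mathbf e$ is the all-ones vector; $\mathrm{diag}(X)$ is the vector of diagonal entries of $X$; $\odot$ is the entrywise product of vectors. A correlation matrix is a positive-semidefinite matrix with all diagonal entries equal to one. $\Delta_r^+=\{\tau\in\mathbb{R}^r:\tau_i>0,\ \sum_i\tau_i=1\}$. A sign component decomposition of a correlation matrix $A$ is a representation $A=\sum_{i=1}^{m}\tau_i s_is_i^{\mathsf t}$ for some natural number $m$, with $(\tau_1,\dots,\tau_m)\in\Delta_m^+$ and $s_i\in\{\pm1\}^n$, where the matrices $s_is_i^{\mathsf t}$ are pairwise distinct. Its parametric representation is the list of pairs $(\tau_i,s_i)$. Two parametric representations are equivalent if they have the same number of terms and the terms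 coincide up to permutation and sign flips $s_i\mapsto\pm s_i$. The decomposition of $A$ is unique if the parametric representations of all sign component decompositions of $A$ (with any number of terms) are equivalent. A family $\{s_1,\dots,s_r\}\subseteq\{\pm1\}^n$ is Schur independent if $\dim\operatorname{span}\{s_i\odot s_j:1\le i,j\le r\}=\binom r2+1$; equivalently, the family $\{\mathbf e\}\cup\{s_i\odot s_j:1\le i<j\le r\}$ is linearly independent. Algorithm SignComponentDecomposition. Input: a rank-$r$ correlation matrix $A\in\mathbb{H}_n$. Set $B\leftarrow A$. For $i=1,\dots,r-1$: (0) let $U$ be a matrix whose columns form an orthonormal basis of $\operatorname{range}(B)$, and draw a fresh standard normal vector $g\in\mathbb{R}^n$, independent of previous draws; (1) find the solution $X_\star$ of the semidefinite program: maximize $g^{\mathsf t}Xg$ over $X\in\mathbb{H}_n$ subject to $\operatorname{trace}(U^{\mathsf t}XU)=n$, $\mathrm{diag}(X)=\mathbf e$, $X\succcurlyeq0$; factorize the rank-one matrix $X_\star=\tilde s_i\tilde s_i^{\mathsf t}$ to obtain $\tilde s_i$; (2) find the solution $\zeta_\star$ of: maximize $\zeta\in\mathbb{R}$ subject to $\zeta B+(1-\zeta)X_\star\succcurlyeq0$; (3) set $B\leftarrow\zeta_\star B+(1-\zeta_\star)X_\star$. After the loop, factorize the rank-one matrix $B=\tilde s_r\tilde s_r^{\mathsf t}$. (4) Find the solution $\tilde\tau\in\Delta_r^+$ of the linear system $A=\sum_{i=1}^r\tilde\tau_i\tilde s_i\tilde s_i^{\mathsf t}$ with $A$ the original input. Output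 the pairs $(\tilde\tau_i,\tilde s_i)$, $i=1,\dots,r$. Running time counts arithmetic operations, the semidefinite programs being solved by a standard solver. -}

module Defs where

open import Algebra.Bundles using (CommutativeRing; Semiring)
import Algebra.Definitions.RawMonoid as RawMonoidOps
import Algebra.Definitions.RawSemiring as RawSemiringOps
import Algebra.Properties.AbelianGroup as AbelianGroupProperties
import Algebra.Properties.Ring as RingProperties
open import Data.Bool.Base using (Bool; if_then_else_)
open import Data.Fin.Base using (Fin; zero; suc; toℕ; remQuot)
open import Data.Fin.Permutation using (Permutation; _⟨$⟩ʳ_)
open import Data.Maybe.Base using (Maybe; just; nothing; maybe′)
open import Data.Nat.Base as ℕ using (ℕ; zero; suc; pred; _!)
open import Data.Nat.Combinatorics using (_C_)
open import Data.Product.Base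
  using (Σ; ∃; ∃₂; _×_; _,_; proj₁; proj₂; uncurry)
open import Data.Sum.Base using (_⊎_; inj₁; inj₂; [_,_]′)
open import Data.Unit.Base using (⊤)
open import Data.Vec.Functional using (Vector; []; _∷_; head; tail)
open import Level using (0ℓ) renaming (suc to lsuc)
open import Relation.Binary.Core using (Rel)
import Relation.Binary.Construct.NonStrictToStrict as ToStrict
open import Relation.Binary.PropositionalEquality.Core using (_≢_)
open import Relation.Binary.Structures using (IsDecTotalOrder)
open import Relation.Nullary using (¬_; does)
open import Relation.Unary using (Pred; U; ∁; ⋃; _≐_; _⊆_)

-- The real numbers, axiomatised (up to unique isomorphism) as a complete
-- ordered field.  The value of the inverse at 0 is unspecified.
record RealNumbers : Set₁ where
  infix 4 _≤_
  infix 9 _⁻¹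
  field
    commutativeRing : CommutativeRing 0ℓ 0ℓ

  open CommutativeRing commutativeRing public
    hiding (_-_) renaming (Carrier to ℝ; zero to *-zero)

  field
    _≤_             : Rel ℝ 0ℓ
    isDecTotalOrder : IsDecTotalOrder _≈_ _≤_
    +-monoˡ-≤       : ∀ z {x y} → x ≤ y → x + z ≤ y + z
    *-nonNegative   : ∀ {x y} → 0# ≤ x → 0# ≤ y → 0# ≤ x * y
    0≉1             : ¬ (0# ≈ 1#)
    _⁻¹             : ℝ → ℝ
    *-inverseʳ      : ∀ {x} → ¬ (x ≈ 0#) → x * x ⁻¹ ≈ 1#

  UpperBound : Pred ℝ 0ℓ → Pred ℝ 0ℓ
  UpperBound S b = ∀ x → S x → x ≤ b

  IsSupremum : Pred ℝ 0ℓ → Pred ℝ 0ℓ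
  IsSupremum S b = UpperBound S b × (∀ c → UpperBound S c → b ≤ c)

  field
    supremum : ∀ S → ∃ S → ∃ (UpperBound S) → ∃ (IsSupremum S)

  open IsDecTotalOrder isDecTotalOrder public
    using (_≟_; _≤?_; total; antisym; ≤-respʳ-≈; ≤-respˡ-≈)
    renaming (trans to ≤-trans; refl to ≤-refl; reflexive to ≤-reflexive)
  open ToStrict _≈_ _≤_ public using (_<_)

module SignComponents (ℛ : RealNumbers) where

  open RealNumbers ℛ public
  open RawMonoidOps +-rawMonoid public using (sum) renaming (_×_ to _·_)
  open RawMonoidOps *-rawMonoid public using () renaming (sum to product)
  open RawSemiringOps (Semiring.rawSemiring semiring) public using (_^_)

  private
    x≤1+x² : ∀ x → x ≤ 1# + x * x
    x≤1+x² x = [ small , large ]′ (total x 1#)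
      where
      open RingProperties ring using (-‿distribˡ-*; -‿distribʳ-*)
      open AbelianGroupProperties +-abelianGroup using (⁻¹-involutive)

      shiftˡ : ∀ {a b} → a ≤ b → 0# ≤ b + - a
      shiftˡ {a} {b} p = ≤-respˡ-≈ (-‿inverseʳ a) (+-monoˡ-≤ (- a) p)

      cancel : ∀ a b → (a + - b) + b ≈ a
      cancel a b = trans (+-assoc a (- b) b)
        (trans (+-congˡ (-‿inverseˡ b)) (+-identityʳ a))

      unshift : ∀ {a b} → 0# ≤ b + - a → a ≤ b
      unshift {a} {b} p =
        ≤-respʳ-≈ (cancel b a) (≤-respˡ-≈ (+-identityˡ a) (+-monoˡ-≤ a p))

      neg-nonNegative : ∀ {a} → a ≤ 0# → 0# ≤ - a
      neg-nonNegative {a} p = ≤-respʳ-≈ (+-identityˡ (- a)) (shiftˡ p)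

      square-nonNegative : ∀ a → 0# ≤ a * a
      square-nonNegative a = [ (λ p → *-nonNegative p p) , negative ]′ (total 0# a)
        where
        negative : a ≤ 0# → 0# ≤ a * a
        negative p = ≤-respʳ-≈
          (trans (sym (-‿distribˡ-* a (- a)))
            (trans (-‿cong (sym (-‿distribʳ-* a a))) (⁻¹-involutive (a * a))))
          (*-nonNegative (neg-nonNegative p) (neg-nonNegative p))

      1≤1+x² : 1# ≤ 1# + x * x
      1≤1+x² = ≤-respʳ-≈ (+-comm (x * x) 1#)
        (≤-respˡ-≈ (+-identityˡ 1#) (+-monoˡ-≤ 1# (square-nonNegative x)))

      x²≤1+x² : x * x ≤ 1# + x * x
      x²≤1+x² = ≤-respˡ-≈ (+-identityˡ (x * x))
        (+-monoˡ-≤ (x * x) (≤-respʳ-≈ (*-identityˡ 1#) (square-nonNegative 1#)))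

      small : x ≤ 1# → x ≤ 1# + x * x
      small p = ≤-trans p 1≤1+x²

      x[x-1]≈x²-x : x * (x + - 1#) ≈ x * x + - x
      x[x-1]≈x²-x = trans (distribˡ x x (- 1#))
        (+-congˡ (trans (sym (-‿distribʳ-* x 1#)) (-‿cong (*-identityʳ x))))

      large : 1# ≤ x → x ≤ 1# + x * x
      large 1≤x = ≤-trans
        (unshift (≤-respʳ-≈ x[x-1]≈x²-x (*-nonNegative 0≤x (shiftˡ 1≤x))))
        x²≤1+x²
        where
        0≤x : 0# ≤ x
        0≤x = ≤-trans (≤-respʳ-≈ (*-identityˡ 1#) (square-nonNegative 1#)) 1≤x

  infixl 6 _-_
  _-_ : ℝ → ℝ → ℝ
  x - y = x + - y

  -- The largest y with y² ≤ x; set to 0 for negative x.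
  √_ : ℝ → ℝ
  √ x = [ root , (λ _ → 0#) ]′ (total 0# x)
    where
    root : 0# ≤ x → ℝ
    root 0≤x = proj₁ (supremum (λ y → y * y ≤ x)
      (0# , ≤-respˡ-≈ (sym (zeroˡ 0#)) 0≤x)
      (1# + x , λ y y²≤x → ≤-trans (x≤1+x² y)
        (≤-respˡ-≈ (+-comm (y * y) 1#)
          (≤-respʳ-≈ (+-comm x 1#) (+-monoˡ-≤ 1# y²≤x)))))

  ----------------------------------------------------------------------
  -- Linear algebra

  Matrix : ℕ → ℕ → Set
  Matrix m n = Vector (Vector ℝ n) m

  infix 4 _≈ᵥ_ _≈ₘ_
  _≈ᵥ_ : ∀ {n} → Rel (Vector ℝ n) 0ℓ
  x ≈ᵥ y = ∀ i → x i ≈ y i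

  _≈ₘ_ : ∀ {m n} → Rel (Matrix m n) 0ℓ
  X ≈ₘ Y = ∀ i j → X i j ≈ Y i j

  infix 10 _ᵗ
  _ᵗ : ∀ {m n} → Matrix m n → Matrix n m
  (X ᵗ) i j = X j i

  infixl 7 _*ₘ_
  _*ₘ_ : ∀ {l m n} → Matrix l m → Matrix m n → Matrix l n
  (X *ₘ Y) i j = sum λ k → X i k * Y k j

  infix 7 _*ᵥ_
  _*ᵥ_ : ∀ {m n} → Matrix m n → Vector ℝ n → Vector ℝ m
  (X *ᵥ v) i = sum λ j → X i j * v j

  ⟨_,_⟩ : ∀ {n} → Vector ℝ n → Vector ℝ n → ℝ
  ⟨ x , y ⟩ = sum λ i → x i * y i

  infixl 7 _⊙_
  _⊙_ : ∀ {n} → Vector ℝ n → Vector ℝ n → Vector ℝ n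
  (x ⊙ y) i = x i * y i

  trace : ∀ {n} → Matrix n n → ℝ
  trace X = sum λ i → X i i

  diag : ∀ {n} → Matrix n n → Vector ℝ n
  diag X i = X i i

  𝐞 : ∀ {n} → Vector ℝ n
  𝐞 _ = 1#

  column : ∀ {m n} → Matrix m n → Fin n → Vector ℝ m
  column X j i = X i j

  dyad : ∀ {n} → Vector ℝ n → Matrix n n
  dyad s i j = s i * s j

  combination : ∀ {n k} → Vector ℝ k → (Fin k → Vector ℝ n) → Vector ℝ n
  combination c v i = sum λ j → c j * v j i

  -- ζX + (1-ζ)Y
  affine : ∀ {n} → ℝ → Matrix n n → Matrix n n → Matrix n n
  affine ζ X Y i j = ζ * X i j + (1# - ζ) * Y i j

  Symmetric : ∀ {n} → Pred (Matrix n n) 0ℓ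
  Symmetric X = X ᵗ ≈ₘ X

  PositiveSemidefinite : ∀ {n} → Pred (Matrix n n) 0ℓ
  PositiveSemidefinite X = Symmetric X × (∀ v → 0# ≤ ⟨ v , X *ᵥ v ⟩)

  InSpan : ∀ {n} {I : Set} → (I → Vector ℝ n) → Pred (Vector ℝ n) 0ℓ
  InSpan {I = I} v x =
    ∃ λ k → Σ (Fin k → I) λ f → ∃ λ c → x ≈ᵥ combination c (λ j → v (f j))

  LinearlyIndependent : ∀ {n k} → Pred (Fin k → Vector ℝ n) 0ℓ
  LinearlyIndependent v =
    ∀ c → combination c v ≈ᵥ (λ _ → 0#) → c ≈ᵥ (λ _ → 0#)

  SpanHasDimension : ∀ {n} {I : Set} → (I → Vector ℝ n) → ℕ → Set
  SpanHasDimension {n} v d = Σ (Fin d → Vector ℝ n) λ b →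
    LinearlyIndependent b × (∀ j → InSpan v (b j)) × (∀ i → InSpan b (v i))

  HasRank : ∀ {m n} → Matrix m n → ℕ → Set
  HasRank X = SpanHasDimension (column X)

  IsOrthonormalBasisOfRange : ∀ {m n k} → Matrix m n → Matrix m k → Set
  IsOrthonormalBasisOfRange X V =
      (∀ i → ⟨ column V i , column V i ⟩ ≈ 1#)
    × (∀ i j → i ≢ j → ⟨ column V i , column V j ⟩ ≈ 0#)
    × (∀ j → InSpan (column X) (column V j))
    × (∀ j → InSpan (column V) (column X j))

  ----------------------------------------------------------------------
  -- Sign component decompositions

  IsCorrelationMatrix : ∀ {n} → Pred (Matrix n n) 0ℓ
  IsCorrelationMatrix X = PositiveSemidefinite X × diag X ≈ᵥ 𝐞

  Δ⁺ : ∀ {m} → Pred (Vector ℝ m) 0ℓ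
  Δ⁺ τ = (∀ i → 0# < τ i) × sum τ ≈ 1#

  IsSign : Pred ℝ 0ℓ
  IsSign x = x ≈ 1# ⊎ x ≈ - 1#

  Parametric : ℕ → ℕ → Set
  Parametric m n = Vector ℝ m × (Fin m → Vector ℝ n)

  ∑τssᵗ : ∀ {m n} → Parametric m n → Matrix n n
  ∑τssᵗ (τ , s) i j = sum λ k → τ k * dyad (s k) i j

  IsSignComponentDecomposition : ∀ {m n} → Matrix n n → Pred (Parametric m n) 0ℓ
  IsSignComponentDecomposition A (τ , s) =
      Δ⁺ τ
    × (∀ i j → IsSign (s i j))
    × (∀ i j → i ≢ j → ¬ (dyad (s i) ≈ₘ dyad (s j)))
    × A ≈ₘ ∑τssᵗ (τ , s)

  -- A permutation from Fin m to Fin m′ exists only when m ≡ m′.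
  infix 4 _∼_
  _∼_ : ∀ {m m′ n} → Parametric m n → Parametric m′ n → Set
  _∼_ {m} {m′} (τ , s) (τ′ , s′) =
    Σ (Permutation m m′) λ π → ∃ λ (ξ : Vector ℝ m) →
      ∀ i → IsSign (ξ i)
          × τ′ (π ⟨$⟩ʳ i) ≈ τ i
          × s′ (π ⟨$⟩ʳ i) ≈ᵥ (λ j → ξ i * s i j)

  HasUniqueDecomposition : ∀ {n} → Pred (Matrix n n) 0ℓ
  HasUniqueDecomposition {n} A =
    ∀ {m m′} (p : Parametric m n) (q : Parametric m′ n) →
    IsSignComponentDecomposition A p → IsSignComponentDecomposition A q → p ∼ q

  SchurIndependent : ∀ {r n} → Pred (Fin r → Vector ℝ n) 0ℓ
  SchurIndependent {r} s =
    SpanHasDimension (λ ((i , j) : Fin r × Fin r) → s i ⊙ s j) (r C 2 ℕ.+ 1)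

  ----------------------------------------------------------------------
  -- The algorithm as a relation: U, the factors and the solutions of the
  -- optimisation problems may be chosen in any admissible way.

  IsMaximiser : {A : Set} → Pred A 0ℓ → (A → ℝ) → Pred A 0ℓ
  IsMaximiser Feasible f x = Feasible x × (∀ y → Feasible y → f y ≤ f x)

  IsSolution₁ : ∀ {n k} → Matrix n k → Vector ℝ n → Pred (Matrix n n) 0ℓ
  IsSolution₁ {n} V g = IsMaximiser
    (λ X → trace (V ᵗ *ₘ X *ₘ V) ≈ n · 1# × diag X ≈ᵥ 𝐞 × PositiveSemidefinite X)
    (λ X → ⟨ g , X *ᵥ g ⟩)

  IsSolution₂ : ∀ {n} → Matrix n n → Matrix n n → Pred ℝ 0ℓ
  IsSolution₂ B X = IsMaximiser (λ ζ → PositiveSemidefinite (affine ζ B X)) (λ ζ → ζ)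

  Loop : ∀ {n} r → Matrix n n → (Fin (pred r) → Vector ℝ n) →
         (Fin r → Vector ℝ n) → Set
  Loop 0 B g s = ⊤
  Loop 1 B g s = B ≈ₘ dyad (s zero)
  Loop {n} (suc (suc r)) B g s =
    ∃ λ k → Σ (Matrix n k) λ V → Σ (Matrix n n) λ X → ∃ λ ζ →
      IsOrthonormalBasisOfRange B V
    × IsSolution₁ V (head g) X
    × X ≈ₘ dyad (head s)
    × IsSolution₂ B X ζ
    × Loop (suc r) (affine ζ B X) (tail g) (tail s)

  IsRun : ∀ {n r} → Matrix n n → (Fin (pred r) → Vector ℝ n) → Pred (Parametric r n) 0ℓ
  IsRun {r = r} A g (τ , s) = Loop r A g s × Δ⁺ τ × A ≈ₘ ∑τssᵗ (τ , s)

  ----------------------------------------------------------------------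
  -- The algorithm as a program of an exact real-arithmetic machine: field
  -- operations, square roots and zero tests each cost one operation.

  Counted : Set → Set
  Counted A = A × ℕ

  value : ∀ {A} → Counted A → A
  value = proj₁

  cost : ∀ {A} → Counted A → ℕ
  cost = proj₂

  return : ∀ {A} → A → Counted A
  return x = x , 0

  infixl 1 _>>=_
  _>>=_ : ∀ {A B} → Counted A → (A → Counted B) → Counted B
  p >>= f = value (f (value p)) , cost p ℕ.+ cost (f (value p))

  each : ∀ {A n} → (Fin n → Counted A) → Counted (Fin n → A)
  each {n = zero}  p = return (λ ())
  each {n = suc n} p = do
    x  ← p zero
    xs ← each (λ i → p (suc i))
    return (x ∷ xs)

  add sub mul : ℝ → ℝ → Counted ℝ
  add x y = x + y , 1
  sub x y = x - y , 1
  mul x y = x * y , 1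

  inv sqrt : ℝ → Counted ℝ
  inv  x = x ⁻¹ , 1
  sqrt x = √ x , 1

  isZero : ℝ → Counted Bool
  isZero x = does (x ≟ 0#) , 1

  draw : ∀ {n} → Vector ℝ n → Counted (Vector ℝ n)
  draw {n} g = g , n

  total-of : ∀ {n} → Vector ℝ n → Counted ℝ
  total-of {zero}  x = return 0#
  total-of {suc n} x = do
    t ← total-of (tail x)
    add (head x) t

  inner : ∀ {n} → Vector ℝ n → Vector ℝ n → Counted ℝ
  inner x y = do
    z ← each λ i → mul (x i) (y i)
    total-of z

  scale : ∀ {n} → ℝ → Vector ℝ n → Counted (Vector ℝ n)
  scale c x = each λ i → mul c (x i)

  subtract : ∀ {n} → Vector ℝ n → Vector ℝ n → Counted (Vector ℝ n)
  subtract x y = each λ i → sub (x i) (y i)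

  combine : ∀ {n k} → Vector ℝ k → (Fin k → Vector ℝ n) → Counted (Vector ℝ n)
  combine c v = each λ i → inner c (λ j → v j i)

  -- Gram–Schmidt; vectors depending on the later ones are dropped.
  gramSchmidt : ∀ {n m} → (Fin m → Vector ℝ n) → Counted (∃ λ k → Fin k → Vector ℝ n)
  gramSchmidt {m = zero}  v = return (0 , λ ())
  gramSchmidt {m = suc m} v = do
    (k , u) ← gramSchmidt (tail v)
    c ← each λ j → inner (u j) (head v)
    p ← combine c u
    w ← subtract (head v) p
    q ← inner w w
    z ← isZero q
    if z then return (k , u) else do
      l ← sqrt q
      l⁻¹ ← inv l
      e ← scale l⁻¹ w
      return (suc k , e ∷ u)

  orthonormalBasis : ∀ {m n} → Matrix m n → Counted (∃ λ k → Matrix m k)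
  orthonormalBasis X = do
    (k , u) ← gramSchmidt (column X)
    return (k , u ᵗ)

  firstNonzero : ∀ {n} → Vector ℝ n → Counted (Maybe (Fin n))
  firstNonzero {zero}  x = return nothing
  firstNonzero {suc n} x = do
    z ← isZero (head x)
    if z
      then (do
        i ← firstNonzero (tail x)
        return (maybe′ (λ j → just (suc j)) nothing i))
      else return (just zero)

  -- If X = ssᵗ then column j of X is sⱼs, and ∣sⱼ∣ = √ Xⱼⱼ.
  factorise : ∀ {n} → Matrix n n → Counted (Vector ℝ n)
  factorise X = do
    j ← firstNonzero (diag X)
    maybe′ (λ j → do
        l ← sqrt (X j j)
        l⁻¹ ← inv l
        scale l⁻¹ (column X j))
      (return λ _ → 0#) j

  affineᶜ : ∀ {n} → ℝ → Matrix n n → Matrix n n → Counted (Matrix n n)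
  affineᶜ ζ X Y = do
    η ← sub 1# ζ
    each λ i → each λ j → do
      x ← mul ζ (X i j)
      y ← mul η (Y i j)
      add x y

  -- Solves a = Σ τᵢvᵢ for linearly independent vᵢ: the first unknown is
  -- eliminated by projecting onto the orthogonal complement of v₀.
  linearSolve : ∀ {N m} → (Fin m → Vector ℝ N) → Vector ℝ N → Counted (Vector ℝ m)
  linearSolve {m = zero}      v a = return (λ ())
  linearSolve {N} {m = suc m} v a = do
    q   ← inner (head v) (head v)
    q⁻¹ ← inv q
    w   ← each λ j → reduce q⁻¹ (tail v j)
    a′  ← reduce q⁻¹ a
    τ   ← linearSolve w a′
    p   ← combine τ (tail v)
    b   ← subtract a p
    t   ← inner b (head v)
    τ₀  ← mul t q⁻¹
    return (τ₀ ∷ τ)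
    where
    reduce : ℝ → Vector ℝ N → Counted (Vector ℝ N)
    reduce q⁻¹ x = do
      t ← inner x (head v)
      c ← mul t q⁻¹
      p ← scale c (head v)
      subtract x p

  flatten : ∀ {m n} → Matrix m n → Vector ℝ (m ℕ.* n)
  flatten {n = n} X k = uncurry X (remQuot n k)

  dyadᶜ : ∀ {n} → Vector ℝ n → Counted (Matrix n n)
  dyadᶜ s = each λ i → each λ j → mul (s i) (s j)

  PolynomiallyBounded : {I : Set} → (I → ℕ) → (I → ℕ) → Set
  PolynomiallyBounded size f = ∃₂ λ c d → ∀ i → f i ℕ.≤ c ℕ.* size i ℕ.^ d ℕ.+ c

  -- An exact solver for the two families of semidefinite programs.  Nothing
  -- is assumed about its answers to programs without a maximiser.
  record SDPSolver : Set where
    field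
      solve₁   : ∀ {n k} → Matrix n k → Vector ℝ n → Counted (Matrix n n)
      solve₂   : ∀ {n} → Matrix n n → Matrix n n → Counted ℝ
      correct₁ : ∀ {n k} (V : Matrix n k) g → ∃ (IsSolution₁ V g) →
                 IsSolution₁ V g (value (solve₁ V g))
      correct₂ : ∀ {n} (B X : Matrix n n) → ∃ (IsSolution₂ B X) →
                 IsSolution₂ B X (value (solve₂ B X))
      time₁    : PolynomiallyBounded
                 {∃₂ λ n k → Matrix n k × Vector ℝ n}
                 (λ (n , k , _) → n ℕ.+ k) (λ (_ , _ , V , g) → cost (solve₁ V g))
      time₂    : PolynomiallyBounded
                 {∃ λ n → Matrix n n × Matrix n n}
                 proj₁ (λ (_ , B , X) → cost (solve₂ B X))

  module _ (solver : SDPSolver) where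
    open SDPSolver solver

    iteration : ∀ {n} → Matrix n n → Vector ℝ n → Counted (Vector ℝ n × Matrix n n)
    iteration B g = do
      (_ , V) ← orthonormalBasis B
      g′ ← draw g
      X  ← solve₁ V g′
      s  ← factorise X
      ζ  ← solve₂ B X
      B′ ← affineᶜ ζ B X
      return (s , B′)

    loop : ∀ {n} r → Matrix n n → (Fin (pred r) → Vector ℝ n) →
           Counted (Fin r → Vector ℝ n)
    loop 0 B g = return (λ ())
    loop 1 B g = do
      s ← factorise B
      return (s ∷ [])
    loop (suc (suc r)) B g = do
      it ← iteration B (head g)
      ss ← loop (suc r) (proj₂ it) (tail g)
      return (proj₁ it ∷ ss)

    signComponentDecomposition :
      ∀ {n} r → Matrix n n → (Fin (pred r) → Vector ℝ n) → Counted (Parametric r n)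
    signComponentDecomposition r A g = do
      s ← loop r A g
      S ← each λ k → dyadᶜ (s k)
      τ ← linearSolve (λ k → flatten (S k)) (flatten A)
      return (τ , s)

  ----------------------------------------------------------------------
  -- Probability

  ConvergesTo : (ℕ → ℝ) → ℝ → Set
  ConvergesTo u l = ∀ ε → 0# < ε → ∃ λ N → ∀ k → N ℕ.≤ k →
    u k ≤ l + ε × l ≤ u k + ε

  infix 4 _SumsTo_
  _SumsTo_ : (ℕ → ℝ) → ℝ → Set
  u SumsTo l = ConvergesTo (λ N → sum {N} (λ k → u (toℕ k))) l

  -- P is a function of all subsets of Ω, but is constrained only on events.
  record ProbabilitySpace : Set₂ where
    field
      Ω         : Set
      Event     : Pred (Pred Ω 0ℓ) (lsuc 0ℓ)
      ℙ         : Pred Ω 0ℓ → ℝ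
      Event-≐   : ∀ {E F} → E ≐ F → Event E → Event F
      Event-U   : Event U
      Event-∁   : ∀ {E} → Event E → Event (∁ E)
      Event-⋃   : ∀ {E : ℕ → Pred Ω 0ℓ} → (∀ k → Event (E k)) → Event (⋃ ℕ E)
      ℙ-≐       : ∀ {E F} → Event E → E ≐ F → ℙ E ≈ ℙ F
      ℙ-nonNeg  : ∀ {E} → Event E → 0# ≤ ℙ E
      ℙ-U       : ℙ U ≈ 1#
      ℙ-⋃       : ∀ {E : ℕ → Pred Ω 0ℓ} → (∀ k → Event (E k)) →
                  (∀ i j → i ≢ j → ∀ ω → E i ω → ¬ E j ω) →
                  (λ k → ℙ (E k)) SumsTo ℙ (⋃ ℕ E)

    AlmostSurely : Pred Ω 0ℓ → Set₁
    AlmostSurely Q = ∃ λ E → Event E × ℙ E ≈ 1# × E ⊆ Q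

  data Borel : Pred ℝ 0ℓ → Set₁ where
    half-line : ∀ b → Borel (_≤ b)
    resp-≐    : ∀ {S T} → S ≐ T → Borel S → Borel T
    ∁-borel   : ∀ {S} → Borel S → Borel (∁ S)
    ⋃-borel   : ∀ {S : ℕ → Pred ℝ 0ℓ} → (∀ k → Borel (S k)) → Borel (⋃ ℕ S)

  _IsExpOf_ : ℝ → ℝ → Set
  e IsExpOf x = (λ k → x ^ k * ((k !) · 1#) ⁻¹) SumsTo e

  -- φ(x) = c exp(-x²/2) for a constant c; for a probability density this
  -- forces c = 1/√(2π).
  IsGaussian : Pred (ℝ → ℝ) 0ℓ
  IsGaussian φ = ∃ λ c → ∀ x →
    ∃ λ e → e IsExpOf (x * x * (1# + 1#) ⁻¹) × φ x * e ≈ c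

  -- Limit of left-endpoint Riemann sums over equal subdivisions, which is
  -- the integral when f is continuous.
  IsIntegral : (ℝ → ℝ) → ℝ → ℝ → ℝ → Set
  IsIntegral f a b = ConvergesTo λ N →
    let h = (b - a) * (N · 1#) ⁻¹ in
    sum {N} λ k → f (a + toℕ k · h) * h

  module _ (𝒫 : ProbabilitySpace) where
    open ProbabilitySpace 𝒫

    IsRandomVariable : (Ω → ℝ) → Set₁
    IsRandomVariable x = ∀ {S} → Borel S → Event (λ ω → S (x ω))

    IsStandardNormal : (Ω → ℝ) → Set₁
    IsStandardNormal x = IsRandomVariable x × ∃ λ φ → IsGaussian φ ×
      (∀ a b → a ≤ b → IsIntegral φ a b (ℙ λ ω → a < x ω × x ω ≤ b))

    -- Independent standard normal vectors: all the coordinates of all the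
    -- vectors are mutually independent standard normal variables.
    AreIndependentStandardNormal : ∀ {m n} → (Ω → Fin m → Vector ℝ n) → Set₁
    AreIndependentStandardNormal {m} {n} g =
        (∀ i j → IsStandardNormal (λ ω → g ω i j))
      × (∀ (S : Fin m → Fin n → Pred ℝ 0ℓ) → (∀ i j → Borel (S i j)) →
           ℙ (λ ω → ∀ i j → S i j (g ω i j))
         ≈ product λ i → product λ j → ℙ (λ ω → S i j (g ω i j)))

module Submission where

open import Algebra.Bundles using (CommutativeRing)
import Algebra.Properties.Group as GroupProperties
import Algebra.Properties.AbelianGroup as AbelianGroupProperties
import Algebra.Properties.Ring as RingProperties
import Algebra.Properties.Semiring.Mult.TCOptimised as SemiringMult
import Algebra.Properties.Semiring.Sum as SemiringSum
import Algebra.Properties.CommutativeMonoid.Sum as MonoidSum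
import Algebra.Solver.Ring as RingSolver
open import Algebra.Solver.Ring.AlmostCommutativeRing
  using (fromCommutativeRing; _-Raw-AlmostCommutative⟶_)
open import Axiom.ExcludedMiddle using (ExcludedMiddle)
open import Data.Bool.Base using (Bool; true; false; if_then_else_)
open import Data.Empty using (⊥-elim)
open import Data.Fin.Base as Fin using (Fin; zero; suc; toℕ; punchIn; punchOut; splitAt; _↑ˡ_; _↑ʳ_; remQuot)
open import Data.Fin.Permutation as Permutation using (Permutation; _⟨$⟩ʳ_; _⟨$⟩ˡ_; _∘ₚ_; permutation)
open import Data.Fin.Properties as Fin
  using (punchInᵢ≢i; punchIn-punchOut; punchIn-injective; punchOut-injective; injective⇒≤; remQuot-combine)
open import Data.Integer.Base as ℤ using (ℤ; +_; -[1+_]; +[1+_])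
import Data.Integer.Properties as ℤ
open import Data.Maybe.Base as Maybe using (Maybe; just; nothing; maybe′)
open import Data.Nat.Base as ℕ using (ℕ; zero; suc; pred)
import Data.Nat.Combinatorics as Combinatorics
import Data.Nat.Properties as ℕ
open import Data.Nat.Tactic.RingSolver using (solve-∀)
open import Data.Product.Base using (∃; ∃₂; _×_; _,_; proj₁; proj₂)
open import Data.Sum.Base using (_⊎_; inj₁; inj₂; [_,_]′)
open import Data.Vec.Functional using (Vector; []; _∷_; _++_; head; tail; removeAt; insertAt)
open import Data.Vec.Functional.Properties using (insertAt-lookup; insertAt-punchIn; lookup-++ˡ; lookup-++ʳ)
open import Data.Unit.Base using (tt)
open import Function.Base using (_∘_; id; _$_)
open import Level using (0ℓ)
open import Relation.Binary.Definitions using (tri<; tri≈; tri>)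
open import Relation.Binary.Bundles using (Poset)
open import Relation.Binary.Structures using (IsDecTotalOrder)
import Relation.Binary.Reasoning.PartialOrder as PartialOrderReasoning
import Relation.Binary.Reasoning.Setoid as SetoidReasoning
open import Relation.Binary.PropositionalEquality.Core as ≡ using (_≡_; _≢_)
open import Relation.Nullary using (¬_; ¬?; Dec; yes; no; does)
open import Relation.Nullary.Decidable using (dec⇒maybe)
open import Relation.Unary using (Pred; U; ∁; ⋃; _∩_; _∪_; _≐_; _⊆_)

open import Defs

-- Let u be dual to the linearly independent signs s.  Every correlation matrix X whose range lies
-- in the span of the s_k has the form X = Σ M_kl s_k s_lᵗ with M_kl = ⟨u_k, X u_l⟩, and the
-- equations X_ii = 1 say that Σ M_kl s_k ⊙ s_l = 𝐞.  Schur independence therefore makes M diagonal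
-- with trace one: X is a convex combination of the s_k s_kᵗ.  Applied to X = ttᵗ for a component t
-- of another decomposition, this gives t = ± s_k, hence uniqueness.  Applied to the feasible set of
-- the first semidefinite program, it shows that the maximiser is the s_k s_kᵗ with the largest
-- ⟨s_k, g⟩², and it is unique unless g lies on one of the hyperplanes orthogonal to s_k ± s_l.
-- The second program then removes s_k s_kᵗ from B, so that the loop finds all components.
--
-- A hyperplane v_j x_j = - Σ v_l x_l is null for Gaussian vectors since, in a cube, it is covered by
-- O(h^(1-n)) boxes with sides of order h, each of probability O(h^n) as the density is bounded.

-- Independence of s comes from the rank: the columns of A lie in the span of the r vectors s_k and
-- span a space of dimension r. It also gives r ≤ n, which turns a cost bound in r and n into one in
-- n. The range condition on feasible X is hidden in the trace constraint: diag X = 𝐞 makes trace X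
-- equal to n, so trace (VᵗXV) = n leaves no trace for the compression of X to the orthogonal
-- complement of the range of V.
--
-- Which components are still present at a draw depends on the earlier draws. The exceptional event
-- is therefore fixed before the loop is followed: every draw must separate the values ⟨s_k, g⟩² of
-- all original components. Subfamilies inherit this, so it serves every course of the loop.
--
-- The reals are given by axioms only, and the normal law through the exponential series and Riemann
-- sums. The estimates start from one bound, the density being at most a constant because exp (x²/2)
-- ≥ 1; countable additivity does the rest. Since equality of reals is a relation that a solver need
-- not respect, the analysis of the program must carry matrices up to `≈ₘ`.

-- Coefficients with decidable equality are needed for the solver to cancel terms.
module IntegerCoefficients {c ℓ} (R : CommutativeRing c ℓ) where
  open CommutativeRing R
  open RingProperties ring using (-‿distribˡ-*; -‿distribʳ-*)
  open AbelianGroupProperties +-abelianGroup using (⁻¹-∙-comm; ⁻¹-involutive; ε⁻¹≈ε)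
  open SemiringMult semiring using (×1-homo-*; ×-homo-+; 1+×) renaming (_×_ to _·′_)
  open import Relation.Binary.Reasoning.Setoid setoid

  ⟦_⟧ℤ : ℤ → Carrier
  ⟦ + n ⟧ℤ      = n ·′ 1#
  ⟦ -[1+ n ] ⟧ℤ = - (suc n ·′ 1#)

  private
    shift : ∀ a b → (1# + a) - (1# + b) ≈ a - b
    shift a b = begin
      (1# + a) - (1# + b)       ≈⟨ +-congˡ (⁻¹-∙-comm 1# b) ⟨
      (1# + a) + (- 1# + - b)   ≈⟨ +-assoc (1# + a) (- 1#) (- b) ⟨
      (1# + a + - 1#) + - b
        ≈⟨ +-congʳ (trans (+-congʳ (+-comm 1# a)) (trans (+-assoc a 1# (- 1#)) (trans (+-congˡ (-‿inverseʳ 1#)) (+-identityʳ a)))) ⟩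
      a - b                     ∎

    -- `⊖` cancels successors on both sides, and `shift` is the same cancellation in R.
    ⊖-homo : ∀ m n → ⟦ m ℤ.⊖ n ⟧ℤ ≈ m ·′ 1# - n ·′ 1#
    ⊖-homo zero    zero    = sym (-‿inverseʳ 0#)
    ⊖-homo zero    (suc n) = sym (+-identityˡ _)
    ⊖-homo (suc m) zero    = sym (trans (+-congˡ ε⁻¹≈ε) (+-identityʳ _))
    ⊖-homo (suc m) (suc n) rewrite ℤ.[1+m]⊖[1+n]≡m⊖n m n = begin
      ⟦ m ℤ.⊖ n ⟧ℤ                        ≈⟨ ⊖-homo m n ⟩
      m ·′ 1# - n ·′ 1#                   ≈⟨ shift _ _ ⟨
      (1# + m ·′ 1#) - (1# + n ·′ 1#)     ≈⟨ +-cong (1+× m 1#) (-‿cong (1+× n 1#)) ⟨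
      suc m ·′ 1# - suc n ·′ 1#           ∎

    +-homo : ∀ i j → ⟦ i ℤ.+ j ⟧ℤ ≈ ⟦ i ⟧ℤ + ⟦ j ⟧ℤ
    +-homo (+ m)      (+ n)      = ×-homo-+ 1# m n
    +-homo (+ m)      -[1+ n ]   = ⊖-homo m (suc n)
    +-homo -[1+ m ]   (+ n)      = trans (⊖-homo n (suc m)) (+-comm _ _)
    +-homo -[1+ m ]   -[1+ n ]   = begin
      - (suc (suc (m ℕ.+ n)) ·′ 1#)       ≡⟨ ≡.cong (λ k → - (suc k ·′ 1#)) (≡.sym (ℕ.+-suc m n)) ⟩
      - ((suc m ℕ.+ suc n) ·′ 1#)         ≈⟨ -‿cong (×-homo-+ 1# (suc m) (suc n)) ⟩
      - (suc m ·′ 1# + suc n ·′ 1#)       ≈⟨ ⁻¹-∙-comm _ _ ⟨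
      - (suc m ·′ 1#) + - (suc n ·′ 1#)   ∎

    -‿homo : ∀ i → ⟦ ℤ.- i ⟧ℤ ≈ - ⟦ i ⟧ℤ
    -‿homo (+ zero)  = sym ε⁻¹≈ε
    -‿homo +[1+ n ]  = refl
    -‿homo -[1+ n ]  = sym (⁻¹-involutive _)

    pos*pos : ∀ m n → ⟦ + m ℤ.* + n ⟧ℤ ≈ ⟦ + m ⟧ℤ * ⟦ + n ⟧ℤ
    pos*pos m n = trans (reflexive (≡.cong ⟦_⟧ℤ (≡.sym (ℤ.pos-* m n)))) (×1-homo-* m n)

    pos*any : ∀ m j → ⟦ + m ℤ.* j ⟧ℤ ≈ ⟦ + m ⟧ℤ * ⟦ j ⟧ℤ
    pos*any m (+ n)    = pos*pos m n
    pos*any m -[1+ n ] = begin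
      ⟦ + m ℤ.* ℤ.- (+ suc n) ⟧ℤ     ≡⟨ ≡.cong ⟦_⟧ℤ (≡.sym (ℤ.neg-distribʳ-* (+ m) (+ suc n))) ⟩
      ⟦ ℤ.- (+ m ℤ.* + suc n) ⟧ℤ     ≈⟨ -‿homo (+ m ℤ.* + suc n) ⟩
      - ⟦ + m ℤ.* + suc n ⟧ℤ         ≈⟨ -‿cong (pos*pos m (suc n)) ⟩
      - (⟦ + m ⟧ℤ * ⟦ + suc n ⟧ℤ)    ≈⟨ -‿distribʳ-* _ _ ⟩
      ⟦ + m ⟧ℤ * - ⟦ + suc n ⟧ℤ      ∎

    *-homo : ∀ i j → ⟦ i ℤ.* j ⟧ℤ ≈ ⟦ i ⟧ℤ * ⟦ j ⟧ℤ
    *-homo (+ m)    j = pos*any m j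
    *-homo -[1+ m ] j = begin
      ⟦ ℤ.- (+ suc m) ℤ.* j ⟧ℤ       ≡⟨ ≡.cong ⟦_⟧ℤ (≡.sym (ℤ.neg-distribˡ-* (+ suc m) j)) ⟩
      ⟦ ℤ.- (+ suc m ℤ.* j) ⟧ℤ       ≈⟨ -‿homo (+ suc m ℤ.* j) ⟩
      - ⟦ + suc m ℤ.* j ⟧ℤ           ≈⟨ -‿cong (pos*any (suc m) j) ⟩
      - (⟦ + suc m ⟧ℤ * ⟦ j ⟧ℤ)      ≈⟨ -‿distribˡ-* _ _ ⟩
      - ⟦ + suc m ⟧ℤ * ⟦ j ⟧ℤ        ∎

    morphism : ℤ.+-*-rawRing -Raw-AlmostCommutative⟶ fromCommutativeRing R
    morphism = record
      { ⟦_⟧ = ⟦_⟧ℤ ; +-homo = +-homo ; *-homo = *-homo ; -‿homo = -‿homo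
      ; 0-homo = refl ; 1-homo = refl }

    _coefficient≟_ : ∀ i j → Maybe (⟦ i ⟧ℤ ≈ ⟦ j ⟧ℤ)
    i coefficient≟ j = Maybe.map (λ { ≡.refl → refl }) (dec⇒maybe (i ℤ.≟ j))

  open RingSolver ℤ.+-*-rawRing (fromCommutativeRing R) morphism _coefficient≟_ public
    using (solve; _:=_; _:+_; _:*_; _:-_; :-_; con)

-- Order arithmetic, square roots and the Archimedean property.

module OrderedField (ℛ : RealNumbers) where

  open SignComponents ℛ
  open IntegerCoefficients commutativeRing public
    using (solve; _:=_; _:+_; _:*_; _:-_; :-_; con)
  open AbelianGroupProperties +-abelianGroup public using (⁻¹-involutive)
  open RingProperties ring public using (-‿distribˡ-*)
  open GroupProperties +-group public
    using () renaming (ε⁻¹≈ε to -0≈0; x∙y⁻¹≈ε⇒x≈y to x-y≈0⇒x≈y)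

  poset : Poset 0ℓ 0ℓ 0ℓ
  poset = record { isPartialOrder = IsDecTotalOrder.isPartialOrder isDecTotalOrder }

  module ≤-Reasoning = PartialOrderReasoning poset
  module ≈-Reasoning = SetoidReasoning setoid

  ≤⇒0≤y-x : ∀ {x y} → x ≤ y → 0# ≤ y - x
  ≤⇒0≤y-x {x} p = ≤-respˡ-≈ (-‿inverseʳ x) (+-monoˡ-≤ (- x) p)

  0≤y-x⇒≤ : ∀ {x y} → 0# ≤ y - x → x ≤ y
  0≤y-x⇒≤ {x} {y} p = ≤-respʳ-≈ (solve 2 (λ x y → y :- x :+ x := y) refl x y)
    (≤-respˡ-≈ (+-identityˡ x) (+-monoˡ-≤ x p))

  +-monoʳ-≤ : ∀ z {x y} → x ≤ y → z + x ≤ z + y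
  +-monoʳ-≤ z p = ≤-respˡ-≈ (+-comm _ z) (≤-respʳ-≈ (+-comm _ z) (+-monoˡ-≤ z p))

  +-mono-≤ : ∀ {a b c d} → a ≤ b → c ≤ d → a + c ≤ b + d
  +-mono-≤ {b = b} {c = c} p q = ≤-trans (+-monoˡ-≤ c p) (+-monoʳ-≤ b q)

  +-nonNegative : ∀ {a b} → 0# ≤ a → 0# ≤ b → 0# ≤ a + b
  +-nonNegative p q = ≤-respˡ-≈ (+-identityˡ 0#) (+-mono-≤ p q)

  neg-mono-≤ : ∀ {x y} → x ≤ y → - y ≤ - x
  neg-mono-≤ {x} {y} p = 0≤y-x⇒≤
    (≤-respʳ-≈ (solve 2 (λ x y → y :- x := :- x :- :- y) refl x y) (≤⇒0≤y-x p))

  *-monoˡ-≤ : ∀ {c x y} → 0# ≤ c → x ≤ y → c * x ≤ c * y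
  *-monoˡ-≤ {c} {x} {y} 0≤c p = 0≤y-x⇒≤
    (≤-respʳ-≈ (solve 3 (λ c x y → c :* (y :- x) := c :* y :- c :* x) refl c x y)
      (*-nonNegative 0≤c (≤⇒0≤y-x p)))

  *-monoʳ-≤ : ∀ {c x y} → 0# ≤ c → x ≤ y → x * c ≤ y * c
  *-monoʳ-≤ 0≤c p = ≤-respˡ-≈ (*-comm _ _) (≤-respʳ-≈ (*-comm _ _) (*-monoˡ-≤ 0≤c p))

  *-mono-≤ : ∀ {a b c d} → 0# ≤ b → 0# ≤ c → a ≤ b → c ≤ d → a * c ≤ b * d
  *-mono-≤ 0≤b 0≤c p q = ≤-trans (*-monoʳ-≤ 0≤c p) (*-monoˡ-≤ 0≤b q)

  square-nonNegative : ∀ x → 0# ≤ x * x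
  square-nonNegative x = [ (λ p → *-nonNegative p p) , negative ]′ (total 0# x)
    where
    negative : x ≤ 0# → 0# ≤ x * x
    negative p = ≤-respʳ-≈ (solve 1 (λ x → (:- x) :* (:- x) := x :* x) refl x)
      (*-nonNegative 0≤-x 0≤-x)
      where
      0≤-x : 0# ≤ - x
      0≤-x = ≤-respˡ-≈ -0≈0 (neg-mono-≤ p)

  0≤1 : 0# ≤ 1#
  0≤1 = ≤-respʳ-≈ (*-identityˡ 1#) (square-nonNegative 1#)

  0<1 : 0# < 1#
  0<1 = 0≤1 , 0≉1

  >⇒≉ : ∀ {x} → 0# < x → ¬ (x ≈ 0#)
  >⇒≉ (_ , 0≉x) x≈0 = 0≉x (sym x≈0)

  ≰⇒> : ∀ {x y} → ¬ (x ≤ y) → y < x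
  ≰⇒> {x} {y} x≰y =
    [ (λ p → ⊥-elim (x≰y p)) , (λ p → p , λ y≈x → x≰y (≤-reflexive (sym y≈x))) ]′ (total x y)

  <⇒≱ : ∀ {x y} → x < y → ¬ (y ≤ x)
  <⇒≱ (x≤y , x≉y) y≤x = x≉y (antisym x≤y y≤x)

  <-respʳ-≈ : ∀ {x y z} → y ≈ z → x < y → x < z
  <-respʳ-≈ y≈z (p , q) = ≤-respʳ-≈ y≈z p , λ e → q (trans e (sym y≈z))

  <-≤-trans : ∀ {x y z} → x < y → y ≤ z → x < z
  <-≤-trans (p , q) r = ≤-trans p r , λ e → q (antisym p (≤-trans r (≤-reflexive (sym e))))

  <-respˡ-≈ : ∀ {x y z} → x ≈ y → x < z → y < z
  <-respˡ-≈ x≈y (p , q) = ≤-respˡ-≈ x≈y p , λ e → q (trans x≈y e)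

  ≤-<-trans : ∀ {x y z} → x ≤ y → y < z → x < z
  ≤-<-trans p (q , r) = ≤-trans p q , λ e → r (antisym q (≤-trans (≤-reflexive (sym e)) p))

  <⇒0<y-x : ∀ {x y} → x < y → 0# < y - x
  <⇒0<y-x (p , q) = ≤⇒0≤y-x p , λ e → q (sym (x-y≈0⇒x≈y _ _ (sym e)))

  0<y-x⇒< : ∀ {x y} → 0# < y - x → x < y
  0<y-x⇒< (p , q) = 0≤y-x⇒≤ p , λ x≈y → q (sym (trans (+-congˡ (-‿cong x≈y)) (-‿inverseʳ _)))

  neg-mono-< : ∀ {x y} → x < y → - y < - x
  neg-mono-< {x} {y} p = 0<y-x⇒<
    (<-respʳ-≈ (solve 2 (λ x y → y :- x := :- x :- :- y) refl x y) (<⇒0<y-x p))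

  +-monoʳ-< : ∀ z {x y} → x < y → z + x < z + y
  +-monoʳ-< z {x} {y} p = 0<y-x⇒<
    (<-respʳ-≈ (solve 3 (λ x y z → y :- x := z :+ y :- (z :+ x)) refl x y z) (<⇒0<y-x p))

  *-zero-product : ∀ {x y} → x * y ≈ 0# → ¬ (x ≈ 0#) → y ≈ 0#
  *-zero-product {x} {y} xy≈0 x≉0 = begin
    y                ≈⟨ *-identityˡ y ⟨
    1# * y           ≈⟨ *-congʳ (*-inverseʳ x≉0) ⟨
    x * x ⁻¹ * y     ≈⟨ solve 3 (λ x i y → x :* i :* y := i :* (x :* y)) refl x (x ⁻¹) y ⟩
    x ⁻¹ * (x * y)   ≈⟨ *-congˡ xy≈0 ⟩
    x ⁻¹ * 0#        ≈⟨ zeroʳ _ ⟩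
    0#               ∎
    where open ≈-Reasoning

  *-nonzero : ∀ {x y} → ¬ (x ≈ 0#) → ¬ (y ≈ 0#) → ¬ (x * y ≈ 0#)
  *-nonzero x≉0 y≉0 xy≈0 = y≉0 (*-zero-product xy≈0 x≉0)

  square-zero : ∀ {x} → x * x ≈ 0# → x ≈ 0#
  square-zero {x} xx≈0 with x ≟ 0#
  ... | yes x≈0 = x≈0
  ... | no  x≉0 = *-zero-product xx≈0 x≉0

  *-inverseˡ : ∀ {x} → ¬ (x ≈ 0#) → x ⁻¹ * x ≈ 1#
  *-inverseˡ x≉0 = trans (*-comm _ _) (*-inverseʳ x≉0)

  *-positive : ∀ {x y} → 0# < x → 0# < y → 0# < x * y
  *-positive p q = *-nonNegative (proj₁ p) (proj₁ q) ,
    λ e → *-nonzero (>⇒≉ p) (>⇒≉ q) (sym e)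

  +-positive : ∀ {x y} → 0# < x → 0# ≤ y → 0# < x + y
  +-positive {x} {y} p q = <-≤-trans p (≤-respˡ-≈ (+-identityʳ x) (+-monoʳ-≤ x q))

  ⁻¹-positive : ∀ {x} → 0# < x → 0# < x ⁻¹
  ⁻¹-positive {x} 0<x = ≤-respʳ-≈ x⁻¹x⁻¹x≈x⁻¹ (*-nonNegative (square-nonNegative (x ⁻¹)) (proj₁ 0<x))
    , λ 0≈x⁻¹ → 0≉1 (trans (sym (zeroʳ x)) (trans (*-congˡ 0≈x⁻¹) (*-inverseʳ x≉0)))
    where
    x≉0 = >⇒≉ 0<x
    x⁻¹x⁻¹x≈x⁻¹ : x ⁻¹ * x ⁻¹ * x ≈ x ⁻¹
    x⁻¹x⁻¹x≈x⁻¹ = trans (*-assoc _ _ _) (trans (*-congˡ (*-inverseˡ x≉0)) (*-identityʳ _))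

  ·1-nonNegative : ∀ n → 0# ≤ n · 1#
  ·1-nonNegative zero    = ≤-refl
  ·1-nonNegative (suc n) = +-nonNegative 0≤1 (·1-nonNegative n)

  ·1-positive : ∀ n → 0# < suc n · 1#
  ·1-positive n = +-positive 0<1 (·1-nonNegative n)

  -- Otherwise y < x, and both factors of x² - y² = (x - y)(x + y) are positive; the second one is
  -- (x - y) + 2y.
  square-cancel-≤ : ∀ {x y} → 0# ≤ y → x * x ≤ y * y → x ≤ y
  square-cancel-≤ {x} {y} 0≤y p with x ≤? y
  ... | yes x≤y = x≤y
  ... | no  x≰y = ⊥-elim (<⇒≱ (*-positive 0<x-y 0<x+y) (≤-respˡ-≈
      (solve 2 (λ x y → x :* x :- y :* y := (x :- y) :* (x :+ y)) refl x y)
      (≤-respʳ-≈ (-‿inverseʳ (y * y)) (+-monoˡ-≤ (- (y * y)) p))))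
    where
    y<x : y < x
    y<x = ≰⇒> x≰y
    0<x-y : 0# < x - y
    0<x-y = <⇒0<y-x y<x
    0<x+y : 0# < x + y
    0<x+y = <-respʳ-≈ (solve 2 (λ x y → x :- y :+ (y :+ y) := x :+ y) refl x y)
      (+-positive 0<x-y (+-nonNegative 0≤y 0≤y))

  -- If r² < x then r + δ is still a member for δ = (x - r²) / (2r + 1 + (x - r²));
  -- if r² > x then r - δ is still an upper bound for δ = (r² - x) / (2r).
  supremum-square : ∀ {x r} → 0# ≤ x → IsSupremum (λ y → y * y ≤ x) r → r * r ≈ x
  supremum-square {x} {r} 0≤x (r-ub , r-least) with r * r ≤? x | x ≤? r * r
  ... | yes p | yes q = antisym p q
  ... | yes p | no x≰r² = ⊥-elim (<⇒≱ 0<δ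
      (≤-respʳ-≈ (-‿inverseʳ r) (≤-respˡ-≈ (solve 2 (λ r δ → r :+ δ :- r := δ) refl r _)
        (+-monoˡ-≤ (- r) (r-ub (r + δ) [r+δ]²≤x)))))
    where
    d = x - r * r
    D = r + r + 1# + d
    δ = d * D ⁻¹
    0<d : 0# < d
    0<d = <⇒0<y-x (≰⇒> x≰r²)
    0≤r : 0# ≤ r
    0≤r = r-ub 0# (≤-respˡ-≈ (sym (zeroˡ 0#)) 0≤x)
    0≤r+r+1 : 0# ≤ r + r + 1#
    0≤r+r+1 = +-nonNegative (+-nonNegative 0≤r 0≤r) 0≤1
    0<D : 0# < D
    0<D = <-respʳ-≈ (+-comm _ _) (+-positive 0<d 0≤r+r+1)
    0<δ : 0# < δ
    0<δ = *-positive 0<d (⁻¹-positive 0<D)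
    δ*D≈d : δ * D ≈ d
    δ*D≈d = trans (*-assoc _ _ _) (trans (*-congˡ (*-inverseˡ (>⇒≉ 0<D))) (*-identityʳ d))
    δ≤1 : δ ≤ 1#
    δ≤1 = ≤-respʳ-≈ (*-inverseʳ (>⇒≉ 0<D)) (*-monoʳ-≤ (proj₁ (⁻¹-positive 0<D))
      (≤-respˡ-≈ (+-identityˡ d) (+-monoˡ-≤ d 0≤r+r+1)))
    2r+δ≤D : r + r + δ ≤ D
    2r+δ≤D = ≤-respˡ-≈ (+-identityʳ _) (+-mono-≤ (+-monoʳ-≤ (r + r) δ≤1) (proj₁ 0<d))
    [r+δ]²≤x : (r + δ) * (r + δ) ≤ x
    [r+δ]²≤x = begin
      (r + δ) * (r + δ)        ≈⟨ solve 2 (λ r δ → (r :+ δ) :* (r :+ δ) := r :* r :+ δ :* (r :+ r :+ δ)) refl r δ ⟩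
      r * r + δ * (r + r + δ)  ≤⟨ +-monoʳ-≤ (r * r) (*-monoˡ-≤ (proj₁ 0<δ) 2r+δ≤D) ⟩
      r * r + δ * D            ≈⟨ +-congˡ δ*D≈d ⟩
      r * r + (x - r * r)      ≈⟨ solve 2 (λ r x → r :* r :+ (x :- r :* r) := x) refl r x ⟩
      x                        ∎
      where open ≤-Reasoning
  ... | no r²≰x | _ = ⊥-elim (<⇒≱ 0<δ
      (≤-respʳ-≈ (solve 2 (λ r δ → r :- δ :- (r :- δ) := con (+ 0)) refl r δ)
        (≤-respˡ-≈ (solve 2 (λ r δ → r :- (r :- δ) := δ) refl r δ)
          (+-monoˡ-≤ (- (r - δ)) (r-least (r - δ) r-δ-ub)))))
    where
    d = r * r - x
    0<d : 0# < d
    0<d = <⇒0<y-x (≰⇒> r²≰x)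
    0≤r : 0# ≤ r
    0≤r = r-ub 0# (≤-respˡ-≈ (sym (zeroˡ 0#)) 0≤x)
    0<r : 0# < r
    0<r = 0≤r , λ 0≈r → r²≰x (≤-respˡ-≈ (trans (sym (zeroˡ r)) (*-congʳ 0≈r)) 0≤x)
    0<2r : 0# < r + r
    0<2r = +-positive 0<r 0≤r
    δ = d * (r + r) ⁻¹
    0<δ : 0# < δ
    0<δ = *-positive 0<d (⁻¹-positive 0<2r)
    δ*2r≈d : δ * (r + r) ≈ d
    δ*2r≈d = trans (*-assoc _ _ _) (trans (*-congˡ (*-inverseˡ (>⇒≉ 0<2r))) (*-identityʳ d))
    d≤r*2r : d ≤ r * (r + r)
    d≤r*2r = 0≤y-x⇒≤ (≤-respʳ-≈
      (solve 2 (λ r x → r :* r :+ x := r :* (r :+ r) :- (r :* r :- x)) refl r x)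
      (+-nonNegative (square-nonNegative r) 0≤x))
    δ≤r : δ ≤ r
    δ≤r = ≤-respʳ-≈ (trans (*-assoc _ _ _) (trans (*-congˡ (*-inverseʳ (>⇒≉ 0<2r))) (*-identityʳ r)))
      (*-monoʳ-≤ (proj₁ (⁻¹-positive 0<2r)) d≤r*2r)
    r-δ-ub : UpperBound (λ y → y * y ≤ x) (r - δ)
    r-δ-ub y y²≤x = square-cancel-≤ (≤⇒0≤y-x δ≤r) (≤-trans y²≤x (begin
      x                                 ≈⟨ +-identityʳ x ⟨
      x + 0#                            ≤⟨ +-monoʳ-≤ x (square-nonNegative δ) ⟩
      x + δ * δ
        ≈⟨ solve 3 (λ r x δ → x :+ δ :* δ := r :* r :- (r :* r :- x) :+ δ :* δ) refl r x δ ⟩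
      r * r - d + δ * δ                 ≈⟨ +-congʳ (+-congˡ (-‿cong δ*2r≈d)) ⟨
      r * r - δ * (r + r) + δ * δ
        ≈⟨ solve 2 (λ r δ → r :* r :- δ :* (r :+ r) :+ δ :* δ := (r :- δ) :* (r :- δ)) refl r δ ⟩
      (r - δ) * (r - δ)                 ∎))
      where open ≤-Reasoning

  √-square : ∀ {x} → 0# ≤ x → √ x * √ x ≈ x
  √-square {x} 0≤x with total 0# x
  ... | inj₁ p = supremum-square 0≤x (proj₂ (supremum _ _ _))
  -- At x ≈ 0 `total` may answer with either side; this is the case in which the root has its
  -- default value 0.
  ... | inj₂ x≤0 = trans (zeroˡ 0#) (antisym 0≤x x≤0)

  -- The supremum of the multiples of 1 would remain an upper bound after subtracting 1.
  archimedean : ExcludedMiddle 0ℓ → ∀ x → ∃ λ n → x < n · 1#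
  archimedean em x with em {P = ∃ λ n → x < n · 1#}
  ... | yes p = p
  ... | no ∄n = ⊥-elim (<⇒≱ 0<1 1≤0)
    where
    Multiple : ℝ → Set
    Multiple y = ∃ λ n → y ≈ n · 1#
    bounded : ∀ n → n · 1# ≤ x
    bounded n with n · 1# ≤? x
    ... | yes p = p
    ... | no ¬p = ⊥-elim (∄n (n , ≰⇒> ¬p))
    sup = supremum Multiple (0# , 0 , refl) (x , λ { y (n , y≈n) → ≤-respˡ-≈ (sym y≈n) (bounded n) })
    b = proj₁ sup
    b-1-ub : UpperBound Multiple (b - 1#)
    b-1-ub y (n , y≈n) = ≤-respˡ-≈ (trans (solve 1 (λ n → con (+ 1) :+ n :- con (+ 1) := n) refl (n · 1#)) (sym y≈n))
      (+-monoˡ-≤ (- 1#) (proj₁ (proj₂ sup) (suc n · 1#) (suc n , refl)))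
    1≤0 : 1# ≤ 0#
    1≤0 = ≤-respˡ-≈ (solve 1 (λ b → b :- (b :- con (+ 1)) := con (+ 1)) refl b)
      (≤-respʳ-≈ (-‿inverseʳ (b - 1#)) (+-monoˡ-≤ (- (b - 1#)) (proj₂ (proj₂ sup) (b - 1#) b-1-ub)))

-- Finite sums.

module Summation (ℛ : RealNumbers) where

  open SignComponents ℛ
  open OrderedField ℛ
  open SemiringSum semiring public
    using (sum-cong-≋; sum-remove; sum-permute; ∑-distrib-+; ∑-comm; sum-replicate-zero; *-distribˡ-sum; *-distribʳ-sum)

  sum-cong : ∀ {n} {f g : Vector ℝ n} → f ≈ᵥ g → sum f ≈ sum g
  sum-cong = sum-cong-≋

  sum-zero : ∀ {n} {f : Vector ℝ n} → (∀ i → f i ≈ 0#) → sum f ≈ 0#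
  sum-zero {n} p = trans (sum-cong p) (sum-replicate-zero n)

  sum-single : ∀ {n} {f : Vector ℝ n} k → (∀ i → i ≢ k → f i ≈ 0#) → sum f ≈ f k
  sum-single {suc n} {f} k p = trans (sum-remove {i = k} f)
    (trans (+-congˡ (sum-zero (λ i → p (punchIn k i) (punchInᵢ≢i k i)))) (+-identityʳ _))

  sum-nonNegative : ∀ {n} {f : Vector ℝ n} → (∀ i → 0# ≤ f i) → 0# ≤ sum f
  sum-nonNegative {zero}  p = ≤-refl
  sum-nonNegative {suc n} p = +-nonNegative (p zero) (sum-nonNegative (p ∘ suc))

  sum-mono-≤ : ∀ {n} {f g : Vector ℝ n} → (∀ i → f i ≤ g i) → sum f ≤ sum g
  sum-mono-≤ {zero}  p = ≤-refl
  sum-mono-≤ {suc n} p = +-mono-≤ (p zero) (sum-mono-≤ (p ∘ suc))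

  sum-neg : ∀ {n} (f : Vector ℝ n) → sum (λ i → - f i) ≈ - sum f
  sum-neg {zero}  f = sym -0≈0
  sum-neg {suc n} f = trans (+-congˡ (sum-neg (tail f)))
    (solve 2 (λ a b → :- a :+ :- b := :- (a :+ b)) refl (f zero) (sum (tail f)))

  sum-sub : ∀ {n} (f g : Vector ℝ n) → sum (λ i → f i - g i) ≈ sum f - sum g
  sum-sub f g = trans (∑-distrib-+ f (λ i → - g i)) (+-congˡ (sum-neg g))

  term≤sum : ∀ {n} {f : Vector ℝ n} → (∀ i → 0# ≤ f i) → ∀ k → f k ≤ sum f
  term≤sum {suc n} {f} p k = ≤-respʳ-≈ (sym (sum-remove {i = k} f))
    (≤-respˡ-≈ (+-identityʳ (f k)) (+-monoʳ-≤ (f k) (sum-nonNegative (λ i → p (punchIn k i)))))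

  sum-nonNegative-zero : ∀ {n} {f : Vector ℝ n} → (∀ i → 0# ≤ f i) → sum f ≈ 0# → ∀ k → f k ≈ 0#
  sum-nonNegative-zero p q k = antisym (≤-trans (term≤sum p k) (≤-reflexive q)) (p k)

  find-nonzero : ∀ {n} (x : Vector ℝ n) → (∃ λ j → ¬ (x j ≈ 0#)) ⊎ (∀ j → x j ≈ 0#)
  find-nonzero x with Fin.any? (λ j → ¬? (x j ≟ 0#))
  ... | yes p = inj₁ p
  ... | no ∄j = inj₂ vanishes
    where
    vanishes : ∀ j → x j ≈ 0#
    vanishes j with x j ≟ 0#
    ... | yes p = p
    ... | no ¬p = ⊥-elim (∄j (j , ¬p))

  nonzero-entry : ∀ {n} {x : Vector ℝ n} → ¬ (∀ j → x j ≈ 0#) → ∃ λ j → ¬ (x j ≈ 0#)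
  nonzero-entry {x = x} x≉0 = [ id , (λ x≈0 → ⊥-elim (x≉0 x≈0)) ]′ (find-nonzero x)

  -- Kronecker symbol with two arguments, standard basis vector with one.
  δ : ∀ {n} → Fin n → Vector ℝ n
  δ i j with i Fin.≟ j
  ... | yes _ = 1#
  ... | no  _ = 0#

  δ-same : ∀ {n} (i : Fin n) → δ i i ≈ 1#
  δ-same i with i Fin.≟ i
  ... | yes _ = refl
  ... | no ¬p = ⊥-elim (¬p ≡.refl)

  δ-diff : ∀ {n} {i j : Fin n} → i ≢ j → δ i j ≈ 0#
  δ-diff {i = i} {j} i≢j with i Fin.≟ j
  ... | yes p = ⊥-elim (i≢j p)
  ... | no  _ = refl

  sum-δˡ : ∀ {n} (k : Fin n) (f : Vector ℝ n) → sum (λ i → δ k i * f i) ≈ f k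
  sum-δˡ k f = trans (sum-single k (λ i i≢k → trans (*-congʳ (δ-diff (i≢k ∘ ≡.sym))) (zeroˡ _)))
    (trans (*-congʳ (δ-same k)) (*-identityˡ _))

-- Inner products, spans and dimension.

module LinearAlgebra (ℛ : RealNumbers) where

  open SignComponents ℛ
  open OrderedField ℛ
  open Summation ℛ

  infixl 6 _-ᵥ_
  _-ᵥ_ : ∀ {n} → Vector ℝ n → Vector ℝ n → Vector ℝ n
  (x -ᵥ y) i = x i - y i

  ⟨⟩-cong : ∀ {n} {x x′ y y′ : Vector ℝ n} → x ≈ᵥ x′ → y ≈ᵥ y′ → ⟨ x , y ⟩ ≈ ⟨ x′ , y′ ⟩
  ⟨⟩-cong p q = sum-cong (λ i → *-cong (p i) (q i))

  ⟨⟩-comm : ∀ {n} (x y : Vector ℝ n) → ⟨ x , y ⟩ ≈ ⟨ y , x ⟩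
  ⟨⟩-comm x y = sum-cong (λ i → *-comm (x i) (y i))

  ⟨⟩-nonNegative : ∀ {n} (x : Vector ℝ n) → 0# ≤ ⟨ x , x ⟩
  ⟨⟩-nonNegative x = sum-nonNegative (λ i → square-nonNegative (x i))

  ⟨⟩-zero : ∀ {n} {x : Vector ℝ n} → ⟨ x , x ⟩ ≈ 0# → ∀ i → x i ≈ 0#
  ⟨⟩-zero {x = x} p i = square-zero (sum-nonNegative-zero (λ i → square-nonNegative (x i)) p i)

  ⟨⟩-scaleʳ : ∀ {n} (x y : Vector ℝ n) c → ⟨ x , (λ i → c * y i) ⟩ ≈ c * ⟨ x , y ⟩
  ⟨⟩-scaleʳ x y c = trans
    (sum-cong (λ i → solve 3 (λ x c y → x :* (c :* y) := c :* (x :* y)) refl (x i) c (y i)))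
    (sym (*-distribˡ-sum c (λ i → x i * y i)))

  ⟨⟩-scaleˡ : ∀ {n} c (x y : Vector ℝ n) → ⟨ (λ i → c * x i) , y ⟩ ≈ c * ⟨ x , y ⟩
  ⟨⟩-scaleˡ c x y = trans (⟨⟩-comm _ y) (trans (⟨⟩-scaleʳ y x c) (*-congˡ (⟨⟩-comm y x)))

  ⟨⟩-subʳ : ∀ {n} (x y z : Vector ℝ n) → ⟨ x , y -ᵥ z ⟩ ≈ ⟨ x , y ⟩ - ⟨ x , z ⟩
  ⟨⟩-subʳ {n} x y z = trans
    (sum-cong {n} (λ i → solve 3 (λ x y z → x :* (y :- z) := x :* y :- x :* z) refl (x i) (y i) (z i)))
    (sum-sub (λ i → x i * y i) (λ i → x i * z i))

  ⟨⟩-subˡ : ∀ {n} (y z x : Vector ℝ n) → ⟨ y -ᵥ z , x ⟩ ≈ ⟨ y , x ⟩ - ⟨ z , x ⟩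
  ⟨⟩-subˡ y z x = trans (⟨⟩-comm _ x)
    (trans (⟨⟩-subʳ x y z) (+-cong (⟨⟩-comm x y) (-‿cong (⟨⟩-comm x z))))

  ⟨⟩-combinationʳ : ∀ {n k} (x : Vector ℝ n) (c : Vector ℝ k) v →
                    ⟨ x , combination c v ⟩ ≈ sum (λ j → c j * ⟨ x , v j ⟩)
  ⟨⟩-combinationʳ {n} {k} x c v = begin
    sum (λ i → x i * sum (λ j → c j * v j i))     ≈⟨ sum-cong (λ i → *-distribˡ-sum {k} (x i) _) ⟩
    sum (λ i → sum (λ j → x i * (c j * v j i)))   ≈⟨ ∑-comm {n} {k} _ ⟩
    sum (λ j → sum (λ i → x i * (c j * v j i)))   ≈⟨ sum-cong (λ j → ⟨⟩-scaleʳ x (v j) (c j)) ⟩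
    sum (λ j → c j * ⟨ x , v j ⟩)                 ∎
    where open ≈-Reasoning

  ⟨⟩-combinationˡ : ∀ {n k} (c : Vector ℝ k) v (x : Vector ℝ n) →
                    ⟨ combination c v , x ⟩ ≈ sum (λ j → c j * ⟨ v j , x ⟩)
  ⟨⟩-combinationˡ c v x = trans (⟨⟩-comm _ x)
    (trans (⟨⟩-combinationʳ x c v) (sum-cong (λ j → *-congˡ (⟨⟩-comm x (v j)))))

  combination-cong : ∀ {n k} {c c′ : Vector ℝ k} {v v′ : Fin k → Vector ℝ n} →
                     c ≈ᵥ c′ → (∀ j → v j ≈ᵥ v′ j) → combination c v ≈ᵥ combination c′ v′
  combination-cong p q i = sum-cong (λ j → *-cong (p j) (q j i))

  -- `InSpan` selects finitely many indices, possibly with repetitions, from any index set. For a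
  -- finite family one coefficient per vector is enough, and coefficient vectors of this kind
  -- compose like matrices.
  Span : ∀ {n k} → (Fin k → Vector ℝ n) → Vector ℝ n → Set
  Span v x = ∃ λ c → x ≈ᵥ combination c v

  span-member : ∀ {n k} (v : Fin k → Vector ℝ n) j → Span v (v j)
  span-member v j = δ j , λ i → sym (sum-δˡ j (λ k → v k i))

  span-resp : ∀ {n k} {v : Fin k → Vector ℝ n} {x y} → x ≈ᵥ y → Span v x → Span v y
  span-resp x≈y (c , p) = c , λ i → trans (sym (x≈y i)) (p i)

  combination-assoc : ∀ {n k l} (c : Vector ℝ l) (C : Fin l → Vector ℝ k) (v : Fin k → Vector ℝ n) →
    combination c (λ j → combination (C j) v) ≈ᵥ combination (combination c C) v
  combination-assoc {k = k} {l} c C v i = begin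
    sum (λ j → c j * sum (λ k → C j k * v k i))    ≈⟨ sum-cong (λ j → *-distribˡ-sum {k} (c j) _) ⟩
    sum (λ j → sum (λ k → c j * (C j k * v k i)))  ≈⟨ ∑-comm {l} {k} _ ⟩
    sum (λ k → sum (λ j → c j * (C j k * v k i)))  ≈⟨ sum-cong {k} (λ k → sum-cong {l} (λ j → sym (*-assoc _ _ _))) ⟩
    sum (λ k → sum (λ j → c j * C j k * v k i))    ≈⟨ sum-cong (λ k → *-distribʳ-sum {l} (v k i) _) ⟨
    sum (λ k → sum (λ j → c j * C j k) * v k i)    ∎
    where open ≈-Reasoning

  span-combination : ∀ {n k l} {v : Fin k → Vector ℝ n} {w : Fin l → Vector ℝ n} →
                     (∀ j → Span v (w j)) → ∀ c → Span v (combination c w)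
  span-combination {v = v} p c = combination c (proj₁ ∘ p) , λ i → trans
    (combination-cong {c = c} (λ _ → refl) (proj₂ ∘ p) i) (combination-assoc c (proj₁ ∘ p) v i)

  span-trans : ∀ {n k l} {v : Fin k → Vector ℝ n} {w : Fin l → Vector ℝ n} {x} →
               (∀ j → Span v (w j)) → Span w x → Span v x
  span-trans p (c , q) = span-resp (λ i → sym (q i)) (span-combination p c)

  InSpan⇒Span : ∀ {n k} {v : Fin k → Vector ℝ n} {x} → InSpan v x → Span v x
  InSpan⇒Span {v = v} (_ , f , c , p) = span-trans (λ j → span-member v (f j)) (c , p)

  Span⇒InSpan : ∀ {n k} {v : Fin k → Vector ℝ n} {x} → Span v x → InSpan v x
  Span⇒InSpan (c , p) = _ , id , c , p

  -- Gaussian elimination on the first of m equations in d + 1 > m unknowns: it is dropped if all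
  -- its coefficients vanish; otherwise a pivot unknown is eliminated from the remaining equations
  -- and recovered afterwards.
  kernel : ∀ m {d} → m ℕ.≤ d → (C : Fin (suc d) → Vector ℝ m) →
           ∃ λ x → (∃ λ i → ¬ (x i ≈ 0#)) × combination x C ≈ᵥ (λ _ → 0#)
  kernel zero    m≤d C = (λ _ → 1#) , (zero , λ e → 0≉1 (sym e)) , λ ()
  kernel (suc m) {suc d} (ℕ.s≤s m≤d) C with find-nonzero (λ i → C i zero)
  ... | inj₂ C₀≈0 = x , nz , λ { zero → sum-zero {f = λ i → x i * C i zero} (λ i → trans (*-congˡ (C₀≈0 i)) (zeroʳ (x i))) ; (suc k) → p k }
    where
    ih = kernel m (ℕ.m≤n⇒m≤1+n m≤d) (λ i k → C i (suc k))
    x = proj₁ ih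
    nz = proj₁ (proj₂ ih)
    p = proj₂ (proj₂ ih)
  ... | inj₁ (i₀ , pivot≉0) = x , nz , vanishes
    where
    open ≈-Reasoning
    ι = C i₀ zero ⁻¹
    R : Fin (suc d) → Vector ℝ (suc m)
    R i = C (punchIn i₀ i)
    C′ : Fin (suc d) → Vector ℝ m
    C′ i k = R i (suc k) - R i zero * ι * C i₀ (suc k)
    ih = kernel m m≤d C′
    x′ = proj₁ ih
    T = sum (λ i → x′ i * R i zero)
    -- The coefficient of the pivot row is the one that makes the first coordinate of the
    -- combination vanish.
    t = - (T * ι)
    x = insertAt x′ i₀ t
    nz : ∃ λ i → ¬ (x i ≈ 0#)
    nz = let (i , q) = proj₁ (proj₂ ih) in
      punchIn i₀ i , λ e → q (trans (reflexive (≡.sym (insertAt-punchIn x′ i₀ t i))) e)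
    split : ∀ k → combination x C k ≈ t * C i₀ k + sum (λ i → x′ i * R i k)
    split k = trans (sum-remove {i = i₀} (λ i → x i * C i k))
      (+-cong (*-congʳ (reflexive (insertAt-lookup x′ i₀ t)))
        (sum-cong (λ i → *-congʳ {R i k} (reflexive (insertAt-punchIn x′ i₀ t i)))))
    vanishes : ∀ k → combination x C k ≈ 0#
    vanishes zero = trans (split zero) (begin
      - (T * ι) * C i₀ zero + T
        ≈⟨ solve 3 (λ T ι c → :- (T :* ι) :* c :+ T := T :- T :* (ι :* c)) refl T ι (C i₀ zero) ⟩
      T - T * (ι * C i₀ zero)     ≈⟨ +-congˡ (-‿cong (trans (*-congˡ (*-inverseˡ pivot≉0)) (*-identityʳ T))) ⟩
      T - T                       ≈⟨ -‿inverseʳ T ⟩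
      0#                          ∎)
    vanishes (suc k) = trans (split (suc k)) (begin
      - (T * ι) * c + sum (λ i → x′ i * R i (suc k))
        ≈⟨ solve 4 (λ T ι c S → :- (T :* ι) :* c :+ S := S :- T :* (ι :* c)) refl T ι c _ ⟩
      sum (λ i → x′ i * R i (suc k)) - T * (ι * c)
        ≈⟨ +-congˡ (-‿cong (*-distribʳ-sum (ι * c) (λ i → x′ i * R i zero))) ⟩
      sum (λ i → x′ i * R i (suc k)) - sum (λ i → x′ i * R i zero * (ι * c))
        ≈⟨ sum-sub (λ i → x′ i * R i (suc k)) (λ i → x′ i * R i zero * (ι * c)) ⟨
      sum (λ i → x′ i * R i (suc k) - x′ i * R i zero * (ι * c))
        ≈⟨ sum-cong (λ i → solve 5 (λ x a b ι c → x :* a :- x :* b :* (ι :* c) := x :* (a :- b :* ι :* c)) refl (x′ i) (R i (suc k)) (R i zero) ι c) ⟩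
      sum (λ i → x′ i * C′ i k)                                         ≈⟨ proj₂ (proj₂ ih) k ⟩
      0#                                                                ∎)
      where c = C i₀ (suc k)

  -- Exchange lemma by counting: if d > m, the d coefficient vectors of b with respect to v have m
  -- entries each, and `kernel` yields a nontrivial relation among them, hence among the vectors of
  -- b.
  independent-≤ : ∀ {n d m} {b : Fin d → Vector ℝ n} {v : Fin m → Vector ℝ n} →
                  LinearlyIndependent b → (∀ j → Span v (b j)) → d ℕ.≤ m
  independent-≤ {d = d} {m} {b} {v} b-indep b∈v with d ℕ.≤? m
  ... | yes d≤m = d≤m
  independent-≤ {d = zero}  b-indep b∈v | no d≰m = ⊥-elim (d≰m ℕ.z≤n)
  independent-≤ {d = suc d} {m} {b} {v} b-indep b∈v | no d≰m =
    let (x , (i , xᵢ≉0) , xC≈0) = kernel m (ℕ.s≤s⁻¹ (ℕ.≰⇒> d≰m)) (proj₁ ∘ b∈v) in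
    ⊥-elim (xᵢ≉0 (b-indep x (λ j → trans (proj₂ (span-combination b∈v x) j)
      (sum-zero (λ k → trans (*-congʳ (xC≈0 k)) (zeroˡ _)))) i))

  -- A relation with c k ≠ 0 would express v k by the other d - 1 vectors; these would then span d
  -- independent ones.
  spanning⇒independent : ∀ {n d} {b v : Fin d → Vector ℝ n} →
    LinearlyIndependent b → (∀ j → Span v (b j)) → LinearlyIndependent v
  spanning⇒independent {d = suc d} {b} {v} b-indep b∈v c cv≈0 k with c k ≟ 0#
  ... | yes cₖ≈0 = cₖ≈0
  ... | no  cₖ≉0 = ⊥-elim (ℕ.1+n≰n (independent-≤ b-indep (λ j → span-trans v∈v′ (b∈v j))))
    where
    open ≈-Reasoning
    v′ : Fin d → Vector ℝ _
    v′ = removeAt v k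
    c′ : Vector ℝ d
    c′ j = - (c k ⁻¹ * c (punchIn k j))
    vₖ∈v′ : Span v′ (v k)
    vₖ∈v′ = c′ , λ i → begin
      v k i                                                   ≈⟨ *-identityˡ _ ⟨
      1# * v k i                                              ≈⟨ *-congʳ (*-inverseˡ cₖ≉0) ⟨
      c k ⁻¹ * c k * v k i
        ≈⟨ solve 4 (λ ι c v s → ι :* c :* v := ι :* (c :* v :+ s) :- ι :* s) refl (c k ⁻¹) (c k) (v k i) (S i) ⟩
      c k ⁻¹ * (c k * v k i + S i) - c k ⁻¹ * S i
        ≈⟨ +-congʳ (*-congˡ (trans (sym (sum-remove {i = k} (λ j → c j * v j i))) (cv≈0 i))) ⟩
      c k ⁻¹ * 0# - c k ⁻¹ * S i
        ≈⟨ solve 2 (λ ι s → ι :* con (+ 0) :- ι :* s := (:- ι) :* s) refl (c k ⁻¹) (S i) ⟩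
      (- c k ⁻¹) * S i
        ≈⟨ *-distribˡ-sum (- c k ⁻¹) (λ j → c (punchIn k j) * v′ j i) ⟩
      sum (λ j → (- c k ⁻¹) * (c (punchIn k j) * v′ j i))
        ≈⟨ sum-cong (λ j → solve 3 (λ ι c v → (:- ι) :* (c :* v) := :- (ι :* c) :* v) refl (c k ⁻¹) (c (punchIn k j)) (v′ j i)) ⟩
      combination c′ v′ i                                     ∎
      where
      S : Vector ℝ _
      S i = sum (λ j → c (punchIn k j) * v′ j i)
    v∈v′ : ∀ j → Span v′ (v j)
    v∈v′ j with k Fin.≟ j
    ... | yes ≡.refl = vₖ∈v′
    ... | no  k≢j    = ≡.subst (λ j → Span v′ (v j)) (punchIn-punchOut k≢j) (span-member v′ (punchOut k≢j))

-- Values of the programs: Gram-Schmidt, dual vectors, factorisation, linear systems.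

module Programs (ℛ : RealNumbers) where

  open SignComponents ℛ
  open OrderedField ℛ
  open Summation ℛ
  open LinearAlgebra ℛ

  each-value : ∀ {A : Set} {n} (p : Fin n → Counted A) i → value (each p) i ≡ value (p i)
  each-value {n = suc n} p zero    = ≡.refl
  each-value {n = suc n} p (suc i) = each-value (p ∘ suc) i

  each-value-≈ : ∀ {n} (p : Fin n → Counted ℝ) → value (each p) ≈ᵥ (λ i → value (p i))
  each-value-≈ p i = reflexive (each-value p i)

  total-of-value : ∀ {n} (x : Vector ℝ n) → value (total-of x) ≈ sum x
  total-of-value {zero}  x = refl
  total-of-value {suc n} x = +-congˡ (total-of-value (tail x))

  inner-value : ∀ {n} (x y : Vector ℝ n) → value (inner x y) ≈ ⟨ x , y ⟩
  inner-value {n} x y = trans (total-of-value {n} _) (sum-cong (each-value-≈ λ i → mul (x i) (y i)))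

  scale-value : ∀ {n} c (x : Vector ℝ n) → value (scale c x) ≈ᵥ (λ i → c * x i)
  scale-value c x = each-value-≈ λ i → mul c (x i)

  subtract-value : ∀ {n} (x y : Vector ℝ n) → value (subtract x y) ≈ᵥ x -ᵥ y
  subtract-value x y = each-value-≈ λ i → sub (x i) (y i)

  combine-value : ∀ {n k} (c : Vector ℝ k) (v : Fin k → Vector ℝ n) →
                  value (combine c v) ≈ᵥ combination c v
  combine-value c v i = trans (each-value-≈ (λ i → inner c (λ j → v j i)) i) (inner-value c _)

  dyadᶜ-value : ∀ {n} (s : Vector ℝ n) → value (dyadᶜ s) ≈ₘ dyad s
  dyadᶜ-value s i j = trans
    (reflexive (≡.cong (_$ j) (each-value (λ i → each λ j → mul (s i) (s j)) i)))
    (each-value-≈ (λ j → mul (s i) (s j)) j)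

  affineᶜ-value : ∀ {n} ζ (X Y : Matrix n n) → value (affineᶜ ζ X Y) ≈ₘ affine ζ X Y
  affineᶜ-value ζ X Y i j = trans
    (reflexive (≡.cong (_$ j) (each-value (λ i → each λ j → entry i j) i)))
    (each-value-≈ (entry i) j)
    where
    entry : ∀ i j → Counted ℝ
    entry i j = mul ζ (X i j) >>= λ x → mul (1# - ζ) (Y i j) >>= λ y → add x y

  Orthonormal : ∀ {n k} → (Fin k → Vector ℝ n) → Set
  Orthonormal u = (∀ i → ⟨ u i , u i ⟩ ≈ 1#) × (∀ i j → i ≢ j → ⟨ u i , u j ⟩ ≈ 0#)

  project : ∀ {n k} → (Fin k → Vector ℝ n) → Vector ℝ n → Vector ℝ n
  project u x = combination (λ j → ⟨ u j , x ⟩) u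

  project-inner : ∀ {n k} {u : Fin k → Vector ℝ n} → Orthonormal u →
                  ∀ x j → ⟨ u j , project u x ⟩ ≈ ⟨ u j , x ⟩
  project-inner {u = u} (unit , orth) x j = begin
    ⟨ u j , project u x ⟩                   ≈⟨ ⟨⟩-combinationʳ (u j) _ u ⟩
    sum (λ i → ⟨ u i , x ⟩ * ⟨ u j , u i ⟩)
      ≈⟨ sum-single j (λ i i≢j → trans (*-congˡ (orth j i (i≢j ∘ ≡.sym))) (zeroʳ _)) ⟩
    ⟨ u j , x ⟩ * ⟨ u j , u j ⟩             ≈⟨ trans (*-congˡ (unit j)) (*-identityʳ _) ⟩
    ⟨ u j , x ⟩                             ∎
    where open ≈-Reasoning

  residual-orthogonal : ∀ {n k} {u : Fin k → Vector ℝ n} → Orthonormal u →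
                        ∀ x j → ⟨ u j , x -ᵥ project u x ⟩ ≈ 0#
  residual-orthogonal {u = u} u-on x j = trans (⟨⟩-subʳ (u j) x (project u x))
    (trans (+-congˡ (-‿cong (project-inner u-on x j))) (-‿inverseʳ _))

  span-scale : ∀ {n k} {v : Fin k → Vector ℝ n} {x} a → Span v x → Span v (λ i → a * x i)
  span-scale {k = k} {v} a (c , p) = (λ j → a * c j) , λ i → trans (*-congˡ (p i))
    (trans (*-distribˡ-sum {k} a _) (sum-cong {k} (λ j → sym (*-assoc a (c j) (v j i)))))

  span-sub : ∀ {n k} {v : Fin k → Vector ℝ n} {x y} → Span v x → Span v y → Span v (x -ᵥ y)
  span-sub {k = k} {v} (c , p) (d , q) = (λ j → c j - d j) , λ i → trans (+-cong (p i) (-‿cong (q i)))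
    (trans (sym (sum-sub {k} _ _))
      (sum-cong {k} (λ j → solve 3 (λ c d v → c :* v :- d :* v := (c :- d) :* v) refl (c j) (d j) (v j i))))

  span-tail : ∀ {n k} (v : Fin (suc k) → Vector ℝ n) {x} → Span (tail v) x → Span v x
  span-tail v = span-trans {v = v} {w = tail v} (λ j → span-member v (suc j))

  OrthonormalBasis : ∀ {n k m} → (Fin k → Vector ℝ n) → (Fin m → Vector ℝ n) → Set
  OrthonormalBasis u v = Orthonormal u × (∀ j → Span v (u j)) × (∀ j → Span u (v j))

  -- The final part of `gramSchmidt`, with the outcome of the zero test as an argument so that both
  -- cases can be treated by matching.
  extend : ∀ {n k} → (Fin k → Vector ℝ n) → Vector ℝ n → ℝ → Bool →
           Counted (∃ λ k → Fin k → Vector ℝ n)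
  extend {k = k} u w q z = if z then return (k , u) else
    (sqrt q >>= λ l → inv l >>= λ l⁻¹ → scale l⁻¹ w >>= λ e → return (suc k , e ∷ u))

  -- w is the component of `head v` orthogonal to u. If it vanishes, `head v` already lies in the
  -- span of u; otherwise `head v` is √⟨w, w⟩ times the new unit vector plus its projection.
  extend-basis : ∀ {n m k} (v : Fin (suc m) → Vector ℝ n) (u : Fin k → Vector ℝ n) w q →
    (d : Dec (q ≈ 0#)) → OrthonormalBasis u (tail v) →
    w ≈ᵥ head v -ᵥ project u (head v) → q ≈ ⟨ w , w ⟩ →
    OrthonormalBasis (proj₂ (value (extend u w q (does d)))) v
  extend-basis v u w q (yes q≈0) (u-on , u∈v , v∈u) w-def q-def = u-on , (λ j → span-tail v (u∈v j)) ,
    λ { zero → (λ j → ⟨ u j , head v ⟩) , λ i → x-y≈0⇒x≈y _ _ (trans (sym (w-def i)) (w≈0 i))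
      ; (suc j) → v∈u j }
    where
    w≈0 : ∀ i → w i ≈ 0#
    w≈0 = ⟨⟩-zero (trans (sym q-def) q≈0)
  extend-basis {k = k} v u w q (no q≉0) ((unit , orth) , u∈v , v∈u) w-def q-def =
    (unit′ , orth′) , eu∈v , v∈eu
    where
    open ≈-Reasoning
    l = √ q
    ι = l ⁻¹
    l²≈q : l * l ≈ q
    l²≈q = √-square (≤-respʳ-≈ (sym q-def) (⟨⟩-nonNegative w))
    l≉0 : ¬ (l ≈ 0#)
    l≉0 l≈0 = q≉0 (trans (sym l²≈q) (trans (*-congʳ l≈0) (zeroˡ l)))
    e = value (scale ι w)
    e≈ιw : e ≈ᵥ (λ i → ι * w i)
    e≈ιw = scale-value ι w
    eu : Fin (suc k) → Vector ℝ _
    eu = e ∷ u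
    e-inner : ∀ x → ⟨ e , x ⟩ ≈ ι * ⟨ w , x ⟩
    e-inner x = trans (⟨⟩-cong e≈ιw (λ _ → refl)) (⟨⟩-scaleˡ ι w x)
    ⟨e,e⟩≈1 : ⟨ e , e ⟩ ≈ 1#
    ⟨e,e⟩≈1 = begin
      ⟨ e , e ⟩              ≈⟨ e-inner e ⟩
      ι * ⟨ w , e ⟩          ≈⟨ *-congˡ (trans (⟨⟩-comm w e) (e-inner w)) ⟩
      ι * (ι * ⟨ w , w ⟩)    ≈⟨ *-congˡ (*-congˡ (trans (sym q-def) (sym l²≈q))) ⟩
      ι * (ι * (l * l))      ≈⟨ solve 2 (λ ι l → ι :* (ι :* (l :* l)) := (l :* ι) :* (l :* ι)) refl ι l ⟩
      (l * ι) * (l * ι)      ≈⟨ *-cong (*-inverseʳ l≉0) (*-inverseʳ l≉0) ⟩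
      1# * 1#                ≈⟨ *-identityˡ 1# ⟩
      1#                     ∎
    ⟨e,u⟩≈0 : ∀ j → ⟨ e , u j ⟩ ≈ 0#
    ⟨e,u⟩≈0 j = trans (e-inner (u j)) (trans (*-congˡ (begin
      ⟨ w , u j ⟩                              ≈⟨ ⟨⟩-cong w-def (λ _ → refl) ⟩
      ⟨ head v -ᵥ project u (head v) , u j ⟩   ≈⟨ ⟨⟩-comm _ (u j) ⟩
      ⟨ u j , head v -ᵥ project u (head v) ⟩   ≈⟨ residual-orthogonal (unit , orth) (head v) j ⟩
      0#                                       ∎)) (zeroʳ ι))
    unit′ : ∀ i → ⟨ eu i , eu i ⟩ ≈ 1#
    unit′ zero    = ⟨e,e⟩≈1
    unit′ (suc i) = unit i
    orth′ : ∀ i j → i ≢ j → ⟨ eu i , eu j ⟩ ≈ 0#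
    orth′ zero    zero    i≢j = ⊥-elim (i≢j ≡.refl)
    orth′ zero    (suc j) i≢j = ⟨e,u⟩≈0 j
    orth′ (suc i) zero    i≢j = trans (⟨⟩-comm (u i) e) (⟨e,u⟩≈0 i)
    orth′ (suc i) (suc j) i≢j = orth i j (i≢j ∘ ≡.cong suc)
    eu∈v : ∀ j → Span v (eu j)
    eu∈v zero = span-resp {v = v} (λ i → trans (*-congˡ (sym (w-def i))) (sym (e≈ιw i)))
      (span-scale {v = v} ι (span-sub {v = v} (span-member v zero)
        (span-tail v (span-combination u∈v (λ j → ⟨ u j , head v ⟩)))))
    eu∈v (suc j) = span-tail v (u∈v j)
    v∈eu : ∀ j → Span eu (v j)
    v∈eu zero = l ∷ (λ j → ⟨ u j , head v ⟩) , λ i → begin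
      head v i
        ≈⟨ solve 2 (λ h p → h := h :- p :+ p) refl (head v i) (project u (head v) i) ⟩
      (head v -ᵥ project u (head v)) i + project u (head v) i
        ≈⟨ +-congʳ (w-def i) ⟨
      w i + project u (head v) i                      ≈⟨ +-congʳ (*-identityˡ (w i)) ⟨
      1# * w i + project u (head v) i
        ≈⟨ +-congʳ (trans (*-congʳ (sym (*-inverseʳ l≉0))) (trans (*-assoc l ι (w i)) (*-congˡ (sym (e≈ιw i))))) ⟩
      l * e i + project u (head v) i                  ∎
    v∈eu (suc j) = span-tail eu (v∈u j)

  gramSchmidt-correct : ∀ {n m} (v : Fin m → Vector ℝ n) →
                        OrthonormalBasis (proj₂ (value (gramSchmidt v))) v
  gramSchmidt-correct {m = zero}  v = ((λ ()) , (λ ())) , (λ ()) , (λ ())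
  gramSchmidt-correct {m = suc m} v =
    extend-basis v u w (value (inner w w)) (value (inner w w) ≟ 0#) (gramSchmidt-correct (tail v))
      (λ i → trans (subtract-value (head v) p i) (+-congˡ (-‿cong (trans (combine-value c u i)
        (combination-cong {v = u} {v′ = u} (λ j → trans (each-value-≈ (λ j → inner (u j) (head v)) j) (inner-value (u j) (head v)))
          (λ _ _ → refl) i)))))
      (inner-value w w)
    where
    u = proj₂ (value (gramSchmidt (tail v)))
    c = value (each λ j → inner (u j) (head v))
    p = value (combine c u)
    w = value (subtract (head v) p)

  orthonormalBasis-correct : ∀ {m n} (X : Matrix m n) →
                             IsOrthonormalBasisOfRange X (proj₂ (value (orthonormalBasis X)))
  orthonormalBasis-correct X =
    let ((unit , orth) , u∈X , X∈u) = gramSchmidt-correct (column X) in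
    unit , orth , (λ j → Span⇒InSpan (u∈X j)) , (λ j → Span⇒InSpan (X∈u j))

  residual-from-basis : ∀ {n k m} {u : Fin k → Vector ℝ n} {v : Fin m → Vector ℝ n} → OrthonormalBasis u v →
    ∀ x → ∃ λ w → (∀ j → ⟨ v j , w ⟩ ≈ 0#) × Span v (x -ᵥ w)
  residual-from-basis {u = u} {v} (u-on , u∈v , v∈u) x = x -ᵥ project u x , v⊥ ,
      span-resp {v = v} (λ i → solve 2 (λ x p → p := x :- (x :- p)) refl (x i) (project u x i))
        (span-combination u∈v (λ j → ⟨ u j , x ⟩))
    where
    v⊥ : ∀ j → ⟨ v j , x -ᵥ project u x ⟩ ≈ 0#
    v⊥ j = let (c , p) = v∈u j in
      trans (⟨⟩-cong p (λ _ → refl)) (trans (⟨⟩-combinationˡ c u _)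
        (sum-zero (λ i → trans (*-congˡ (residual-orthogonal u-on x i)) (zeroʳ _))))

  -- w is the component of v i orthogonal to the other vectors. It is a combination of v with
  -- coefficient 1 at i, hence nonzero by independence, and ⟨w, v i⟩ = ⟨w, w⟩; so w / ⟨w, w⟩ is dual
  -- to v i.
  dual-from-residual : ∀ {n k} {v : Fin (suc k) → Vector ℝ n} → LinearlyIndependent v → ∀ i w →
    (∀ j → ⟨ removeAt v i j , w ⟩ ≈ 0#) → Span (removeAt v i) (v i -ᵥ w) →
    ∃ λ u → ∀ j → ⟨ u , v j ⟩ ≈ δ i j
  dual-from-residual {k = k} {v} v-indep i w v′⊥w (c , vᵢ-w≈cv′) = (λ l → ⟨ w , w ⟩ ⁻¹ * w l) , λ j →
      trans (⟨⟩-scaleˡ (⟨ w , w ⟩ ⁻¹) w (v j)) (on j)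
    where
    open ≈-Reasoning
    v′ = removeAt v i
    c′ : Vector ℝ (suc k)
    c′ = insertAt (λ j → - c j) i 1#
    c′v≈w : ∀ l → combination c′ v l ≈ w l
    c′v≈w l = begin
      sum (λ j → c′ j * v j l)                            ≈⟨ sum-remove {i = i} (λ j → c′ j * v j l) ⟩
      c′ i * v i l + sum (λ j → c′ (punchIn i j) * v′ j l) ≈⟨ +-cong (*-congʳ (reflexive (insertAt-lookup _ i 1#)))
            (sum-cong {k} (λ j → trans (*-congʳ (reflexive (insertAt-punchIn _ i 1# j))) (sym (-‿distribˡ-* (c j) (v′ j l))))) ⟩
      1# * v i l + sum (λ j → - (c j * v′ j l))           ≈⟨ +-cong (*-identityˡ _) (sum-neg (λ j → c j * v′ j l)) ⟩
      v i l - combination c v′ l                          ≈⟨ +-congˡ (-‿cong (vᵢ-w≈cv′ l)) ⟨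
      v i l - (v i l - w l)                               ≈⟨ solve 2 (λ v w → v :- (v :- w) := w) refl (v i l) (w l) ⟩
      w l                                                 ∎
    ww≉0 : ¬ (⟨ w , w ⟩ ≈ 0#)
    ww≉0 ww≈0 = 0≉1 (sym (trans (sym (reflexive (insertAt-lookup (λ j → - c j) i 1#)))
      (v-indep c′ (λ l → trans (c′v≈w l) (⟨⟩-zero ww≈0 l)) i)))
    ⟨w,vᵢ⟩≈⟨w,w⟩ : ⟨ w , v i ⟩ ≈ ⟨ w , w ⟩
    ⟨w,vᵢ⟩≈⟨w,w⟩ = x-y≈0⇒x≈y _ _ (begin
      ⟨ w , v i ⟩ - ⟨ w , w ⟩          ≈⟨ ⟨⟩-subʳ w (v i) w ⟨
      ⟨ w , v i -ᵥ w ⟩                 ≈⟨ ⟨⟩-cong (λ _ → refl) vᵢ-w≈cv′ ⟩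
      ⟨ w , combination c v′ ⟩         ≈⟨ ⟨⟩-combinationʳ w c v′ ⟩
      sum (λ j → c j * ⟨ w , v′ j ⟩)
        ≈⟨ sum-zero (λ j → trans (*-congˡ (trans (⟨⟩-comm w (v′ j)) (v′⊥w j))) (zeroʳ (c j))) ⟩
      0#                               ∎)
    on : ∀ j → ⟨ w , w ⟩ ⁻¹ * ⟨ w , v j ⟩ ≈ δ i j
    on j with i Fin.≟ j
    ... | yes ≡.refl = trans (*-congˡ ⟨w,vᵢ⟩≈⟨w,w⟩) (*-inverseˡ ww≉0)
    ... | no i≢j = trans (*-congˡ (≡.subst (λ j → ⟨ w , v j ⟩ ≈ 0#) (punchIn-punchOut i≢j)
        (trans (⟨⟩-comm w _) (v′⊥w (punchOut i≢j))))) (zeroʳ _)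

  abstract
    -- Gram-Schmidt drops dependent vectors, so the orthogonal decomposition exists for every finite
    -- family.
    residual : ∀ {n k} (v : Fin k → Vector ℝ n) x →
               ∃ λ w → (∀ j → ⟨ v j , w ⟩ ≈ 0#) × Span v (x -ᵥ w)
    residual v = residual-from-basis (gramSchmidt-correct v)

    dual-vector : ∀ {n k} {v : Fin k → Vector ℝ n} → LinearlyIndependent v →
                  ∀ i → ∃ λ u → ∀ j → ⟨ u , v j ⟩ ≈ δ i j
    dual-vector {k = suc k} {v} v-indep i =
      let (w , v′⊥w , v-w∈v′) = residual (removeAt v i) (v i) in
      dual-from-residual v-indep i w v′⊥w v-w∈v′

  -- As t has a nonzero entry at index zero, the search in `factorise` stops there. The result is
  -- column zero of ttᵗ divided by √X₀₀, the absolute value of that entry, which is t up to sign.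
  factorise-correct : ∀ {n} (X : Matrix (suc n) (suc n)) t → X ≈ₘ dyad t → ¬ (t zero ≈ 0#) →
                      X ≈ₘ dyad (value (factorise X))
  factorise-correct X t X≈tt t₀≉0 with X zero zero ≟ 0#
  ... | yes p = ⊥-elim (*-nonzero t₀≉0 t₀≉0 (trans (sym (X≈tt zero zero)) p))
  ... | no X₀₀≉0 = λ i j → begin
    X i j                                             ≈⟨ X≈tt i j ⟩
    t i * t j                                         ≈⟨ trans (*-identityˡ _) (*-identityˡ _) ⟨
    1# * (1# * (t i * t j))                           ≈⟨ *-cong (*-inverseˡ l≉0) (*-congʳ (*-inverseˡ l≉0)) ⟨
    ι * l * (ι * l * (t i * t j))
      ≈⟨ solve 4 (λ ι l a b → ι :* l :* (ι :* l :* (a :* b)) := ι :* ι :* (a :* b) :* (l :* l)) refl ι l (t i) (t j) ⟩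
    ι * ι * (t i * t j) * (l * l)                     ≈⟨ *-congˡ (trans l²≈X₀₀ (X≈tt zero zero)) ⟩
    ι * ι * (t i * t j) * (t zero * t zero)
      ≈⟨ solve 4 (λ ι a b z → ι :* ι :* (a :* b) :* (z :* z) := (ι :* (a :* z)) :* (ι :* (b :* z))) refl ι (t i) (t j) (t zero) ⟩
    (ι * (t i * t zero)) * (ι * (t j * t zero))       ≈⟨ *-cong (*-congˡ (X≈tt i zero)) (*-congˡ (X≈tt j zero)) ⟨
    (ι * X i zero) * (ι * X j zero)
      ≈⟨ *-cong (scale-value ι (column X zero) i) (scale-value ι (column X zero) j) ⟨
    dyad (value (scale ι (column X zero))) i j        ∎
    where
    open ≈-Reasoning
    l = √ (X zero zero)
    ι = l ⁻¹
    l²≈X₀₀ : l * l ≈ X zero zero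
    l²≈X₀₀ = √-square (≤-respʳ-≈ (sym (X≈tt zero zero)) (square-nonNegative (t zero)))
    l≉0 : ¬ (l ≈ 0#)
    l≉0 l≈0 = X₀₀≉0 (trans (sym l²≈X₀₀) (trans (*-congʳ l≈0) (zeroˡ l)))

  -- A copy of the local function of `linearSolve`, which lemmas can name; both unfold to the same
  -- program.
  reduce : ∀ {N} → Vector ℝ N → ℝ → Vector ℝ N → Counted (Vector ℝ N)
  reduce v₀ q⁻¹ x = inner x v₀ >>= λ t → mul t q⁻¹ >>= λ c → scale c v₀ >>= λ p → subtract x p

  reduced : ∀ {N} → Vector ℝ N → ℝ → Vector ℝ N → Vector ℝ N
  reduced v₀ q⁻¹ x = x -ᵥ (λ i → ⟨ x , v₀ ⟩ * q⁻¹ * v₀ i)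

  reduce-value : ∀ {N} (v₀ : Vector ℝ N) q⁻¹ x → value (reduce v₀ q⁻¹ x) ≈ᵥ reduced v₀ q⁻¹ x
  reduce-value v₀ q⁻¹ x i = trans (subtract-value x (value (scale (value (inner x v₀) * q⁻¹) v₀)) i)
    (+-congˡ (-‿cong (trans (scale-value _ v₀ i) (*-congʳ (*-congʳ (inner-value x v₀))))))

  reduced-combination : ∀ {N m} (v₀ : Vector ℝ N) q⁻¹ (c : Vector ℝ m) (v : Fin m → Vector ℝ N) →
    combination c (λ j → reduced v₀ q⁻¹ (v j)) ≈ᵥ
    (λ i → combination c v i - sum (λ j → c j * (⟨ v j , v₀ ⟩ * q⁻¹)) * v₀ i)
  reduced-combination {m = m} v₀ q⁻¹ c v i = begin
    sum (λ j → c j * (v j i - β j * v₀ i))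
      ≈⟨ sum-cong {m} (λ j → solve 4 (λ c v b z → c :* (v :- b :* z) := c :* v :- c :* b :* z) refl (c j) (v j i) (β j) (v₀ i)) ⟩
    sum (λ j → c j * v j i - c j * β j * v₀ i)              ≈⟨ sum-sub {m} _ _ ⟩
    combination c v i - sum (λ j → c j * β j * v₀ i)        ≈⟨ +-congˡ (-‿cong (*-distribʳ-sum {m} (v₀ i) _)) ⟨
    combination c v i - sum (λ j → c j * β j) * v₀ i        ∎
    where
    open ≈-Reasoning
    β : Vector ℝ _
    β j = ⟨ v j , v₀ ⟩ * q⁻¹

  -- The projection along v₀ is linear and kills v₀, so `tail x` solves the reduced system, and x₀
  -- is read off from a minus the other terms, which is x₀ v₀.
  linearSolve-correct : ∀ {N m} (v : Fin m → Vector ℝ N) a x → LinearlyIndependent v →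
                        a ≈ᵥ combination x v → value (linearSolve v a) ≈ᵥ x
  linearSolve-correct {N} {suc m} v a x v-indep a≈xv = λ { zero → τ₀≈x₀ ; (suc j) → τ≈x j }
    where
    open ≈-Reasoning
    v₀ = head v
    q = value (inner v₀ v₀)
    q⁻¹ = q ⁻¹
    w = value (each λ j → reduce v₀ q⁻¹ (tail v j))
    a′ = value (reduce v₀ q⁻¹ a)
    τ = value (linearSolve w a′)
    p = value (combine τ (tail v))
    b = value (subtract a p)
    q≉0 : ¬ (q ≈ 0#)
    q≉0 q≈0 = 0≉1 (sym (trans (sym (δ-same {suc m} zero)) (v-indep (δ zero) (λ i →
      trans (sum-δˡ {suc m} zero (λ j → v j i)) (⟨⟩-zero (trans (sym (inner-value v₀ v₀)) q≈0) i)) zero)))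
    w≈ : ∀ j → w j ≈ᵥ reduced v₀ q⁻¹ (tail v j)
    w≈ j i = trans (reflexive (≡.cong (_$ i) (each-value (λ j → reduce v₀ q⁻¹ (tail v j)) j)))
      (reduce-value v₀ q⁻¹ (tail v j) i)
    -- The multiple of v₀ that the projection removes from Σ c_j v_j. A relation c among the reduced
    -- vectors thus lifts to a relation among all of v with coefficient - B c at v₀, which is why
    -- independence survives.
    B : Vector ℝ m → ℝ
    B c = sum (λ j → c j * (⟨ tail v j , v₀ ⟩ * q⁻¹))
    cw≈ : ∀ c i → combination c w i ≈ combination c (tail v) i - B c * v₀ i
    cw≈ c i = trans (combination-cong {c = c} (λ _ → refl) w≈ i) (reduced-combination v₀ q⁻¹ c (tail v) i)
    w-indep : LinearlyIndependent w
    w-indep c cw≈0 j = v-indep (- B c ∷ c) (λ i → begin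
      - B c * v₀ i + combination c (tail v) i
        ≈⟨ solve 3 (λ b z s → :- b :* z :+ s := s :- b :* z) refl (B c) (v₀ i) _ ⟩
      combination c (tail v) i - B c * v₀ i     ≈⟨ cw≈ c i ⟨
      combination c w i                         ≈⟨ cw≈0 i ⟩
      0#                                        ∎) (suc j)
    ⟨a,v₀⟩q⁻¹ : ⟨ a , v₀ ⟩ * q⁻¹ ≈ x zero + B (tail x)
    ⟨a,v₀⟩q⁻¹ = begin
      ⟨ a , v₀ ⟩ * q⁻¹
        ≈⟨ *-congʳ (trans (⟨⟩-cong a≈xv (λ _ → refl)) (⟨⟩-combinationˡ x v v₀)) ⟩
      (x zero * ⟨ v₀ , v₀ ⟩ + sum (λ j → x (suc j) * ⟨ tail v j , v₀ ⟩)) * q⁻¹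
        ≈⟨ distribʳ q⁻¹ _ _ ⟩
      x zero * ⟨ v₀ , v₀ ⟩ * q⁻¹ + sum (λ j → x (suc j) * ⟨ tail v j , v₀ ⟩) * q⁻¹
        ≈⟨ +-cong (trans (*-congʳ (*-congˡ (sym (inner-value v₀ v₀)))) (trans (*-assoc _ _ _) (trans (*-congˡ (*-inverseʳ q≉0)) (*-identityʳ _))))
            (trans (*-distribʳ-sum {m} q⁻¹ _) (sum-cong {m} (λ j → *-assoc _ _ _))) ⟩
      x zero + B (tail x)                                        ∎
    a′≈ : a′ ≈ᵥ combination (tail x) w
    a′≈ i = begin
      a′ i                                                       ≈⟨ reduce-value v₀ q⁻¹ a i ⟩
      a i - ⟨ a , v₀ ⟩ * q⁻¹ * v₀ i                              ≈⟨ +-cong (a≈xv i) (-‿cong (*-congʳ ⟨a,v₀⟩q⁻¹)) ⟩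
      x zero * v₀ i + combination (tail x) (tail v) i - (x zero + B (tail x)) * v₀ i
        ≈⟨ solve 4 (λ x z s b → x :* z :+ s :- (x :+ b) :* z := s :- b :* z) refl (x zero) (v₀ i) _ (B (tail x)) ⟩
      combination (tail x) (tail v) i - B (tail x) * v₀ i        ≈⟨ cw≈ (tail x) i ⟨
      combination (tail x) w i                                   ∎
    τ≈x : τ ≈ᵥ tail x
    τ≈x = linearSolve-correct w a′ (tail x) w-indep a′≈
    b≈ : b ≈ᵥ (λ i → x zero * v₀ i)
    b≈ i = begin
      b i                                                        ≈⟨ subtract-value a p i ⟩
      a i - p i
        ≈⟨ +-cong (a≈xv i) (-‿cong (trans (combine-value τ (tail v) i) (combination-cong {v = tail v} {v′ = tail v} τ≈x (λ _ _ → refl) i))) ⟩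
      x zero * v₀ i + combination (tail x) (tail v) i - combination (tail x) (tail v) i
        ≈⟨ solve 2 (λ y s → y :+ s :- s := y) refl (x zero * v₀ i) _ ⟩
      x zero * v₀ i                                              ∎
    τ₀≈x₀ : value (inner b v₀) * q⁻¹ ≈ x zero
    τ₀≈x₀ = begin
      value (inner b v₀) * q⁻¹
        ≈⟨ *-congʳ (trans (inner-value b v₀) (trans (⟨⟩-cong b≈ (λ _ → refl)) (⟨⟩-scaleˡ (x zero) v₀ v₀))) ⟩
      x zero * ⟨ v₀ , v₀ ⟩ * q⁻¹                                 ≈⟨ *-congʳ (*-congˡ (inner-value v₀ v₀)) ⟨
      x zero * q * q⁻¹
        ≈⟨ trans (*-assoc _ _ _) (trans (*-congˡ (*-inverseʳ q≉0)) (*-identityʳ _)) ⟩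
      x zero                                                     ∎

-- Quadratic forms, positive semidefinite matrices and traces.

module Semidefinite (ℛ : RealNumbers) where

  open SignComponents ℛ
  open OrderedField ℛ
  open Summation ℛ
  open LinearAlgebra ℛ
  open Programs ℛ

  form-symmetric : ∀ {n} {X : Matrix n n} → Symmetric X → ∀ x y → ⟨ x , X *ᵥ y ⟩ ≈ ⟨ y , X *ᵥ x ⟩
  form-symmetric {n} {X} X-sym x y = begin
    sum (λ i → x i * sum (λ j → X i j * y j))     ≈⟨ sum-cong {n} (λ i → *-distribˡ-sum {n} (x i) _) ⟩
    sum (λ i → sum (λ j → x i * (X i j * y j)))   ≈⟨ ∑-comm {n} {n} _ ⟩
    sum (λ j → sum (λ i → x i * (X i j * y j)))
      ≈⟨ sum-cong {n} (λ j → sum-cong {n} (λ i → trans (*-congˡ (*-congʳ (X-sym j i)))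
          (solve 3 (λ x a y → x :* (a :* y) := y :* (a :* x)) refl (x i) (X j i) (y j)))) ⟩
    sum (λ j → sum (λ i → y j * (X j i * x i)))   ≈⟨ sum-cong {n} (λ j → *-distribˡ-sum {n} (y j) _) ⟨
    sum (λ j → y j * sum (λ i → X j i * x i))     ∎
    where open ≈-Reasoning

  form-combination : ∀ {n k} (X : Matrix n n) (c : Vector ℝ k) (v : Fin k → Vector ℝ n) →
    ⟨ combination c v , X *ᵥ combination c v ⟩ ≈
    sum (λ a → c a * sum (λ b → c b * ⟨ v a , X *ᵥ v b ⟩))
  form-combination {n} {k} X c v = trans (⟨⟩-combinationˡ c v _)
    (sum-cong {k} (λ a → *-congˡ (trans (⟨⟩-cong {x = v a} (λ _ → refl) (λ i → ⟨⟩-combinationʳ (X i) c v))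
      (⟨⟩-combinationʳ (v a) c (λ b → X *ᵥ v b)))))

  -- With y = Xw, b = ⟨y, y⟩ and c = ⟨y, Xy⟩, the form at (c + 1)w - by is -b²(c + 2).
  psd-kernel : ∀ {n} {X : Matrix n n} → PositiveSemidefinite X →
               ∀ w → ⟨ w , X *ᵥ w ⟩ ≈ 0# → ∀ i → (X *ᵥ w) i ≈ 0#
  psd-kernel {n} {X} (X-sym , X≥0) w wXw≈0 = ⟨⟩-zero (square-zero (antisym b²≤0 (square-nonNegative b)))
    where
    y = X *ᵥ w
    b = ⟨ y , y ⟩
    c = ⟨ y , X *ᵥ y ⟩
    coefficients : Vector ℝ 2
    coefficients = (c + 1#) ∷ (- b) ∷ []
    vectors : Fin 2 → Vector ℝ n
    vectors = w ∷ y ∷ []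
    value-of-form : ⟨ combination coefficients vectors , X *ᵥ combination coefficients vectors ⟩ ≈
                    - (b * b * (c + 1# + 1#))
    value-of-form = begin
      _ ≈⟨ form-combination X coefficients vectors ⟩
      (c + 1#) * ((c + 1#) * ⟨ w , X *ᵥ w ⟩ + (- b * ⟨ w , X *ᵥ y ⟩ + 0#)) +
        (- b * ((c + 1#) * b + (- b * c + 0#)) + 0#)
        ≈⟨ +-congʳ (*-congˡ (+-cong (*-congˡ wXw≈0) (+-congʳ (*-congˡ (form-symmetric X-sym w y))))) ⟩
      (c + 1#) * ((c + 1#) * 0# + (- b * b + 0#)) + (- b * ((c + 1#) * b + (- b * c + 0#)) + 0#)
        ≈⟨ solve 2 (λ b c → (c :+ con (+ 1)) :* ((c :+ con (+ 1)) :* con (+ 0) :+ (:- b :* b :+ con (+ 0)))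
             :+ (:- b :* ((c :+ con (+ 1)) :* b :+ (:- b :* c :+ con (+ 0))) :+ con (+ 0))
             := :- (b :* b :* (c :+ con (+ 1) :+ con (+ 1)))) refl b c ⟩
      - (b * b * (c + 1# + 1#)) ∎
      where open ≈-Reasoning
    b²[c+2]≤0 : b * b * (c + 1# + 1#) ≤ 0#
    b²[c+2]≤0 = ≤-respʳ-≈ -0≈0 (≤-respˡ-≈ (⁻¹-involutive _) (neg-mono-≤ (≤-respʳ-≈ value-of-form (X≥0 _))))
    b²≤0 : b * b ≤ 0#
    b²≤0 = ≤-trans (≤-respˡ-≈ (*-identityʳ _) (*-monoˡ-≤ (square-nonNegative b)
      (≤-respˡ-≈ (+-identityˡ 1#) (+-monoˡ-≤ 1# (+-nonNegative (X≥0 y) 0≤1))))) b²[c+2]≤0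

  ∑-*ᵥ : ∀ {m n} (c : Vector ℝ m) (t : Fin m → Vector ℝ n) x →
         ∑τssᵗ (c , t) *ᵥ x ≈ᵥ combination (λ k → c k * ⟨ t k , x ⟩) t
  ∑-*ᵥ {m} {n} c t x i = begin
    sum (λ j → sum (λ k → c k * (t k i * t k j)) * x j)    ≈⟨ sum-cong {n} (λ j → *-distribʳ-sum {m} (x j) _) ⟩
    sum (λ j → sum (λ k → c k * (t k i * t k j) * x j))    ≈⟨ ∑-comm {n} {m} _ ⟩
    sum (λ k → sum (λ j → c k * (t k i * t k j) * x j))    ≈⟨ sum-cong {m} (λ k → trans (sum-cong {n} (λ j →
          solve 4 (λ c a b x → c :* (a :* b) :* x := c :* a :* (b :* x)) refl (c k) (t k i) (t k j) (x j)))
          (sym (*-distribˡ-sum {n} (c k * t k i) _))) ⟩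
    sum (λ k → c k * t k i * ⟨ t k , x ⟩)
      ≈⟨ sum-cong {m} (λ k → solve 3 (λ c a b → c :* a :* b := c :* b :* a) refl (c k) (t k i) ⟨ t k , x ⟩) ⟩
    sum (λ k → c k * ⟨ t k , x ⟩ * t k i)                  ∎
    where open ≈-Reasoning

  ∑-form : ∀ {m n} (c : Vector ℝ m) (t : Fin m → Vector ℝ n) x y →
           ⟨ x , ∑τssᵗ (c , t) *ᵥ y ⟩ ≈ sum (λ k → c k * (⟨ t k , x ⟩ * ⟨ t k , y ⟩))
  ∑-form {m} c t x y = trans (⟨⟩-cong {x = x} (λ _ → refl) (∑-*ᵥ c t y))
    (trans (⟨⟩-combinationʳ x _ t) (sum-cong {m} (λ k → trans (*-congˡ (⟨⟩-comm x (t k)))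
      (solve 3 (λ c a b → c :* b :* a := c :* (a :* b)) refl (c k) ⟨ t k , x ⟩ ⟨ t k , y ⟩))))

  form-cong : ∀ {n} {X Y : Matrix n n} → X ≈ₘ Y → ∀ x y → ⟨ x , X *ᵥ y ⟩ ≈ ⟨ x , Y *ᵥ y ⟩
  form-cong {n} X≈Y x y = sum-cong {n} (λ i → *-congˡ (sum-cong {n} (λ j → *-congʳ (X≈Y i j))))

  psd-resp-≈ : ∀ {n} {X Y : Matrix n n} → X ≈ₘ Y → PositiveSemidefinite X → PositiveSemidefinite Y
  psd-resp-≈ X≈Y (X-sym , X≥0) =
    (λ i j → trans (sym (X≈Y j i)) (trans (X-sym i j) (X≈Y i j))) ,
    λ v → ≤-respʳ-≈ (form-cong X≈Y v v) (X≥0 v)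

  ∑-psd : ∀ {m n} {c : Vector ℝ m} (t : Fin m → Vector ℝ n) → (∀ k → 0# ≤ c k) →
          PositiveSemidefinite (∑τssᵗ (c , t))
  ∑-psd {m} {c = c} t 0≤c = (λ i j → sum-cong {m} (λ k → *-congˡ (*-comm _ _))) ,
    λ v → ≤-respʳ-≈ (sym (∑-form c t v v))
      (sum-nonNegative (λ k → *-nonNegative (0≤c k) (square-nonNegative _)))

  dyad≈∑ : ∀ {n} (t : Vector ℝ n) → ∑τssᵗ {1} ((λ _ → 1#) , (λ _ → t)) ≈ₘ dyad t
  dyad≈∑ t i j = trans (+-identityʳ _) (*-identityˡ _)

  dyad-psd : ∀ {n} (t : Vector ℝ n) → PositiveSemidefinite (dyad t)
  dyad-psd t = psd-resp-≈ (dyad≈∑ t) (∑-psd {1} (λ _ → t) (λ _ → 0≤1))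

  dyad-form : ∀ {n} (t x y : Vector ℝ n) → ⟨ x , dyad t *ᵥ y ⟩ ≈ ⟨ t , x ⟩ * ⟨ t , y ⟩
  dyad-form t x y = trans (form-cong (λ i j → sym (dyad≈∑ t i j)) x y)
    (trans (∑-form {1} (λ _ → 1#) (λ _ → t) x y) (trans (+-identityʳ _) (*-identityˡ _)))

  trace-conjugate : ∀ {n k} (V : Matrix n k) (X : Matrix n n) →
    trace (V ᵗ *ₘ X *ₘ V) ≈ sum (λ a → ⟨ column V a , X *ᵥ column V a ⟩)
  trace-conjugate {n} {k} V X = sum-cong {k} (λ a → begin
    sum (λ l → sum (λ i → V i a * X i l) * V l a)    ≈⟨ sum-cong {n} (λ l → *-distribʳ-sum {n} (V l a) _) ⟩
    sum (λ l → sum (λ i → V i a * X i l * V l a))    ≈⟨ ∑-comm {n} {n} _ ⟩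
    sum (λ i → sum (λ l → V i a * X i l * V l a))
      ≈⟨ sum-cong {n} (λ i → trans (sum-cong {n} (λ l → *-assoc _ _ _)) (sym (*-distribˡ-sum {n} (V i a) _))) ⟩
    sum (λ i → V i a * sum (λ l → X i l * V l a))    ∎)
    where open ≈-Reasoning

  project-span : ∀ {n k} {u : Fin k → Vector ℝ n} → Orthonormal u → ∀ {x} → Span u x → x ≈ᵥ project u x
  project-span {k = k} {u} (unit , orth) {x} (c , p) i = trans (p i) (sum-cong {k} (λ j → *-congʳ (begin
    c j                            ≈⟨ trans (*-congˡ (unit j)) (*-identityʳ (c j)) ⟨
    c j * ⟨ u j , u j ⟩
      ≈⟨ sum-single j (λ l l≢j → trans (*-congˡ (orth j l (l≢j ∘ ≡.sym))) (zeroʳ (c l))) ⟨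
    sum (λ l → c l * ⟨ u j , u l ⟩) ≈⟨ ⟨⟩-combinationʳ (u j) c u ⟨
    ⟨ u j , combination c u ⟩      ≈⟨ ⟨⟩-cong {x = u j} (λ _ → refl) p ⟨
    ⟨ u j , x ⟩                    ∎)))
    where open ≈-Reasoning

  trace-dyad : ∀ {n k} {V : Matrix n k} → Orthonormal (column V) → ∀ {t} → Span (column V) t →
               trace (V ᵗ *ₘ dyad t *ₘ V) ≈ ⟨ t , t ⟩
  trace-dyad {k = k} {V} V-on {t} t∈V = begin
    trace (V ᵗ *ₘ dyad t *ₘ V)                                  ≈⟨ trace-conjugate V (dyad t) ⟩
    sum (λ a → ⟨ column V a , dyad t *ᵥ column V a ⟩)
      ≈⟨ sum-cong {k} (λ a → trans (dyad-form t (column V a) (column V a)) (*-congʳ (⟨⟩-comm t (column V a)))) ⟩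
    sum (λ a → ⟨ column V a , t ⟩ * ⟨ t , column V a ⟩)         ≈⟨ ⟨⟩-combinationʳ t _ (column V) ⟨
    ⟨ t , project (column V) t ⟩
      ≈⟨ ⟨⟩-cong {x = t} (λ _ → refl) (project-span V-on t∈V) ⟨
    ⟨ t , t ⟩                                                   ∎
    where open ≈-Reasoning

  -- The difference of the traces is the trace of the compression of X to the
  -- orthogonal complement of the range of V.
  trace-range : ∀ {n k} {V : Matrix n k} {X : Matrix n n} → Orthonormal (column V) →
    PositiveSemidefinite X → trace (V ᵗ *ₘ X *ₘ V) ≈ trace X → ∀ j → Span (column V) (column X j)
  trace-range {n} {k} {V} {X} (unit , orth) X-psd@(X-sym , X≥0) tr j =
    (λ a → (X *ᵥ column V a) j) , λ i → begin
      X i j                                          ≈⟨ X-sym i j ⟨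
      X j i                                          ≈⟨ X*δ i j ⟨
      (X *ᵥ δ i) j                                   ≈⟨ solve 2 (λ x p → x := x :- p :+ p) refl _ ((X *ᵥ p i) j) ⟩
      (X *ᵥ δ i) j - (X *ᵥ p i) j + (X *ᵥ p i) j     ≈⟨ +-congʳ (⟨⟩-subʳ (X j) (δ i) (p i)) ⟨
      (X *ᵥ w i) j + (X *ᵥ p i) j                    ≈⟨ +-congʳ (psd-kernel X-psd (w i) (wXw≈0 i) j) ⟩
      0# + (X *ᵥ p i) j                              ≈⟨ +-identityˡ _ ⟩
      (X *ᵥ p i) j                                   ≈⟨ ⟨⟩-combinationʳ (X j) (V i) (column V) ⟩
      sum (λ a → V i a * (X *ᵥ column V a) j)        ≈⟨ sum-cong {k} (λ a → *-comm _ _) ⟩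
      sum (λ a → (X *ᵥ column V a) j * V i a)        ∎
    where
    open ≈-Reasoning
    -- Row i of V holds the coordinates of the projection `p i` of the unit vector `δ i`. The forms
    -- of X at the residuals `w i` add up to trace X - 2T + T = 0 and are nonnegative, so X
    -- annihilates every `w i`.
    p w : Fin n → Vector ℝ n
    p i = combination (V i) (column V)
    w i = δ i -ᵥ p i
    Q : Fin k → Fin k → ℝ
    Q a b = ⟨ column V a , X *ᵥ column V b ⟩
    T : ℝ
    T = sum (λ a → Q a a)
    X*δ : ∀ i j → (X *ᵥ δ i) j ≈ X j i
    X*δ i j = trans (sum-cong {n} (λ l → *-comm _ _)) (sum-δˡ i (X j))
    δXδ : ∀ i → ⟨ δ i , X *ᵥ δ i ⟩ ≈ X i i
    δXδ i = trans (sum-δˡ i (X *ᵥ δ i)) (X*δ i i)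
    pXδ : ∀ i → ⟨ p i , X *ᵥ δ i ⟩ ≈ sum (λ a → V i a * (X *ᵥ column V a) i)
    pXδ i = trans (⟨⟩-combinationˡ (V i) (column V) _) (sum-cong {k} (λ a → *-congˡ
      (trans (form-symmetric X-sym (column V a) (δ i)) (sum-δˡ i (X *ᵥ column V a)))))
    wXw : ∀ i → ⟨ w i , X *ᵥ w i ⟩ ≈
      X i i - (sum (λ a → V i a * (X *ᵥ column V a) i) + sum (λ a → V i a * (X *ᵥ column V a) i))
        + sum (λ a → V i a * sum (λ b → V i b * Q a b))
    wXw i = begin
      ⟨ w i , X *ᵥ w i ⟩
        ≈⟨ trans (⟨⟩-cong {x = w i} (λ _ → refl) (λ l → ⟨⟩-subʳ (X l) (δ i) (p i))) (⟨⟩-subʳ (w i) (X *ᵥ δ i) (X *ᵥ p i)) ⟩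
      ⟨ w i , X *ᵥ δ i ⟩ - ⟨ w i , X *ᵥ p i ⟩
        ≈⟨ +-cong (⟨⟩-subˡ (δ i) (p i) _) (-‿cong (⟨⟩-subˡ (δ i) (p i) _)) ⟩
      (⟨ δ i , X *ᵥ δ i ⟩ - ⟨ p i , X *ᵥ δ i ⟩) - (⟨ δ i , X *ᵥ p i ⟩ - ⟨ p i , X *ᵥ p i ⟩)
        ≈⟨ solve 4 (λ a b c d → (a :- b) :- (c :- d) := a :- (b :+ c) :+ d) refl _ _ _ _ ⟩
      ⟨ δ i , X *ᵥ δ i ⟩ - (⟨ p i , X *ᵥ δ i ⟩ + ⟨ δ i , X *ᵥ p i ⟩) + ⟨ p i , X *ᵥ p i ⟩
        ≈⟨ +-cong (+-cong (δXδ i) (-‿cong (+-cong (pXδ i) (trans (form-symmetric X-sym (δ i) (p i)) (pXδ i)))))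
             (form-combination X (V i) (column V)) ⟩
      _ ∎
    cross : sum (λ i → sum (λ a → V i a * (X *ᵥ column V a) i)) ≈ T
    cross = ∑-comm {n} {k} _
    square : sum (λ i → sum (λ a → V i a * sum (λ b → V i b * Q a b))) ≈ T
    square = begin
      sum (λ i → sum (λ a → V i a * sum (λ b → V i b * Q a b)))    ≈⟨ ∑-comm {n} {k} _ ⟩
      sum (λ a → sum (λ i → V i a * sum (λ b → V i b * Q a b)))    ≈⟨ sum-cong {k} (λ a → trans
           (⟨⟩-cong {x = column V a} (λ _ → refl) (λ i → sum-cong {k} (λ b → *-comm _ _)))
           (⟨⟩-combinationʳ (column V a) (Q a) (column V))) ⟩
      sum (λ a → sum (λ b → Q a b * ⟨ column V a , column V b ⟩))  ≈⟨ sum-cong {k} (λ a → trans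
           (sum-single a (λ b b≢a → trans (*-congˡ (orth a b (b≢a ∘ ≡.sym))) (zeroʳ (Q a b))))
           (trans (*-congˡ (unit a)) (*-identityʳ (Q a a)))) ⟩
      T                                                            ∎
    total≈0 : sum (λ i → ⟨ w i , X *ᵥ w i ⟩) ≈ 0#
    total≈0 = begin
      sum (λ i → ⟨ w i , X *ᵥ w i ⟩)   ≈⟨ sum-cong {n} wXw ⟩
      _
        ≈⟨ trans (∑-distrib-+ {n} _ _) (+-congʳ (trans (sum-sub {n} _ _) (+-congˡ (-‿cong (∑-distrib-+ {n} _ _))))) ⟩
      trace X - (sum (λ i → sum (λ a → V i a * (X *ᵥ column V a) i)) + sum (λ i → sum (λ a → V i a * (X *ᵥ column V a) i)))
        + sum (λ i → sum (λ a → V i a * sum (λ b → V i b * Q a b)))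
          ≈⟨ +-cong (+-congˡ (-‿cong (+-cong cross cross))) square ⟩
      trace X - (T + T) + T            ≈⟨ +-congʳ (+-congʳ (trans (sym tr) (trace-conjugate V X))) ⟩
      T - (T + T) + T                  ≈⟨ solve 1 (λ t → t :- (t :+ t) :+ t := con (+ 0)) refl T ⟩
      0#                               ∎
    wXw≈0 : ∀ i → ⟨ w i , X *ᵥ w i ⟩ ≈ 0#
    wXw≈0 = sum-nonNegative-zero (λ i → X≥0 (w i)) total≈0

-- Enumeration of the pairs k < l.

module PairEnumeration where

  open Combinatorics using (_C_; nC1≡n; nCk+nC[k+1]≡[n+1]C[k+1])

  -- The binomial coefficient of r over 2, by the recursion that the enumeration follows: pairs
  -- containing the first index, then pairs without it.
  triangle : ℕ → ℕ
  triangle zero    = 0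
  triangle (suc r) = r ℕ.+ triangle r

  nC2≡triangle : ∀ r → r C 2 ≡ triangle r
  nC2≡triangle zero    = ≡.refl
  nC2≡triangle (suc r) = ≡.trans (≡.sym (nCk+nC[k+1]≡[n+1]C[k+1] r 1))
    (≡.cong₂ ℕ._+_ (nC1≡n r) (nC2≡triangle r))

  shift : ∀ {r} → Fin r × Fin r → Fin (suc r) × Fin (suc r)
  shift (i , j) = suc i , suc j

  pairs : ∀ r → Vector (Fin r × Fin r) (triangle r)
  pairs zero    = []
  pairs (suc r) = (λ j → zero , suc j) ++ (shift ∘ pairs r)

  pairs-cover : ∀ {r} (i j : Fin r) → i ≢ j →
                (∃ λ q → pairs r q ≡ (i , j)) ⊎ (∃ λ q → pairs r q ≡ (j , i))
  pairs-cover zero    zero    i≢j = ⊥-elim (i≢j ≡.refl)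
  pairs-cover {suc r} zero (suc j) i≢j =
    inj₁ (j ↑ˡ triangle r , lookup-++ˡ (λ j → zero , suc j) (shift ∘ pairs r) j)
  pairs-cover {suc r} (suc i) zero i≢j =
    inj₂ (i ↑ˡ triangle r , lookup-++ˡ (λ j → zero , suc j) (shift ∘ pairs r) i)
  pairs-cover {suc r} (suc i) (suc j) i≢j =
    [ (λ (q , e) → inj₁ (r ↑ʳ q , ≡.trans (found q) (≡.cong shift e)))
    , (λ (q , e) → inj₂ (r ↑ʳ q , ≡.trans (found q) (≡.cong shift e))) ]′
    (pairs-cover i j (i≢j ∘ ≡.cong suc))
    where
    found : ∀ q → pairs (suc r) (r ↑ʳ q) ≡ shift (pairs r q)
    found = lookup-++ʳ (λ j → zero , suc j) (shift ∘ pairs r)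

-- Schur independence as a property of quadratic combinations.

module SchurIndependence (ℛ : RealNumbers) where

  open SignComponents ℛ
  open OrderedField ℛ
  open Summation ℛ
  open LinearAlgebra ℛ
  open Programs ℛ
  open Semidefinite ℛ
  open PairEnumeration
  open Combinatorics using (_C_)

  sum-++ : ∀ {A : Set} {m n} (h : A → ℝ) (xs : Vector A m) (ys : Vector A n) →
           sum (h ∘ (xs ++ ys)) ≈ sum (h ∘ xs) + sum (h ∘ ys)
  sum-++ {m = zero}  h xs ys = sym (+-identityˡ _)
  sum-++ {m = suc m} {n} h xs ys = begin
    h (xs zero) + sum (λ i → h ((xs ++ ys) (suc i)))
      ≈⟨ +-congˡ (sum-cong {m ℕ.+ n} (λ i → reflexive (≡.cong h (tail-++ i)))) ⟩
    h (xs zero) + sum (h ∘ (tail xs ++ ys))              ≈⟨ +-congˡ (sum-++ h (tail xs) ys) ⟩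
    h (xs zero) + (sum (h ∘ tail xs) + sum (h ∘ ys))     ≈⟨ +-assoc _ _ _ ⟨
    h (xs zero) + sum (h ∘ tail xs) + sum (h ∘ ys)       ∎
    where
    open ≈-Reasoning
    tail-++ : ∀ i → (xs ++ ys) (suc i) ≡ (tail xs ++ ys) i
    tail-++ i with splitAt m i
    ... | inj₁ _ = ≡.refl
    ... | inj₂ _ = ≡.refl

  sum-pairs : ∀ {r} (h : Fin r → Fin r → ℝ) →
    sum (λ k → sum (h k)) ≈
    sum (λ k → h k k) + sum (λ q → let (k , l) = pairs r q in h k l + h l k)
  sum-pairs {zero}  h = sym (+-identityˡ _)
  sum-pairs {suc r} h = begin
    (h zero zero + S₁) + sum (λ k → h (suc k) zero + sum (λ l → h (suc k) (suc l)))
      ≈⟨ +-congˡ (trans (∑-distrib-+ {r} _ _) (+-congˡ (sum-pairs (λ k l → h (suc k) (suc l))))) ⟩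
    (h zero zero + S₁) + (S₂ + (D + P))
      ≈⟨ solve 5 (λ z a b d p → (z :+ a) :+ (b :+ (d :+ p)) := (z :+ d) :+ ((a :+ b) :+ p)) refl (h zero zero) S₁ S₂ D P ⟩
    (h zero zero + D) + ((S₁ + S₂) + P)
      ≈⟨ +-congˡ (trans (+-congʳ (sym (∑-distrib-+ {r} _ _))) (sym (sum-++ g (λ j → zero , suc j) (shift ∘ pairs r)))) ⟩
    (h zero zero + D) + sum (g ∘ pairs (suc r))
      ∎
    where
    open ≈-Reasoning
    g : Fin (suc r) × Fin (suc r) → ℝ
    g (k , l) = h k l + h l k
    S₁ = sum (λ l → h zero (suc l))
    S₂ = sum (λ k → h (suc k) zero)
    D = sum (λ k → h (suc k) (suc k))
    P = sum (λ q → let (k , l) = pairs r q in h (suc k) (suc l) + h (suc l) (suc k))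

  Signs : ∀ {r n} → (Fin r → Vector ℝ n) → Set
  Signs s = ∀ i j → IsSign (s i j)

  sign² : ∀ {x} → IsSign x → x * x ≈ 1#
  sign² (inj₁ x≈1)  = trans (*-cong x≈1 x≈1) (*-identityˡ 1#)
  sign² (inj₂ x≈-1) = trans (*-cong x≈-1 x≈-1) (solve 0 (:- con (+ 1) :* :- con (+ 1) := con (+ 1)) refl)

  square-one⇒sign : ∀ {x} → x * x ≈ 1# → IsSign x
  square-one⇒sign {x} xx≈1 with x - 1# ≟ 0#
  ... | yes p = inj₁ (x-y≈0⇒x≈y _ _ p)
  ... | no ¬p = inj₂ (x-y≈0⇒x≈y _ _ (trans (+-congˡ (⁻¹-involutive 1#)) (*-zero-product (begin
    (x - 1#) * (x + 1#)   ≈⟨ solve 1 (λ x → (x :- con (+ 1)) :* (x :+ con (+ 1)) := x :* x :- con (+ 1)) refl x ⟩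
    x * x - 1#            ≈⟨ +-congʳ xx≈1 ⟩
    1# - 1#               ≈⟨ -‿inverseʳ 1# ⟩
    0#                    ∎) ¬p)))
    where open ≈-Reasoning

  quadratic : ∀ {r n} → Matrix r r → (Fin r → Vector ℝ n) → Vector ℝ n
  quadratic M t i = sum λ k → sum λ l → M k l * (t k i * t l i)

  -- Linear independence of the family 𝐞, s_k ⊙ s_l (k < l), phrased without enumerating the pairs.
  SchurFree : ∀ {r n} → (Fin r → Vector ℝ n) → Set
  SchurFree t = ∀ M c → quadratic M t ≈ᵥ (λ _ → c) → ∀ k l → k ≢ l → M k l + M l k ≈ 0#

  -- Since s_k ⊙ s_k = 𝐞, all products lie in the span of 𝐞 and the s_k ⊙ s_l with k < l. These are
  -- as many vectors as the dimension of the span of the products, so they are independent.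
  schurIndependent⇒schurFree : ∀ {r n} {s : Fin r → Vector ℝ n} → Signs s → SchurIndependent s → SchurFree s
  schurIndependent⇒schurFree {r} {n} {s} s-signs independent M c Ms≈c = off-diagonal
    where
    open ≈-Reasoning
    products : Fin r × Fin r → Vector ℝ n
    products (i , j) = s i ⊙ s j
    v : Fin (suc (triangle r)) → Vector ℝ n
    v = 𝐞 ∷ (products ∘ pairs r)
    product∈v : ∀ p → Span v (products p)
    product∈v (i , j) with i Fin.≟ j
    ... | yes ≡.refl = span-resp {v = v} (λ l → sym (sign² (s-signs i l))) (span-member v zero)
    ... | no i≢j = [ (λ (q , e) → ≡.subst (Span v ∘ products) e (span-member v (suc q)))
                   , (λ (q , e) → span-resp {v = v} (λ l → *-comm _ _) (≡.subst (Span v ∘ products) e (span-member v (suc q)))) ]′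
                   (pairs-cover i j i≢j)
    size : r C 2 ℕ.+ 1 ≡ suc (triangle r)
    size = ≡.trans (ℕ.+-comm (r C 2) 1) (≡.cong suc (nC2≡triangle r))
    basis : SpanHasDimension products (suc (triangle r))
    basis = ≡.subst (SpanHasDimension products) size independent
    v-independent : LinearlyIndependent v
    v-independent = spanning⇒independent {v = v} (proj₁ (proj₂ basis)) (λ j →
      let (k , f , d , p) = proj₁ (proj₂ (proj₂ basis)) j in
      span-trans {v = v} (λ i → product∈v (f i)) (d , p))
    -- The diagonal terms M k k (s k i)² add up to trace M in every coordinate i, so 𝐞 receives the
    -- coefficient trace M - c.
    coefficients : Vector ℝ (suc (triangle r))
    coefficients = (trace M - c) ∷ (λ q → let (k , l) = pairs r q in M k l + M l k)
    vanishing : ∀ i → combination coefficients v i ≈ 0#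
    vanishing i = begin
      (trace M - c) * 1# + Q
        ≈⟨ solve 3 (λ t c q → (t :- c) :* con (+ 1) :+ q := t :+ q :- c) refl (trace M) c Q ⟩
      trace M + Q - c
        ≈⟨ +-congʳ (+-cong (sum-cong {r} (λ k → trans (*-congˡ (sign² (s-signs k i))) (*-identityʳ _)))
            (sum-cong {triangle r} (λ q → let (k , l) = pairs r q in
            solve 4 (λ a b x y → a :* (x :* y) :+ b :* (y :* x) := (a :+ b) :* (x :* y)) refl (M k l) (M l k) (s k i) (s l i)))) ⟨
      sum (λ k → h k k) + sum (λ q → let (k , l) = pairs r q in h k l + h l k) - c
        ≈⟨ +-congʳ (sum-pairs h) ⟨
      quadratic M s i - c                               ≈⟨ +-congʳ (Ms≈c i) ⟩
      c - c                                             ≈⟨ -‿inverseʳ c ⟩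
      0#                                                ∎
      where
      Q = sum (λ q → (let (k , l) = pairs r q in M k l + M l k) * products (pairs r q) i)
      h : Fin r → Fin r → ℝ
      h k l = M k l * (s k i * s l i)
    zero-pair : ∀ q → let (k , l) = pairs r q in M k l + M l k ≈ 0#
    zero-pair q = v-independent coefficients vanishing (suc q)
    off-diagonal : ∀ k l → k ≢ l → M k l + M l k ≈ 0#
    off-diagonal k l k≢l =
      [ (λ (q , e) → ≡.subst Zero e (zero-pair q))
      , (λ (q , e) → trans (+-comm _ _) (≡.subst Zero e (zero-pair q))) ]′ (pairs-cover k l k≢l)
      where
      Zero : Fin r × Fin r → Set
      Zero (k , l) = M k l + M l k ≈ 0#

  -- M is padded with a zero row and a zero column at p, which does not change the quadratic
  -- combination.
  schurFree-removeAt : ∀ {r n} (t : Fin (suc r) → Vector ℝ n) p → SchurFree t → SchurFree (removeAt t p)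
  schurFree-removeAt {r} t p free M c Mt≈c k l k≢l =
    trans (reflexive (≡.cong₂ _+_ (≡.sym (restrict k l)) (≡.sym (restrict l k))))
      (free M̂ c (λ i → trans (extension i) (Mt≈c i)) _ _ (k≢l ∘ punchIn-injective p k l))
    where
    open ≈-Reasoning
    M̂ : Matrix (suc r) (suc r)
    M̂ = insertAt (λ k → insertAt (M k) p 0#) p (λ _ → 0#)
    restrict : ∀ k l → M̂ (punchIn p k) (punchIn p l) ≡ M k l
    restrict k l = ≡.trans (≡.cong (_$ punchIn p l) (insertAt-punchIn _ p (λ _ → 0#) k))
      (insertAt-punchIn (M k) p 0# l)
    extension : ∀ i → quadratic M̂ t i ≈ quadratic M (removeAt t p) i
    extension i = begin
      quadratic M̂ t i
        ≈⟨ sum-remove {i = p} (λ k → sum (λ l → M̂ k l * (t k i * t l i))) ⟩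
      sum (λ l → M̂ p l * (t p i * t l i)) + sum (λ k → sum (λ l → M̂ (punchIn p k) l * (t (punchIn p k) i * t l i)))
        ≈⟨ +-cong (sum-zero {suc r} {λ l → M̂ p l * (t p i * t l i)} (λ l → trans (*-congʳ (reflexive (≡.cong (_$ l) (insertAt-lookup _ p (λ _ → 0#))))) (zeroˡ _)))
             (sum-cong {r} (λ k → sum-remove {i = p} (λ l → M̂ (punchIn p k) l * (t (punchIn p k) i * t l i)))) ⟩
      0# + sum (λ k → M̂ (punchIn p k) p * (t (punchIn p k) i * t p i) +
                      sum (λ l → M̂ (punchIn p k) (punchIn p l) * (t (punchIn p k) i * t (punchIn p l) i)))
        ≈⟨ trans (+-identityˡ _) (sum-cong {r} (λ k → trans (+-congʳ (trans (*-congʳ (trans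
             (reflexive (≡.cong (_$ p) (insertAt-punchIn _ p (λ _ → 0#) k))) (reflexive (insertAt-lookup (M k) p 0#)))) (zeroˡ _)))
             (trans (+-identityˡ _) (sum-cong {r} (λ l → *-congʳ (reflexive (restrict k l))))))) ⟩
      quadratic M (removeAt t p) i
        ∎

  independent-removeAt : ∀ {r n} (t : Fin (suc r) → Vector ℝ n) p →
                         LinearlyIndependent t → LinearlyIndependent (removeAt t p)
  independent-removeAt {r} t p t-indep c ct≈0 k = trans (reflexive (≡.sym (insertAt-punchIn c p 0# k)))
    (t-indep ĉ (λ i → trans (sum-remove {i = p} (λ k → ĉ k * t k i)) (trans
      (+-cong (trans (*-congʳ (reflexive (insertAt-lookup c p 0#))) (zeroˡ _))
        (trans (sum-cong {r} (λ k → *-congʳ (reflexive (insertAt-punchIn c p 0# k)))) (ct≈0 i)))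
      (+-identityˡ 0#))) (punchIn p k))
    where
    ĉ = insertAt c p 0#

  quadratic-diagonal : ∀ {r n} {M : Matrix r r} {t : Fin r → Vector ℝ n} → Signs t →
    (∀ k l → k ≢ l → M k l ≈ 0#) → ∀ i → quadratic M t i ≈ trace M
  quadratic-diagonal {r} {M = M} {t} t-signs off i = sum-cong {r} (λ k → trans
    (sum-single k (λ l l≢k → trans (*-congʳ (off k l (l≢k ∘ ≡.sym))) (zeroˡ _)))
    (trans (*-congˡ (sign² (t-signs k i))) (*-identityʳ _)))

  x+x≈0⇒x≈0 : ∀ {x} → x + x ≈ 0# → x ≈ 0#
  x+x≈0⇒x≈0 {x} 2x≈0 = *-zero-product (trans (solve 1 (λ x → (con (+ 1) :+ con (+ 1)) :* x := x :+ x) refl x) 2x≈0)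
    (>⇒≉ (+-positive 0<1 0≤1))

-- Uniqueness of the decomposition.

module Uniqueness (ℛ : RealNumbers) where

  open SignComponents ℛ
  open OrderedField ℛ
  open Summation ℛ
  open LinearAlgebra ℛ
  open Programs ℛ
  open Semidefinite ℛ
  open SchurIndependence ℛ

  abstract
    -- If x = Σ c_k t_k then x ⊙ x = 𝐞 forces c_k c_l = 0 for k ≠ l, hence Σ c_k² = 1.
    sign-in-span : ∀ {r n} {t : Fin r → Vector ℝ n} → Fin n → Signs t → SchurFree t →
      ∀ {x} → (∀ j → IsSign (x j)) → Span t x →
      ∃₂ λ k ξ → IsSign ξ × x ≈ᵥ (λ j → ξ * t k j)
    sign-in-span {r} {n} {t} i₀ t-signs t-free {x} x-sign (c , x≈ct) = k , c k , square-one⇒sign cₖ²≈1 , λ j →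
      trans (x≈ct j) (sum-single k (λ l l≢k → trans (*-congʳ (others l l≢k)) (zeroˡ _)))
      where
      open ≈-Reasoning
      M : Matrix r r
      M k l = c k * c l
      Mt≈1 : ∀ i → quadratic M t i ≈ 1#
      Mt≈1 i = begin
        sum (λ k → sum (λ l → c k * c l * (t k i * t l i)))   ≈⟨ sum-cong {r} (λ k → trans (sum-cong {r} (λ l →
              solve 4 (λ a b x y → a :* b :* (x :* y) := a :* x :* (b :* y)) refl (c k) (c l) (t k i) (t l i)))
              (sym (*-distribˡ-sum {r} (c k * t k i) _))) ⟩
        sum (λ k → c k * t k i * combination c t i)           ≈⟨ *-distribʳ-sum {r} (combination c t i) _ ⟨
        combination c t i * combination c t i                 ≈⟨ *-cong (x≈ct i) (x≈ct i) ⟨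
        x i * x i                                             ≈⟨ sign² (x-sign i) ⟩
        1#                                                    ∎
      off : ∀ k l → k ≢ l → M k l ≈ 0#
      off k l k≢l = x+x≈0⇒x≈0 (trans (+-congˡ (*-comm (c k) (c l))) (t-free M 1# Mt≈1 k l k≢l))
      -- The trace is read off at one coordinate, hence the argument `i₀`.
      trace≈1 : trace M ≈ 1#
      trace≈1 = trans (sym (quadratic-diagonal t-signs off i₀)) (Mt≈1 i₀)
      nonzero : ∃ λ k → ¬ (c k ≈ 0#)
      nonzero = nonzero-entry (λ c≈0 → 0≉1 (trans
        (sym (sum-zero {r} (λ k → trans (*-congʳ (c≈0 k)) (zeroˡ _)))) trace≈1))
      k : Fin r
      k = proj₁ nonzero
      others : ∀ l → l ≢ k → c l ≈ 0#
      others l l≢k = *-zero-product (off k l (l≢k ∘ ≡.sym)) (proj₂ nonzero)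
      cₖ²≈1 : c k * c k ≈ 1#
      cₖ²≈1 = trans (sym (sum-single k (λ l l≢k → trans (*-congʳ (others l l≢k)) (zeroˡ _)))) trace≈1

    -- A vector orthogonal to all s_k is in the kernel of A, hence orthogonal to all t_i.
    component-in-span : ∀ {m r n} {τ : Vector ℝ r} {s : Fin r → Vector ℝ n} {σ : Vector ℝ m} {t} →
      (∀ i → 0# < σ i) → ∑τssᵗ (τ , s) ≈ₘ ∑τssᵗ (σ , t) → ∀ i → Span s (t i)
    component-in-span {m} {r} {n} {τ} {s} {σ} {t} 0<σ ∑s≈∑t i with residual s (t i)
    ... | w , s⊥w , (c , t-w≈cs) = c , λ j → trans (sym (t-w≈t j)) (t-w≈cs j)
      where
      open ≈-Reasoning
      form≈0 : sum (λ k → σ k * (⟨ t k , w ⟩ * ⟨ t k , w ⟩)) ≈ 0#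
      form≈0 = begin
        sum (λ k → σ k * (⟨ t k , w ⟩ * ⟨ t k , w ⟩))    ≈⟨ ∑-form σ t w w ⟨
        ⟨ w , ∑τssᵗ (σ , t) *ᵥ w ⟩                       ≈⟨ form-cong ∑s≈∑t w w ⟨
        ⟨ w , ∑τssᵗ (τ , s) *ᵥ w ⟩                       ≈⟨ ∑-form τ s w w ⟩
        sum (λ k → τ k * (⟨ s k , w ⟩ * ⟨ s k , w ⟩))
          ≈⟨ sum-zero {r} (λ k → trans (*-congˡ (trans (*-congʳ (s⊥w k)) (zeroˡ _))) (zeroʳ _)) ⟩
        0#                                               ∎
      t⊥w : ⟨ t i , w ⟩ ≈ 0#
      t⊥w = square-zero (*-zero-product (sum-nonNegative-zero
        (λ k → *-nonNegative (proj₁ (0<σ k)) (square-nonNegative ⟨ t k , w ⟩)) form≈0 i) (>⇒≉ (0<σ i)))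
      ww≈0 : ⟨ w , w ⟩ ≈ 0#
      ww≈0 = begin
        ⟨ w , w ⟩                              ≈⟨ solve 2 (λ a b → a := b :- (b :- a)) refl ⟨ w , w ⟩ ⟨ t i , w ⟩ ⟩
        ⟨ t i , w ⟩ - (⟨ t i , w ⟩ - ⟨ w , w ⟩) ≈⟨ +-cong t⊥w (-‿cong (sym (⟨⟩-subˡ (t i) w w))) ⟩
        0# - ⟨ t i -ᵥ w , w ⟩
          ≈⟨ +-congˡ (-‿cong (trans (⟨⟩-cong t-w≈cs (λ _ → refl)) (trans (⟨⟩-combinationˡ c s w)
              (sum-zero {r} (λ k → trans (*-congˡ (s⊥w k)) (zeroʳ _)))))) ⟩
        0# - 0#                                ≈⟨ -‿inverseʳ 0# ⟩
        0#                                     ∎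
      t-w≈t : ∀ j → t i j - w j ≈ t i j
      t-w≈t j = trans (+-congˡ (trans (-‿cong (⟨⟩-zero ww≈0 j)) -0≈0)) (+-identityʳ _)

  dyad-sign : ∀ {n ξ} {x t : Vector ℝ n} → IsSign ξ → x ≈ᵥ (λ j → ξ * t j) → dyad x ≈ₘ dyad t
  dyad-sign {ξ = ξ} {x} {t} ξ-sign x≈ξt i j = trans (*-cong (x≈ξt i) (x≈ξt j))
    (trans (solve 3 (λ ξ a b → ξ :* a :* (ξ :* b) := ξ :* ξ :* (a :* b)) refl ξ (t i) (t j))
      (trans (*-congʳ (sign² ξ-sign)) (*-identityˡ _)))

  -- `match` provides the map f and the signs ξ, and f is injective because the dyads of t are
  -- distinct. Comparing weights shows that f is onto, every τ_k being positive, and that matched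
  -- weights agree.
  decomposition-∼ : ∀ {m r n} {τ : Vector ℝ r} {s : Fin r → Vector ℝ n} {A} {p : Parametric m n} → Fin n →
    (∀ k → 0# < τ k) → Signs s → SchurFree s → LinearlyIndependent s → A ≈ₘ ∑τssᵗ (τ , s) →
    IsSignComponentDecomposition A p → p ∼ (τ , s)
  decomposition-∼ {m} {r} {n} {τ} {s} {A} {σ , t} i₀ 0<τ s-signs s-free s-indep A≈s
    ((0<σ , _) , t-signs , t-distinct , A≈t) = permutation f f⁻¹ f∘f⁻¹ f⁻¹∘f , ξ , λ i → ξ-sign i , τf≈σ i , s≈ξt i
    where
    open ≈-Reasoning
    ∑s≈∑t : ∑τssᵗ (τ , s) ≈ₘ ∑τssᵗ (σ , t)
    ∑s≈∑t i j = trans (sym (A≈s i j)) (A≈t i j)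
    match : ∀ i → ∃₂ λ k ξ → IsSign ξ × t i ≈ᵥ (λ j → ξ * s k j)
    match i = sign-in-span i₀ s-signs s-free (t-signs i) (component-in-span 0<σ ∑s≈∑t i)
    f : Fin m → Fin r
    f i = proj₁ (match i)
    ξ : Vector ℝ m
    ξ i = proj₁ (proj₂ (match i))
    ξ-sign : ∀ i → IsSign (ξ i)
    ξ-sign i = proj₁ (proj₂ (proj₂ (match i)))
    t≈ξs : ∀ i → t i ≈ᵥ (λ j → ξ i * s (f i) j)
    t≈ξs i = proj₂ (proj₂ (proj₂ (match i)))
    s≈ξt : ∀ i → s (f i) ≈ᵥ (λ j → ξ i * t i j)
    s≈ξt i j = sym (trans (*-congˡ (t≈ξs i j)) (trans (sym (*-assoc _ _ _))
      (trans (*-congʳ (sign² (ξ-sign i))) (*-identityˡ _))))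
    f-injective : ∀ {i j} → f i ≡ f j → i ≡ j
    f-injective {i} {j} fi≡fj with i Fin.≟ j
    ... | yes i≡j = i≡j
    ... | no  i≢j = ⊥-elim (t-distinct i j i≢j (λ a b → trans (dyad-sign (ξ-sign i) (t≈ξs i) a b)
      (trans (reflexive (≡.cong (λ k → dyad (s k) a b) fi≡fj)) (sym (dyad-sign (ξ-sign j) (t≈ξs j) a b)))))
    u : Fin r → Vector ℝ n
    u k = proj₁ (dual-vector s-indep k)
    ⟨s,u⟩ : ∀ l k → ⟨ s l , u k ⟩ ≈ δ k l
    ⟨s,u⟩ l k = trans (⟨⟩-comm (s l) (u k)) (proj₂ (dual-vector s-indep k) l)
    ⟨t,u⟩² : ∀ i k → ⟨ t i , u k ⟩ * ⟨ t i , u k ⟩ ≈ δ k (f i) * δ k (f i)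
    ⟨t,u⟩² i k = begin
      ⟨ t i , u k ⟩ * ⟨ t i , u k ⟩                         ≈⟨ *-cong ⟨t,u⟩ ⟨t,u⟩ ⟩
      (ξ i * δ k (f i)) * (ξ i * δ k (f i))
        ≈⟨ solve 2 (λ x d → (x :* d) :* (x :* d) := x :* x :* (d :* d)) refl (ξ i) (δ k (f i)) ⟩
      ξ i * ξ i * (δ k (f i) * δ k (f i))                   ≈⟨ trans (*-congʳ (sign² (ξ-sign i))) (*-identityˡ _) ⟩
      δ k (f i) * δ k (f i)                                 ∎
      where
      ⟨t,u⟩ : ⟨ t i , u k ⟩ ≈ ξ i * δ k (f i)
      ⟨t,u⟩ = trans (⟨⟩-cong (t≈ξs i) (λ _ → refl)) (trans (⟨⟩-scaleˡ (ξ i) (s (f i)) (u k)) (*-congˡ (⟨s,u⟩ (f i) k)))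
    δ² : ∀ {k l : Fin r} → k ≢ l → δ k l * δ k l ≈ 0#
    δ² k≢l = trans (*-congʳ (δ-diff k≢l)) (zeroˡ _)
    δ²-same : ∀ (k : Fin r) → δ k k * δ k k ≈ 1#
    δ²-same k = trans (*-cong (δ-same k) (δ-same k)) (*-identityˡ 1#)
    -- Both representations of A are evaluated as forms at the dual vector `u k`: on one side only
    -- s_k survives, on the other only the t_i with f i = k.
    weight : ∀ k → τ k ≈ sum (λ i → σ i * (δ k (f i) * δ k (f i)))
    weight k = begin
      τ k                                                     ≈⟨ trans (*-congˡ (δ²-same k)) (*-identityʳ (τ k)) ⟨
      τ k * (δ k k * δ k k)
        ≈⟨ sum-single k (λ l l≢k → trans (*-congˡ (δ² (l≢k ∘ ≡.sym))) (zeroʳ (τ l))) ⟨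
      sum (λ l → τ l * (δ k l * δ k l))
        ≈⟨ sum-cong {r} (λ l → *-congˡ (*-cong (⟨s,u⟩ l k) (⟨s,u⟩ l k))) ⟨
      sum (λ l → τ l * (⟨ s l , u k ⟩ * ⟨ s l , u k ⟩))       ≈⟨ ∑-form τ s (u k) (u k) ⟨
      ⟨ u k , ∑τssᵗ (τ , s) *ᵥ u k ⟩                          ≈⟨ form-cong ∑s≈∑t (u k) (u k) ⟩
      ⟨ u k , ∑τssᵗ (σ , t) *ᵥ u k ⟩                          ≈⟨ ∑-form σ t (u k) (u k) ⟩
      sum (λ i → σ i * (⟨ t i , u k ⟩ * ⟨ t i , u k ⟩))       ≈⟨ sum-cong {m} (λ i → *-congˡ (⟨t,u⟩² i k)) ⟩
      sum (λ i → σ i * (δ k (f i) * δ k (f i)))               ∎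
    τf≈σ : ∀ i → τ (f i) ≈ σ i
    τf≈σ i = trans (weight (f i)) (trans
      (sum-single i (λ j j≢i → trans (*-congˡ (δ² (λ e → j≢i (≡.sym (f-injective e))))) (zeroʳ (σ j))))
      (trans (*-congˡ (δ²-same (f i))) (*-identityʳ (σ i))))
    preimage : ∀ k → ∃ λ i → f i ≡ k
    preimage k with Fin.any? (λ i → f i Fin.≟ k)
    ... | yes p = p
    ... | no ∄i = ⊥-elim (>⇒≉ (0<τ k) (trans (weight k) (sum-zero {m} (λ i →
      trans (*-congˡ (δ² (λ e → ∄i (i , ≡.sym e)))) (zeroʳ (σ i))))))
    f⁻¹ : Fin r → Fin m
    f⁻¹ k = proj₁ (preimage k)
    f∘f⁻¹ : ∀ k → f (f⁻¹ k) ≡ k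
    f∘f⁻¹ k = proj₂ (preimage k)
    f⁻¹∘f : ∀ i → f⁻¹ (f i) ≡ i
    f⁻¹∘f i = f-injective (f∘f⁻¹ (f i))

  ∼-sym : ∀ {m m′ n} {p : Parametric m n} {q : Parametric m′ n} → p ∼ q → q ∼ p
  ∼-sym {p = τ , s} {q = τ′ , s′} (π , ξ , π-matches) = Permutation.flip π , (λ j → ξ (π ⟨$⟩ˡ j)) , λ j →
    let (ξ-sign , τ≈ , s≈) = π-matches (π ⟨$⟩ˡ j)
        back = Permutation.inverseʳ π {j} in
    ξ-sign , sym (trans (reflexive (≡.cong τ′ (≡.sym back))) τ≈) ,
    λ i → sym (trans (*-congˡ (trans (reflexive (≡.cong (λ j → s′ j i) (≡.sym back))) (s≈ i)))
      (trans (sym (*-assoc _ _ _)) (trans (*-congʳ (sign² ξ-sign)) (*-identityˡ _))))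

  ∼-trans : ∀ {m m′ m″ n} {p : Parametric m n} {q : Parametric m′ n} {u : Parametric m″ n} → p ∼ q → q ∼ u → p ∼ u
  ∼-trans (π , ξ , π-matches) (ρ , η , ρ-matches) = π ∘ₚ ρ , (λ i → η (π ⟨$⟩ʳ i) * ξ i) , λ i →
    let (ξ-sign , τ≈ , s≈) = π-matches i
        (η-sign , τ≈′ , s≈′) = ρ-matches (π ⟨$⟩ʳ i) in
    square-one⇒sign (trans (solve 2 (λ a b → (a :* b) :* (a :* b) := (a :* a) :* (b :* b)) refl _ _)
      (trans (*-cong (sign² η-sign) (sign² ξ-sign)) (*-identityˡ 1#))) ,
    trans τ≈′ τ≈ ,
    λ j → trans (s≈′ j) (trans (*-congˡ (s≈ j)) (sym (*-assoc _ _ _)))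

  uniqueness : ∀ {r n} {τ : Vector ℝ r} {s : Fin r → Vector ℝ n} {A} → Fin n →
    (∀ k → 0# < τ k) → Signs s → SchurFree s → LinearlyIndependent s → A ≈ₘ ∑τssᵗ (τ , s) →
    HasUniqueDecomposition A
  uniqueness {n = n} {τ = τ} {s} {A} i₀ 0<τ s-signs s-free s-indep A≈s p q p-dec q-dec =
    ∼-trans {p = p} {q = τ , s} {u = q} (reference p-dec) (∼-sym {p = q} {q = τ , s} (reference q-dec))
    where
    reference : ∀ {m} {p : Parametric m n} → IsSignComponentDecomposition A p → p ∼ (τ , s)
    reference = decomposition-∼ i₀ 0<τ s-signs s-free s-indep A≈s

  -- The r independent vectors that span the range of A lie in the span of the r vectors s_k.
  rank⇒independent : ∀ {r n} {τ : Vector ℝ r} {s : Fin r → Vector ℝ n} {A} →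
                     HasRank A r → A ≈ₘ ∑τssᵗ (τ , s) → LinearlyIndependent s
  rank⇒independent {r} {τ = τ} {s} {A} (b , b-indep , b∈A , _) A≈s = spanning⇒independent b-indep
    (λ j → span-trans {w = column A} column∈s (InSpan⇒Span (b∈A j)))
    where
    column∈s : ∀ j → Span s (column A j)
    column∈s j = (λ k → τ k * s k j) , λ i → trans (A≈s i j) (sum-cong {r} (λ k →
      solve 3 (λ τ a b → τ :* (a :* b) := τ :* b :* a) refl (τ k) (s k i) (s k j)))

  independent⇒≤ : ∀ {r n} {s : Fin r → Vector ℝ n} → LinearlyIndependent s → r ℕ.≤ n
  independent⇒≤ {n = n} {s} s-indep = independent-≤ {v = δ} s-indep (λ j → s j , λ i → sym (trans
    (sum-single i (λ k k≢i → trans (*-congˡ (δ-diff k≢i)) (zeroʳ _))) (trans (*-congˡ (δ-same i)) (*-identityʳ _))))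

-- The two optimisation problems of one iteration.

module AlgorithmAnalysis (ℛ : RealNumbers) where

  open SignComponents ℛ
  open OrderedField ℛ
  open Summation ℛ
  open LinearAlgebra ℛ
  open Programs ℛ
  open Semidefinite ℛ
  open SchurIndependence ℛ

  argmax : ∀ {r} (a : Vector ℝ (suc r)) → ∃ λ k → ∀ l → a l ≤ a k
  argmax {zero}  a = zero , λ { zero → ≤-refl }
  argmax {suc r} a with argmax (tail a)
  ... | k , k-max with total (a zero) (a (suc k))
  ...   | inj₁ a₀≤aₖ = suc k , λ { zero → a₀≤aₖ ; (suc l) → k-max l }
  ...   | inj₂ aₖ≤a₀ = zero , λ { zero → ≤-refl ; (suc l) → ≤-trans (k-max l) aₖ≤a₀ }

  sum-ones : ∀ n → sum {n} (λ _ → 1#) ≈ n · 1#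
  sum-ones zero    = refl
  sum-ones (suc n) = +-congˡ (sum-ones n)

  span-dual : ∀ {r n} {t u : Fin r → Vector ℝ n} → (∀ k l → ⟨ u k , t l ⟩ ≈ δ k l) →
              ∀ {y} → Span t y → y ≈ᵥ combination (λ k → ⟨ u k , y ⟩) t
  span-dual {r} {t = t} {u} u-dual {y} (c , y≈ct) i = trans (y≈ct i) (sum-cong {r} (λ k → *-congʳ (sym (begin
    ⟨ u k , y ⟩                      ≈⟨ ⟨⟩-cong {x = u k} (λ _ → refl) y≈ct ⟩
    ⟨ u k , combination c t ⟩        ≈⟨ ⟨⟩-combinationʳ (u k) c t ⟩
    sum (λ l → c l * ⟨ u k , t l ⟩)  ≈⟨ sum-cong {r} (λ l → trans (*-congˡ (u-dual k l)) (*-comm _ _)) ⟩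
    sum (λ l → δ k l * c l)          ≈⟨ sum-δˡ k c ⟩
    c k                              ∎))))
    where open ≈-Reasoning

  -- The loop invariant: B is a convex combination with positive weights of the
  -- dyads of the sign components which have not been found yet.
  record State {n r} (B : Matrix n n) (c : Vector ℝ r) (t : Fin r → Vector ℝ n) : Set where
    field
      positive    : ∀ k → 0# < c k
      total≈1     : sum c ≈ 1#
      signs       : Signs t
      schurFree   : SchurFree t
      independent : LinearlyIndependent t
      represents  : B ≈ₘ ∑τssᵗ (c , t)

    dual : Fin r → Vector ℝ n
    dual k = proj₁ (dual-vector independent k)

    dual-inner : ∀ k l → ⟨ dual k , t l ⟩ ≈ δ k l
    dual-inner k = proj₂ (dual-vector independent k)

    column-in-span : ∀ j → Span t (column B j)
    column-in-span j = (λ k → c k * t k j) , λ i → trans (represents i j) (sum-cong {r} (λ k →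
      solve 3 (λ τ a b → τ :* (a :* b) := τ :* b :* a) refl (c k) (t k i) (t k j)))

    -- B maps the dual vector of t_k to c_k t_k, and c_k is nonzero.
    component-in-range : ∀ k → Span (column B) (t k)
    component-in-range k = (λ j → c k ⁻¹ * dual k j) , λ i → begin
      t k i
        ≈⟨ trans (*-congʳ (*-inverseˡ (>⇒≉ (positive k)))) (*-identityˡ _) ⟨
      c k ⁻¹ * c k * t k i                              ≈⟨ *-assoc _ _ _ ⟩
      c k ⁻¹ * (c k * t k i)                            ≈⟨ *-congˡ (B*dual i) ⟨
      c k ⁻¹ * (B *ᵥ dual k) i                          ≈⟨ *-distribˡ-sum {n} (c k ⁻¹) _ ⟩
      sum (λ j → c k ⁻¹ * (B i j * dual k j))
        ≈⟨ sum-cong {n} (λ j → solve 3 (λ ι b d → ι :* (b :* d) := ι :* d :* b) refl (c k ⁻¹) (B i j) (dual k j)) ⟩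
      sum (λ j → c k ⁻¹ * dual k j * B i j)             ∎
      where
      open ≈-Reasoning
      B*dual : ∀ i → (B *ᵥ dual k) i ≈ c k * t k i
      B*dual i = begin
        (B *ᵥ dual k) i                                 ≈⟨ sum-cong {n} (λ j → *-congʳ (represents i j)) ⟩
        (∑τssᵗ (c , t) *ᵥ dual k) i                     ≈⟨ ∑-*ᵥ c t (dual k) i ⟩
        sum (λ l → c l * ⟨ t l , dual k ⟩ * t l i)
          ≈⟨ sum-cong {r} (λ l → trans (*-congʳ (*-congˡ (trans (⟨⟩-comm (t l) (dual k)) (dual-inner k l))))
              (solve 3 (λ a d x → a :* d :* x := d :* (a :* x)) refl (c l) (δ k l) (t l i))) ⟩
        sum (λ l → δ k l * (c l * t l i))               ≈⟨ sum-δˡ k (λ l → c l * t l i) ⟩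
        c k * t k i                                     ∎

  Feasible₁ : ∀ {n k} → Matrix n k → Matrix n n → Set
  Feasible₁ {n} V X = trace (V ᵗ *ₘ X *ₘ V) ≈ n · 1# × diag X ≈ᵥ 𝐞 × PositiveSemidefinite X

  module FirstProgram {n r k} {B : Matrix n n} {c : Vector ℝ r} {t : Fin r → Vector ℝ n} {V : Matrix n k}
    (i₀ : Fin n) (state : State B c t) (V-basis : IsOrthonormalBasisOfRange B V) where

    open State state

    V-orthonormal : Orthonormal (column V)
    V-orthonormal = let (unit , orth , _) = V-basis in unit , orth

    V-in-span : ∀ a → Span t (column V a)
    V-in-span a = let (_ , _ , V∈B , _) = V-basis in
      span-trans {w = column B} column-in-span (InSpan⇒Span (V∈B a))

    component-in-V : ∀ k → Span (column V) (t k)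
    component-in-V k = let (_ , _ , _ , B∈V) = V-basis in
      span-trans {v = column V} {w = column B} (λ j → InSpan⇒Span (B∈V j)) (component-in-range k)

    dyad-feasible : ∀ k → Feasible₁ V (dyad (t k))
    dyad-feasible k =
      trans (trace-dyad {V = V} V-orthonormal (component-in-V k))
        (trans (sum-cong {n} (λ i → sign² (signs k i))) (sum-ones n)) ,
      (λ i → sign² (signs k i)) , dyad-psd (t k)

    -- The trace constraint puts the columns of X into the span of t. Expanding first the columns
    -- and then, by symmetry, the rows in dual coordinates yields M; its diagonal consists of values
    -- of the form of X and is therefore nonnegative.
    feasible-structure : ∀ X → Feasible₁ V X →
      ∃ λ m → (∀ l → 0# ≤ m l) × sum m ≈ 1# × X ≈ₘ ∑τssᵗ (m , t)
    feasible-structure X (trace≈n , diag≈1 , X-psd@(X-sym , X≥0)) =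
      (λ l → M l l) , (λ l → X≥0 (dual l)) , trace≈1 , λ i j → trans (X≈M i j) (sum-cong {r} (λ k →
        sum-single k (λ l l≢k → trans (*-congʳ (M-off k l (l≢k ∘ ≡.sym))) (zeroˡ _))))
      where
      open ≈-Reasoning
      M : Matrix r r
      M k l = ⟨ dual l , X *ᵥ dual k ⟩
      trace-X : trace (V ᵗ *ₘ X *ₘ V) ≈ trace X
      trace-X = trans trace≈n (sym (trans (sum-cong {n} diag≈1) (sum-ones n)))
      X∈t : ∀ j → Span t (column X j)
      X∈t j = span-trans {w = column V} V-in-span (trace-range {V = V} V-orthonormal X-psd trace-X j)
      X*∈t : ∀ y → Span t (X *ᵥ y)
      X*∈t y = span-resp (λ i → sum-cong {n} (λ j → *-comm _ _)) (span-combination X∈t y)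
      X≈M : ∀ i j → X i j ≈ sum (λ k → sum (λ l → M k l * (t k i * t l j)))
      X≈M i j = begin
        X i j                                             ≈⟨ span-dual dual-inner (X∈t j) i ⟩
        sum (λ k → ⟨ dual k , column X j ⟩ * t k i)
          ≈⟨ sum-cong {r} (λ k → *-congʳ (sum-cong {n} (λ i → trans (*-comm _ _) (*-congʳ (X-sym j i))))) ⟩
        sum (λ k → (X *ᵥ dual k) j * t k i)
          ≈⟨ sum-cong {r} (λ k → *-congʳ (span-dual dual-inner (X*∈t (dual k)) j)) ⟩
        sum (λ k → sum (λ l → M k l * t l j) * t k i)
          ≈⟨ sum-cong {r} (λ k → trans (*-distribʳ-sum {r} (t k i) _) (sum-cong {r} (λ l →
              solve 3 (λ m a b → m :* b :* a := m :* (a :* b)) refl (M k l) (t k i) (t l j)))) ⟩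
        sum (λ k → sum (λ l → M k l * (t k i * t l j)))   ∎
      Mt≈1 : ∀ i → quadratic M t i ≈ 1#
      Mt≈1 i = trans (sym (X≈M i i)) (diag≈1 i)
      M-off : ∀ k l → k ≢ l → M k l ≈ 0#
      M-off k l k≢l = x+x≈0⇒x≈0 (trans (+-congˡ (form-symmetric X-sym (dual l) (dual k))) (schurFree M 1# Mt≈1 k l k≢l))
      trace≈1 : trace M ≈ 1#
      trace≈1 = trans (sym (quadratic-diagonal signs M-off i₀)) (Mt≈1 i₀)

    module Objective (g : Vector ℝ n) (k : Fin r)
      (k-max : ∀ l → ⟨ t l , g ⟩ * ⟨ t l , g ⟩ ≤ ⟨ t k , g ⟩ * ⟨ t k , g ⟩) where

      a : Vector ℝ r
      a l = ⟨ t l , g ⟩ * ⟨ t l , g ⟩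

      objective : ∀ {X m} → X ≈ₘ ∑τssᵗ (m , t) → ⟨ g , X *ᵥ g ⟩ ≈ sum (λ l → m l * a l)
      objective {m = m} X≈ = trans (form-cong X≈ g g) (∑-form m t g g)

      constant : ∀ {m : Vector ℝ r} → sum m ≈ 1# → sum (λ l → m l * a k) ≈ a k
      constant m≈1 = trans (sym (*-distribʳ-sum {r} (a k) _)) (trans (*-congʳ m≈1) (*-identityˡ _))

      dyad-solution : IsSolution₁ V g (dyad (t k))
      dyad-solution = dyad-feasible k , λ Y Y-feasible →
        let (m , 0≤m , m≈1 , Y≈) = feasible-structure Y Y-feasible in
        ≤-respˡ-≈ (sym (objective Y≈)) (≤-respʳ-≈ (trans (constant m≈1) (sym (dyad-form (t k) g g)))
          (sum-mono-≤ {r} (λ l → *-monoˡ-≤ (0≤m l) (k-max l))))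

      -- For an optimal convex combination Σ m_l (a_k - a_l) ≤ 0, while every term is nonnegative.
      -- So all terms vanish, and m_l = 0 wherever a_l differs from the maximum a_k.
      solution-unique : (∀ l → l ≢ k → ¬ (a l ≈ a k)) → ∀ X → IsSolution₁ V g X → X ≈ₘ dyad (t k)
      solution-unique a-distinct X (X-feasible , X-max) = λ i j → trans (X≈ i j)
        (trans (sum-single k (λ l l≢k → trans (*-congʳ (others l l≢k)) (zeroˡ _)))
          (trans (*-congʳ mₖ≈1) (*-identityˡ _)))
        where
        structure = feasible-structure X X-feasible
        m = proj₁ structure
        0≤m = proj₁ (proj₂ structure)
        m≈1 = proj₁ (proj₂ (proj₂ structure))
        X≈ = proj₂ (proj₂ (proj₂ structure))
        gap-nonNegative : ∀ l → 0# ≤ m l * (a k - a l)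
        gap-nonNegative l = *-nonNegative (0≤m l) (≤⇒0≤y-x (k-max l))
        gap : sum (λ l → m l * (a k - a l)) ≈ a k - sum (λ l → m l * a l)
        gap = trans (sum-cong {r} (λ l → solve 3 (λ m a b → m :* (a :- b) := m :* a :- m :* b) refl (m l) (a k) (a l)))
          (trans (sum-sub {r} _ _) (+-congʳ (constant m≈1)))
        gap≤0 : sum (λ l → m l * (a k - a l)) ≤ 0#
        gap≤0 = ≤-respˡ-≈ (sym gap) (≤-respʳ-≈ (-‿inverseʳ _) (+-monoˡ-≤ (- sum (λ l → m l * a l))
          (≤-respˡ-≈ (dyad-form (t k) g g) (≤-respʳ-≈ (objective X≈) (X-max (dyad (t k)) (dyad-feasible k))))))
        others : ∀ l → l ≢ k → m l ≈ 0#
        others l l≢k = *-zero-product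
          (trans (*-comm _ _) (sum-nonNegative-zero gap-nonNegative (antisym gap≤0 (sum-nonNegative gap-nonNegative)) l))
          (λ e → a-distinct l l≢k (sym (x-y≈0⇒x≈y _ _ e)))
        mₖ≈1 : m k ≈ 1#
        mₖ≈1 = trans (sym (sum-single k others)) m≈1

  module SecondProgram {n r} {B : Matrix n n} {c : Vector ℝ (suc (suc r))} {t : Fin (suc (suc r)) → Vector ℝ n}
    (state : State B c t) (k : Fin (suc (suc r))) where

    open State state
    open ≈-Reasoning

    rest : ℝ
    rest = sum (removeAt c k)

    0<rest : 0# < rest
    0<rest = +-positive (positive (punchIn k zero)) (sum-nonNegative {r} (λ i → proj₁ (positive (punchIn k (suc i)))))

    cₖ+rest≈1 : c k + rest ≈ 1#
    cₖ+rest≈1 = trans (sym (sum-remove {i = k} c)) total≈1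

    -- In ζB + (1 - ζ) t_k t_kᵗ the component t_k has weight ζ c_k + 1 - ζ = 1 - ζ (1 - c_k), and 1
    -- - c_k is `rest`; the weight vanishes at the inverse of `rest`. As another component is
    -- present, `rest` is positive.
    ζ★ : ℝ
    ζ★ = rest ⁻¹

    weights : ℝ → Vector ℝ (suc (suc r))
    weights ζ l = ζ * c l + (1# - ζ) * δ k l

    affine-weights : ∀ {X} → X ≈ₘ dyad (t k) → ∀ ζ → affine ζ B X ≈ₘ ∑τssᵗ (weights ζ , t)
    affine-weights {X} X≈ ζ i j = sym (begin
      sum (λ l → (ζ * c l + (1# - ζ) * δ k l) * (t l i * t l j))
        ≈⟨ sum-cong {suc (suc r)} {g = λ l → ζ * (c l * (t l i * t l j)) + (1# - ζ) * (δ k l * (t l i * t l j))}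
             (λ l → solve 5 (λ z c o d x → (z :* c :+ o :* d) :* x := z :* (c :* x) :+ o :* (d :* x)) refl ζ (c l) (1# - ζ) (δ k l) (t l i * t l j)) ⟩
      sum (λ l → ζ * (c l * (t l i * t l j)) + (1# - ζ) * (δ k l * (t l i * t l j)))
        ≈⟨ ∑-distrib-+ (λ l → ζ * (c l * (t l i * t l j))) (λ l → (1# - ζ) * (δ k l * (t l i * t l j))) ⟩
      sum (λ l → ζ * (c l * (t l i * t l j))) + sum (λ l → (1# - ζ) * (δ k l * (t l i * t l j)))
        ≈⟨ +-cong (*-distribˡ-sum ζ (λ l → c l * (t l i * t l j))) (*-distribˡ-sum (1# - ζ) (λ l → δ k l * (t l i * t l j))) ⟨
      ζ * sum (λ l → c l * (t l i * t l j)) + (1# - ζ) * sum (λ l → δ k l * (t l i * t l j))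
        ≈⟨ +-cong (*-congˡ (sym (represents i j))) (*-congˡ (trans (sum-δˡ k (λ l → t l i * t l j)) (sym (X≈ i j)))) ⟩
      affine ζ B X i j ∎)

    weight-found : ∀ ζ → weights ζ k ≈ 1# - ζ * rest
    weight-found ζ = begin
      ζ * c k + (1# - ζ) * δ k k     ≈⟨ +-congˡ (trans (*-congˡ (δ-same k)) (*-identityʳ _)) ⟩
      ζ * c k + (1# - ζ)
        ≈⟨ solve 3 (λ z c s → z :* c :+ (con (+ 1) :- z) := con (+ 1) :+ z :* (c :+ s :- con (+ 1)) :- z :* s) refl ζ (c k) rest ⟩
      1# + ζ * (c k + rest - 1#) - ζ * rest
        ≈⟨ +-congʳ (trans (+-congˡ (trans (*-congˡ (trans (+-congʳ cₖ+rest≈1) (-‿inverseʳ 1#))) (zeroʳ ζ))) (+-identityʳ 1#)) ⟩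
      1# - ζ * rest                  ∎

    weight-other : ∀ ζ l → k ≢ l → weights ζ l ≈ ζ * c l
    weight-other ζ l k≢l = trans (+-congˡ (trans (*-congˡ (δ-diff k≢l)) (zeroʳ _))) (+-identityʳ _)

    -- The form at the dual vector of t_k isolates the weight 1 - ζ · `rest`, which must be
    -- nonnegative.
    feasible-≤ : ∀ {X} → X ≈ₘ dyad (t k) → ∀ ζ → PositiveSemidefinite (affine ζ B X) → ζ ≤ ζ★
    feasible-≤ {X} X≈ ζ (_ , ≥0) = ≤-respʳ-≈ (*-identityˡ ζ★) (≤-respˡ-≈
      (trans (*-assoc ζ rest ζ★) (trans (*-congˡ (*-inverseʳ (>⇒≉ 0<rest))) (*-identityʳ ζ)))
      (*-monoʳ-≤ (proj₁ (⁻¹-positive 0<rest)) (0≤y-x⇒≤ (≤-respʳ-≈ form (≥0 (dual k))))))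
      where
      form : ⟨ dual k , affine ζ B X *ᵥ dual k ⟩ ≈ 1# - ζ * rest
      form = begin
        ⟨ dual k , affine ζ B X *ᵥ dual k ⟩
          ≈⟨ trans (form-cong (affine-weights X≈ ζ) (dual k) (dual k)) (∑-form (weights ζ) t (dual k) (dual k)) ⟩
        sum (λ l → weights ζ l * (⟨ t l , dual k ⟩ * ⟨ t l , dual k ⟩))
          ≈⟨ sum-single {f = λ l → weights ζ l * (⟨ t l , dual k ⟩ * ⟨ t l , dual k ⟩)} k
               (λ l l≢k → trans (*-congˡ (trans (*-congʳ (trans (⟨t,dual⟩ l) (δ-diff (l≢k ∘ ≡.sym)))) (zeroˡ _))) (zeroʳ _)) ⟩
        weights ζ k * (⟨ t k , dual k ⟩ * ⟨ t k , dual k ⟩)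
          ≈⟨ *-congˡ (trans (*-cong ⟨tₖ,dual⟩≈1 ⟨tₖ,dual⟩≈1) (*-identityˡ 1#)) ⟩
        weights ζ k * 1#
          ≈⟨ trans (*-identityʳ _) (weight-found ζ) ⟩
        1# - ζ * rest ∎
        where
        ⟨t,dual⟩ : ∀ l → ⟨ t l , dual k ⟩ ≈ δ k l
        ⟨t,dual⟩ l = trans (⟨⟩-comm (t l) (dual k)) (dual-inner k l)
        ⟨tₖ,dual⟩≈1 : ⟨ t k , dual k ⟩ ≈ 1#
        ⟨tₖ,dual⟩≈1 = trans (⟨t,dual⟩ k) (δ-same k)

    weight-found★ : ∀ {ζ} → ζ ≈ ζ★ → weights ζ k ≈ 0#
    weight-found★ {ζ} ζ≈ζ★ = trans (weight-found ζ)
      (trans (+-congˡ (-‿cong (trans (*-congʳ ζ≈ζ★) (*-inverseˡ (>⇒≉ 0<rest))))) (-‿inverseʳ 1#))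

    ζ★-feasible : ∀ {X} → X ≈ₘ dyad (t k) → PositiveSemidefinite (affine ζ★ B X)
    ζ★-feasible {X} X≈ = psd-resp-≈ (λ i j → sym (affine-weights {X} X≈ ζ★ i j)) (∑-psd t nonNegative)
      where
      nonNegative : ∀ l → 0# ≤ weights ζ★ l
      nonNegative l with k Fin.≟ l
      ... | yes ≡.refl = ≤-reflexive (sym (trans (+-congˡ (*-congˡ (sym (δ-same k)))) (weight-found★ refl)))
      ... | no  k≢l    = ≤-respʳ-≈ (sym (trans (+-congˡ (zeroʳ _)) (+-identityʳ _)))
        (*-nonNegative (proj₁ (⁻¹-positive 0<rest)) (proj₁ (positive l)))

    ζ★-solution : ∀ {X} → X ≈ₘ dyad (t k) → IsSolution₂ B X ζ★
    ζ★-solution X≈ = ζ★-feasible X≈ , feasible-≤ X≈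

    solution-unique : ∀ {X ζ} → X ≈ₘ dyad (t k) → IsSolution₂ B X ζ → ζ ≈ ζ★
    solution-unique X≈ (ζ-feasible , ζ-max) = antisym (feasible-≤ X≈ _ ζ-feasible) (ζ-max ζ★ (ζ★-feasible X≈))

    -- The remaining weights are rescaled by 1 / `rest` to have sum one. B′ is tied to the affine
    -- combination by `≈ₘ` only, so that the lemma covers both the relation `Loop` and the matrix
    -- computed by the program.
    next-state : ∀ {X ζ B′} → X ≈ₘ dyad (t k) → IsSolution₂ B X ζ → B′ ≈ₘ affine ζ B X →
                 State B′ (λ l → ζ★ * removeAt c k l) (removeAt t k)
    next-state {X} {ζ} {B′} X≈ ζ-solution B′≈ = record
      { positive    = λ l → *-positive (⁻¹-positive 0<rest) (positive (punchIn k l))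
      ; total≈1     = trans (sym (*-distribˡ-sum ζ★ (removeAt c k))) (*-inverseˡ (>⇒≉ 0<rest))
      ; signs       = λ l → signs (punchIn k l)
      ; schurFree   = schurFree-removeAt t k schurFree
      ; independent = independent-removeAt t k independent
      ; represents  = λ i j → begin
          B′ i j                ≈⟨ B′≈ i j ⟩
          affine ζ B X i j      ≈⟨ affine-weights X≈ ζ i j ⟩
          sum (λ l → weights ζ l * (t l i * t l j))
                                ≈⟨ sum-remove {i = k} (λ l → weights ζ l * (t l i * t l j)) ⟩
          weights ζ k * (t k i * t k j) + sum (λ l → weights ζ (punchIn k l) * (t (punchIn k l) i * t (punchIn k l) j))
                                ≈⟨ +-cong (trans (*-congʳ (weight-found★ ζ≈ζ★)) (zeroˡ _))
                                     (sum-cong {suc r} {f = λ l → weights ζ (punchIn k l) * (t (punchIn k l) i * t (punchIn k l) j)}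
                                       (λ l → *-congʳ (trans (weight-other ζ (punchIn k l) (punchInᵢ≢i k l ∘ ≡.sym)) (*-congʳ ζ≈ζ★)))) ⟩
          0# + ∑τssᵗ ((λ l → ζ★ * removeAt c k l) , removeAt t k) i j
                                ≈⟨ +-identityˡ _ ⟩
          ∑τssᵗ ((λ l → ζ★ * removeAt c k l) , removeAt t k) i j ∎ }
      where
      ζ≈ζ★ : ζ ≈ ζ★
      ζ≈ζ★ = solution-unique X≈ ζ-solution

-- The loop, as a relation and as a program.

module LoopAnalysis (ℛ : RealNumbers) where

  open SignComponents ℛ
  open OrderedField ℛ
  open Summation ℛ
  open LinearAlgebra ℛ
  open Programs ℛ
  open Semidefinite ℛ
  open SchurIndependence ℛ
  open Uniqueness ℛ
  open AlgorithmAnalysis ℛ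

  -- The first semidefinite program has a unique solution for such g.
  Separates : ∀ {r n} → Vector ℝ n → (Fin r → Vector ℝ n) → Set
  Separates g t = ∀ k l → k ≢ l → ¬ (⟨ t k , g ⟩ * ⟨ t k , g ⟩ ≈ ⟨ t l , g ⟩ * ⟨ t l , g ⟩)

  separates-removeAt : ∀ {r n} {g : Vector ℝ n} {t : Fin (suc r) → Vector ℝ n} p →
                       Separates g t → Separates g (removeAt t p)
  separates-removeAt p sep k l k≢l = sep (punchIn p k) (punchIn p l) (k≢l ∘ punchIn-injective p k l)

  -- Factorising a dyad recovers its vector only up to sign, so the components are compared through
  -- their dyads.
  Matches : ∀ {r r′ n} → (Fin r → Vector ℝ n) → (Fin r′ → Vector ℝ n) → Set
  Matches {r} {r′} s t = ∃ λ (p : Fin r → Fin r′) →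
    (∀ {i j} → p i ≡ p j → i ≡ j) × (∀ i → dyad (s i) ≈ₘ dyad (t (p i)))

  extend-matches : ∀ {r n} {s : Fin (suc r) → Vector ℝ n} {t : Fin (suc r) → Vector ℝ n} k →
    dyad (head s) ≈ₘ dyad (t k) → Matches (tail s) (removeAt t k) → Matches s t
  extend-matches {r} {s = s} {t} k s₀≈tₖ (p′ , p′-injective , p′-matches) = p , p-injective , matches
    where
    p : Fin (suc r) → Fin (suc r)
    p = k ∷ (punchIn k ∘ p′)
    p-injective : ∀ {i j} → p i ≡ p j → i ≡ j
    p-injective {zero}  {zero}  e = ≡.refl
    p-injective {zero}  {suc j} e = ⊥-elim (punchInᵢ≢i k (p′ j) (≡.sym e))
    p-injective {suc i} {zero}  e = ⊥-elim (punchInᵢ≢i k (p′ i) e)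
    p-injective {suc i} {suc j} e = ≡.cong suc (p′-injective (punchIn-injective k (p′ i) (p′ j) e))
    matches : ∀ i → dyad (s i) ≈ₘ dyad (t (p i))
    matches zero    = s₀≈tₖ
    matches (suc i) = p′-matches i

  abstract
    best : ∀ {n r} (t : Fin (suc r) → Vector ℝ n) g →
           ∃ λ k → ∀ l → ⟨ t l , g ⟩ * ⟨ t l , g ⟩ ≤ ⟨ t k , g ⟩ * ⟨ t k , g ⟩
    best t g = argmax (λ l → ⟨ t l , g ⟩ * ⟨ t l , g ⟩)

  module Step {n r k} {B : Matrix n n} {c : Vector ℝ (suc r)} {t : Fin (suc r) → Vector ℝ n}
    (i₀ : Fin n) (state : State B c t) (g : Vector ℝ n) (sep : Separates g t)
    {V : Matrix n k} (V-basis : IsOrthonormalBasisOfRange B V) where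

    open FirstProgram {V = V} i₀ state V-basis

    abstract
      step-solution : IsSolution₁ V g (dyad (t (proj₁ (best t g))))
      step-solution = Objective.dyad-solution g (proj₁ (best t g)) (proj₂ (best t g))

      step-unique : ∀ X → IsSolution₁ V g X → X ≈ₘ dyad (t (proj₁ (best t g)))
      step-unique = Objective.solution-unique g (proj₁ (best t g)) (proj₂ (best t g)) (λ l → sep l (proj₁ (best t g)))

  -- The weight of the last component is the total weight 1.
  single-state : ∀ {n} {B : Matrix n n} {c} {t : Fin 1 → Vector ℝ n} → State B c t → B ≈ₘ dyad (t zero)
  single-state {B = B} {c} {t} state i j = begin
    B i j                                      ≈⟨ represents i j ⟩
    c zero * (t zero i * t zero j) + 0#        ≈⟨ +-identityʳ _ ⟩
    c zero * (t zero i * t zero j)             ≈⟨ *-congʳ (trans (sym (+-identityʳ _)) total≈1) ⟩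
    1# * (t zero i * t zero j)                 ≈⟨ *-identityˡ _ ⟩
    t zero i * t zero j                        ∎
    where
    open State state
    open ≈-Reasoning

  -- Whatever basis a run chooses, separation leaves a single solution of the first program, the
  -- dyad of the component that `best` selects for the draw; the second program has a single
  -- solution as well. So each pass removes one known component.
  loop-components : ∀ {n} r {B : Matrix n n} {c} {t : Fin r → Vector ℝ n} → Fin n → State B c t →
    ∀ g → (∀ i → Separates (g i) t) → ∀ s → Loop r B g s → Matches s t
  loop-components zero i₀ state g sep s _ = id , (λ e → e) , λ ()
  loop-components (suc zero) i₀ state g sep s B≈ss = id , (λ e → e) , λ { zero → λ i j →
    trans (sym (B≈ss i j)) (single-state state i j) }
  loop-components (suc (suc r)) {t = t} i₀ state g sep s (_ , V , X , ζ , V-basis , X-sol , X≈ss , ζ-sol , rest) =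
    extend-matches {s = s} {t} k (λ i j → trans (sym (X≈ss i j)) (X≈tt i j))
      (loop-components (suc r) i₀ (SecondProgram.next-state state k X≈tt ζ-sol (λ _ _ → refl)) (tail g)
        (λ i → separates-removeAt {g = g (suc i)} {t} k (sep (suc i))) (tail s) rest)
    where
    k : Fin (suc (suc r))
    k = proj₁ (best t (head g))
    X≈tt : X ≈ₘ dyad (t k)
    X≈tt = Step.step-unique i₀ state (head g) (sep zero) {V = V} V-basis X X-sol

  injective⇒permutation : ∀ {r} (p : Fin r → Fin r) → (∀ {i j} → p i ≡ p j → i ≡ j) →
                          ∃ λ (π : Permutation r r) → ∀ i → π ⟨$⟩ʳ i ≡ p i
  injective⇒permutation {r} p p-injective =
    permutation p (proj₁ ∘ preimage) (proj₂ ∘ preimage) (λ i → p-injective (proj₂ (preimage (p i)))) , λ _ → ≡.refl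
    where
    missed : ∀ {r} (p : Fin r → Fin r) → (∀ {i j} → p i ≡ p j → i ≡ j) → ∀ k → ¬ (∀ i → k ≢ p i)
    missed {suc r} p p-injective k k∉p = ℕ.1+n≰n (injective⇒≤ {f = λ i → punchOut (k∉p i)}
      (λ {i} {j} e → p-injective (punchOut-injective (k∉p i) (k∉p j) e)))
    preimage : ∀ k → ∃ λ i → p i ≡ k
    preimage k with Fin.any? (λ i → p i Fin.≟ k)
    ... | yes q = q
    ... | no ∄i = ⊥-elim (missed p p-injective k (λ i e → ∄i (i , ≡.sym e)))

  -- That the output consists of signs follows from the diagonals of the matched dyads, and that its
  -- dyads are distinct from the injectivity of the matching. It is therefore itself a decomposition
  -- of A, to be compared with s.
  run-decomposition : ∀ {n r} {A : Matrix n n} {τ s} → Fin n → State A τ s →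
    (∀ i j → i ≢ j → ¬ (dyad (s i) ≈ₘ dyad (s j))) →
    ∀ g → (∀ i → Separates (g i) s) → ∀ (out : Parametric r n) → IsRun A g out → (τ , s) ∼ out
  run-decomposition {n} {r} {A} {τ} {s} i₀ state s-distinct g sep (τ′ , s′) (loop , Δ , A≈) =
    ∼-sym {p = τ′ , s′} {q = τ , s} (decomposition-∼ i₀ positive signs schurFree independent represents
      (Δ , (λ k j → square-one⇒sign (trans (matches k j j) (sign² (signs (p k) j)))) , distinct , A≈))
    where
    open State state
    components = loop-components r i₀ state g sep s′ loop
    p = proj₁ components
    matches : ∀ i → dyad (s′ i) ≈ₘ dyad (s (p i))
    matches = proj₂ (proj₂ components)
    distinct : ∀ i j → i ≢ j → ¬ (dyad (s′ i) ≈ₘ dyad (s′ j))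
    distinct i j i≢j e = s-distinct (p i) (p j) (i≢j ∘ proj₁ (proj₂ components)) (λ a b →
      trans (sym (matches i a b)) (trans (e a b) (matches j a b)))

  basis-resp-≈ : ∀ {m n k} {X Y : Matrix m n} {V : Matrix m k} → X ≈ₘ Y →
                 IsOrthonormalBasisOfRange X V → IsOrthonormalBasisOfRange Y V
  basis-resp-≈ X≈Y (unit , orth , V∈X , X∈V) = unit , orth ,
    (λ j → let (k , f , c , p) = V∈X j in k , f , c , λ i → trans (p i) (sum-cong {k} (λ l → *-congˡ (X≈Y i (f l))))) ,
    (λ j → let (k , f , c , p) = X∈V j in k , f , c , λ i → trans (sym (X≈Y i j)) (p i))

  solution₂-resp-≈ : ∀ {n} {B C X : Matrix n n} {ζ} → B ≈ₘ C → IsSolution₂ B X ζ → IsSolution₂ C X ζ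
  solution₂-resp-≈ {B = B} {C} {X} B≈C (feasible , max) =
    psd-resp-≈ (affine-cong B≈C _) feasible ,
    λ η η-feasible → max η (psd-resp-≈ (affine-cong (λ i j → sym (B≈C i j)) η) η-feasible)
    where
    affine-cong : ∀ {B C} → B ≈ₘ C → ∀ ζ → affine ζ B X ≈ₘ affine ζ C X
    affine-cong B≈C ζ i j = +-congʳ (*-congˡ (B≈C i j))

  sign≉0 : ∀ {x} → IsSign x → ¬ (x ≈ 0#)
  sign≉0 x-sign x≈0 = 0≉1 (trans (sym (zeroˡ _)) (trans (*-congʳ (sym x≈0)) (sign² x-sign)))

  weights : ∀ {n r} → Matrix n n → (Fin r → Vector ℝ n) → Vector ℝ r
  weights A s = value (each (λ k → dyadᶜ (s k)) >>= λ S → linearSolve (λ k → flatten (S k)) (flatten A))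

  -- The form of Σ c_l s̃_l s̃_lᵗ at the dual vector of s_(p k) is c_k, so the flattened dyads are
  -- independent. The linear system then has the one solution τ ∘ p, and p is a permutation.
  weights-correct : ∀ {n r} {A : Matrix n n} {τ} {s s̃ : Fin r → Vector ℝ n} → State A τ s → Matches s̃ s →
    Δ⁺ (weights A s̃) × A ≈ₘ ∑τssᵗ (weights A s̃ , s̃)
  weights-correct {n} {r} {A} {τ} {s} {s̃} state (p , p-injective , matches) = (τ̃-positive , τ̃-total) , A≈
    where
    open State state
    open ≈-Reasoning
    π = proj₁ (injective⇒permutation p p-injective)
    π≡p = proj₂ (injective⇒permutation p p-injective)
    S : Fin r → Matrix n n
    S = value (each λ k → dyadᶜ (s̃ k))
    S≈ : ∀ k → S k ≈ₘ dyad (s̃ k)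
    S≈ k i j = trans (reflexive (≡.cong (λ M → M i j) (each-value (λ k → dyadᶜ (s̃ k)) k))) (dyadᶜ-value (s̃ k) i j)
    τ̃ : Vector ℝ r
    τ̃ = value (linearSolve (λ k → flatten (S k)) (flatten A))
    A≈τp : A ≈ₘ ∑τssᵗ (τ ∘ p , s̃)
    A≈τp i j = begin
      A i j                                                           ≈⟨ represents i j ⟩
      sum (λ k → τ k * (s k i * s k j))                               ≈⟨ sum-permute {r} {r} _ π ⟩
      sum (λ k → τ (π ⟨$⟩ʳ k) * (s (π ⟨$⟩ʳ k) i * s (π ⟨$⟩ʳ k) j))
        ≈⟨ sum-cong {r} (λ k → reflexive (≡.cong (λ l → τ l * (s l i * s l j)) (π≡p k))) ⟩
      sum (λ k → τ (p k) * (s (p k) i * s (p k) j))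
        ≈⟨ sum-cong {r} (λ k → *-congˡ (matches k i j)) ⟨
      sum (λ k → τ (p k) * (s̃ k i * s̃ k j))                           ∎
    flat-independent : LinearlyIndependent (λ k → flatten (S k))
    flat-independent c cS≈0 k = begin
      c k
        ≈⟨ trans (*-congˡ (trans (*-cong (δ-same (p k)) (δ-same (p k))) (*-identityˡ 1#))) (*-identityʳ (c k)) ⟨
      c k * (δ (p k) (p k) * δ (p k) (p k))
        ≈⟨ sum-single k (λ l l≢k → trans (*-congˡ (trans (*-congʳ (δ-diff (λ e → l≢k (p-injective (≡.sym e))))) (zeroˡ _))) (zeroʳ (c l))) ⟨
      sum (λ l → c l * (δ (p k) (p l) * δ (p k) (p l)))               ≈⟨ sum-cong {r} (λ l → *-congˡ (begin
        ⟨ s̃ l , u ⟩ * ⟨ s̃ l , u ⟩                                       ≈⟨ dyad-form (s̃ l) u u ⟨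
        ⟨ u , dyad (s̃ l) *ᵥ u ⟩                                         ≈⟨ form-cong (matches l) u u ⟩
        ⟨ u , dyad (s (p l)) *ᵥ u ⟩                                     ≈⟨ dyad-form (s (p l)) u u ⟩
        ⟨ s (p l) , u ⟩ * ⟨ s (p l) , u ⟩                               ≈⟨ *-cong (⟨s,u⟩ l) (⟨s,u⟩ l) ⟩
        δ (p k) (p l) * δ (p k) (p l)                                   ∎)) ⟨
      sum (λ l → c l * (⟨ s̃ l , u ⟩ * ⟨ s̃ l , u ⟩))                   ≈⟨ ∑-form c s̃ u u ⟨
      ⟨ u , ∑τssᵗ (c , s̃) *ᵥ u ⟩
        ≈⟨ sum-zero {n} {λ i → u i * (∑τssᵗ (c , s̃) *ᵥ u) i} (λ i → trans (*-congˡ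
            (sum-zero {n} {λ j → ∑τssᵗ (c , s̃) i j * u j} (λ j → trans (*-congʳ (cs̃≈0 i j)) (zeroˡ (u j))))) (zeroʳ (u i))) ⟩
      0#                                                              ∎
      where
      u = dual (p k)
      ⟨s,u⟩ : ∀ l → ⟨ s (p l) , u ⟩ ≈ δ (p k) (p l)
      ⟨s,u⟩ l = trans (⟨⟩-comm (s (p l)) u) (dual-inner (p k) (p l))
      -- The relation between flattened dyads, read at the position that encodes (i, j), is a
      -- relation between matrix entries.
      cs̃≈0 : ∀ i j → ∑τssᵗ (c , s̃) i j ≈ 0#
      cs̃≈0 i j = trans (sum-cong {r} (λ l → *-congˡ (trans (sym (S≈ l i j))
        (reflexive (≡.cong (λ (a , b) → S l a b) (≡.sym (remQuot-combine i j)))))))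
        (cS≈0 (Fin.combine i j))
    τ̃≈τp : τ̃ ≈ᵥ τ ∘ p
    τ̃≈τp = linearSolve-correct (λ k → flatten (S k)) (flatten A) (τ ∘ p) flat-independent (λ q →
      let (i , j) = remQuot n q in
      trans (A≈τp i j) (sum-cong {r} (λ k → *-congˡ (sym (S≈ k i j)))))
    τ̃-positive : ∀ k → 0# < τ̃ k
    τ̃-positive k = <-respʳ-≈ (sym (τ̃≈τp k)) (positive (p k))
    τ̃-total : sum τ̃ ≈ 1#
    τ̃-total = begin
      sum τ̃                           ≈⟨ sum-cong {r} τ̃≈τp ⟩
      sum (λ k → τ (p k))             ≈⟨ sum-cong {r} (λ k → reflexive (≡.cong τ (π≡p k))) ⟨
      sum (λ k → τ (π ⟨$⟩ʳ k))        ≈⟨ sum-permute τ π ⟨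
      sum τ                           ≈⟨ total≈1 ⟩
      1#                              ∎
    A≈ : A ≈ₘ ∑τssᵗ (τ̃ , s̃)
    A≈ i j = trans (A≈τp i j) (sum-cong {r} (λ k → *-congʳ (sym (τ̃≈τp k))))

  module _ (solver : SDPSolver) where

    open SDPSolver solver

    -- `Loop` continues with `affine ζ C X`, the program with the matrix it has computed, and the
    -- two agree only up to `≈ₘ`. As `solve₁` and `solve₂` need not respect this relation, all calls
    -- and the invariant refer to the program's matrix B, and only the conclusion to C.
    loop-correct : ∀ {n} r {B C : Matrix (suc n) (suc n)} {c} {t : Fin r → Vector ℝ (suc n)} → State B c t →
      ∀ g → (∀ i → Separates (g i) t) → B ≈ₘ C → Loop r C g (value (loop solver r B g))
    loop-correct zero state g sep B≈C = tt
    loop-correct (suc zero) {B} {C} {c} {t} state g sep B≈C i j = trans (sym (B≈C i j))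
      (factorise-correct B (t zero) (single-state state) (sign≉0 (State.signs state zero zero)) i j)
    loop-correct (suc (suc r)) {B} {C} {c} {t} state g sep B≈C =
        _ , V , X , ζ , basis-resp-≈ B≈C V-basis , X-solution ,
        factorise-correct X (t k) X≈tt (sign≉0 (State.signs state k zero)) ,
        solution₂-resp-≈ B≈C ζ-solution ,
        loop-correct (suc r) (SecondProgram.next-state state k X≈tt ζ-solution (affineᶜ-value ζ B X)) (tail g)
          (λ i → separates-removeAt {g = g (suc i)} {t} k (sep (suc i)))
          (λ i j → trans (affineᶜ-value ζ B X i j) (+-congʳ (*-congˡ (B≈C i j))))
      where
      k : Fin (suc (suc r))
      k = proj₁ (best t (head g))
      V = proj₂ (value (orthonormalBasis B))
      V-basis : IsOrthonormalBasisOfRange B V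
      V-basis = orthonormalBasis-correct B
      module S = Step zero state (head g) (sep zero) {V = V} V-basis
      X = value (solve₁ V (head g))
      X-solution : IsSolution₁ V (head g) X
      X-solution = correct₁ V (head g) (dyad (t k) , S.step-solution)
      X≈tt : X ≈ₘ dyad (t k)
      X≈tt = S.step-unique X X-solution
      ζ = value (solve₂ B X)
      ζ-solution : IsSolution₂ B X ζ
      ζ-solution = correct₂ B X (SecondProgram.ζ★ state k , SecondProgram.ζ★-solution state k X≈tt)

    run-correct : ∀ {n r} {A : Matrix (suc n) (suc n)} {τ} {s : Fin r → Vector ℝ (suc n)} → State A τ s →
      ∀ g → (∀ i → Separates (g i) s) → IsRun A g (value (signComponentDecomposition solver r A g))
    run-correct {r = r} {A} {τ} {s} state g sep = loop-holds ,
        weights-correct state (loop-components r zero state g sep _ loop-holds)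
      where
      loop-holds : Loop r A g (value (loop solver r A g))
      loop-holds = loop-correct r state g sep (λ _ _ → refl)

-- Polynomial bounds on the natural numbers.

module PolynomialBounds where

  open import Data.Nat.Base using (_+_; _*_; _^_; _≤_; z≤n; s≤s)
  open ℕ.≤-Reasoning

  -- A syntax for explicit cost bounds, so that a polynomial bound follows by recursion instead of
  -- by estimating one large formula.
  data Expression : Set where
    var     : Expression
    con     : ℕ → Expression
    _⊕_ _⊗_ : Expression → Expression → Expression
    _↑_     : Expression → ℕ → Expression

  infixl 6 _⊕_
  infixl 7 _⊗_
  infixr 8 _↑_

  ⟦_⟧ : Expression → ℕ → ℕ
  ⟦ var ⟧   n = n
  ⟦ con k ⟧ n = k
  ⟦ e ⊕ f ⟧ n = ⟦ e ⟧ n + ⟦ f ⟧ n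
  ⟦ e ⊗ f ⟧ n = ⟦ e ⟧ n * ⟦ f ⟧ n
  ⟦ e ↑ k ⟧ n = ⟦ e ⟧ n ^ k

  -- The base is at least one, so exponents may be increased; this lets sums and products be bounded
  -- by a single monomial.
  Bounded : (ℕ → ℕ) → Set
  Bounded f = ∃₂ λ c d → ∀ n → f n ≤ c * suc n ^ d

  bounded-* : ∀ {f g} → Bounded f → Bounded g → Bounded (λ n → f n * g n)
  bounded-* {f} {g} (c , d , p) (c′ , d′ , q) = c * c′ , d + d′ , λ n → begin
    f n * g n                           ≤⟨ ℕ.*-mono-≤ (p n) (q n) ⟩
    c * suc n ^ d * (c′ * suc n ^ d′)   ≡⟨ ℕ.[m*n]*[o*p]≡[m*o]*[n*p] c (suc n ^ d) c′ (suc n ^ d′) ⟩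
    c * c′ * (suc n ^ d * suc n ^ d′)   ≡⟨ ≡.cong (c * c′ *_) (ℕ.^-distribˡ-+-* (suc n) d d′) ⟨
    c * c′ * suc n ^ (d + d′)           ∎

  bounded-+ : ∀ {f g} → Bounded f → Bounded g → Bounded (λ n → f n + g n)
  bounded-+ {f} {g} (c , d , p) (c′ , d′ , q) = c + c′ , d + d′ , λ n → begin
    f n + g n                                       ≤⟨ ℕ.+-mono-≤ (p n) (q n) ⟩
    c * suc n ^ d + c′ * suc n ^ d′                 ≤⟨ ℕ.+-mono-≤ (ℕ.*-monoʳ-≤ c (ℕ.^-monoʳ-≤ (suc n) (ℕ.m≤m+n d d′)))
          (ℕ.*-monoʳ-≤ c′ (ℕ.^-monoʳ-≤ (suc n) (ℕ.m≤n+m d′ d))) ⟩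
    c * suc n ^ (d + d′) + c′ * suc n ^ (d + d′)    ≡⟨ ℕ.*-distribʳ-+ (suc n ^ (d + d′)) c c′ ⟨
    (c + c′) * suc n ^ (d + d′)                     ∎

  bounded-con : ∀ k → Bounded (λ _ → k)
  bounded-con k = k , 0 , λ n → ℕ.≤-reflexive (≡.sym (ℕ.*-identityʳ k))

  expression-bounded : ∀ e → Bounded ⟦ e ⟧
  expression-bounded var         = 1 , 1 , λ n → ℕ.≤-trans (ℕ.n≤1+n n) (ℕ.≤-reflexive
    (≡.sym (≡.trans (ℕ.*-identityˡ _) (ℕ.*-identityʳ (suc n)))))
  expression-bounded (con k)     = bounded-con k
  expression-bounded (e ⊕ f)     = bounded-+ {⟦ e ⟧} {⟦ f ⟧} (expression-bounded e) (expression-bounded f)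
  expression-bounded (e ⊗ f)     = bounded-* {⟦ e ⟧} {⟦ f ⟧} (expression-bounded e) (expression-bounded f)
  expression-bounded (e ↑ zero)  = bounded-con 1
  expression-bounded (e ↑ suc k) =
    bounded-* {⟦ e ⟧} {λ n → ⟦ e ⟧ n ^ k} (expression-bounded e) (expression-bounded (e ↑ k))

  ^-distribʳ-* : ∀ m n k → (m * n) ^ k ≡ m ^ k * n ^ k
  ^-distribʳ-* m n zero    = ≡.refl
  ^-distribʳ-* m n (suc k) = ≡.trans (≡.cong (m * n *_) (^-distribʳ-* m n k))
    (ℕ.[m*n]*[o*p]≡[m*o]*[n*p] m n (m ^ k) (n ^ k))

  -- n + 1 ≤ 2n for positive n, which costs the factor 2^d; the additive constant takes care of n =
  -- 0.
  bounded⇒polynomial : ∀ {f} → Bounded f → ∃₂ λ c d → ∀ n → f n ≤ c * n ^ d + c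
  bounded⇒polynomial {f} (c , d , p) = c * 2 ^ d , d , λ n → ℕ.≤-trans (p n) (double n)
    where
    double : ∀ n → c * suc n ^ d ≤ c * 2 ^ d * n ^ d + c * 2 ^ d
    double zero = ℕ.≤-trans (ℕ.*-monoʳ-≤ c (ℕ.^-monoˡ-≤ d (s≤s z≤n))) (ℕ.m≤n+m (c * 2 ^ d) _)
    double (suc n) = begin
      c * suc (suc n) ^ d
        ≤⟨ ℕ.*-monoʳ-≤ c (ℕ.^-monoˡ-≤ d (s≤s (ℕ.≤-trans (s≤s (ℕ.m≤m+n n 0)) (ℕ.m≤n+m _ n)))) ⟩
      c * (2 * suc n) ^ d                                ≡⟨ ≡.cong (c *_) (^-distribʳ-* 2 (suc n) d) ⟩
      c * (2 ^ d * suc n ^ d)                            ≡⟨ ℕ.*-assoc c (2 ^ d) (suc n ^ d) ⟨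
      c * 2 ^ d * suc n ^ d                              ≤⟨ ℕ.m≤m+n _ _ ⟩
      c * 2 ^ d * suc n ^ d + c * 2 ^ d                  ∎

-- Running time.

module CostBounds (ℛ : RealNumbers) where

  open SignComponents ℛ using
    (ℝ; _≟_; 0#; Matrix; Counted; value; cost; each; mul; sub; add; isZero; sqrt; inv; return; _>>=_; total-of; inner; scale; subtract; combine;
     gramSchmidt; firstNonzero; factorise; affineᶜ; linearSolve; flatten; dyadᶜ; SDPSolver; iteration; loop;
     signComponentDecomposition; diag)
  open Programs ℛ using (extend; reduce)
  open import Data.Nat.Base using (_+_; _*_; _^_; _≤_; z≤n; s≤s)
  open PolynomialBounds

  -- A program that ends with `return` has a trailing 0 in its cost.
  m+0≤ : ∀ {m n} → m ≤ n → m + 0 ≤ n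
  m+0≤ {m} m≤n = ℕ.≤-trans (ℕ.≤-reflexive (ℕ.+-identityʳ m)) m≤n

  each-cost : ∀ {A : Set} {n} (p : Fin n → Counted A) b → (∀ i → cost (p i) ≤ b) → cost (each p) ≤ n * b
  each-cost {n = zero}  p b h = z≤n
  each-cost {n = suc n} p b h = ℕ.+-mono-≤ (h zero) (m+0≤ (each-cost (p ∘ suc) b (h ∘ suc)))

  total-of-cost : ∀ {n} (x : Vector ℝ n) → cost (total-of x) ≤ n
  total-of-cost {zero}  x = z≤n
  total-of-cost {suc n} x = ℕ.≤-trans (ℕ.+-monoˡ-≤ 1 (total-of-cost (tail x))) (ℕ.≤-reflexive (ℕ.+-comm n 1))

  inner-cost : ∀ {n} (x y : Vector ℝ n) → cost (inner x y) ≤ n * 1 + n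
  inner-cost x y = ℕ.+-mono-≤ (each-cost (λ i → mul (x i) (y i)) 1 (λ _ → ℕ.≤-refl)) (total-of-cost (value (each λ i → mul (x i) (y i))))

  scale-cost : ∀ {n} c (x : Vector ℝ n) → cost (scale c x) ≤ n * 1
  scale-cost c x = each-cost (λ i → mul c (x i)) 1 (λ _ → ℕ.≤-refl)

  subtract-cost : ∀ {n} (x y : Vector ℝ n) → cost (subtract x y) ≤ n * 1
  subtract-cost x y = each-cost (λ i → sub (x i) (y i)) 1 (λ _ → ℕ.≤-refl)

  combine-cost : ∀ {n k K} (c : Vector ℝ k) (v : Fin k → Vector ℝ n) → k ≤ K → cost (combine c v) ≤ n * (K * 1 + K)
  combine-cost c v k≤K = each-cost (λ i → inner c (λ j → v j i)) _ (λ i →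
    ℕ.≤-trans (inner-cost c (λ j → v j i)) (ℕ.+-mono-≤ (ℕ.*-monoˡ-≤ 1 k≤K) k≤K))

  dyadᶜ-cost : ∀ {n} (s : Vector ℝ n) → cost (dyadᶜ s) ≤ n * (n * 1)
  dyadᶜ-cost {n} s = each-cost (λ i → each λ j → mul (s i) (s j)) (n * 1) (λ i →
    each-cost (λ j → mul (s i) (s j)) 1 (λ _ → ℕ.≤-refl))

  affineᶜ-cost : ∀ {n} ζ (X Y : Matrix n n) → cost (affineᶜ ζ X Y) ≤ 1 + n * (n * 3)
  affineᶜ-cost {n} ζ X Y = ℕ.+-monoʳ-≤ 1 (each-cost (λ i → each (entry i)) (n * 3) (λ i →
    each-cost (entry i) 3 (λ _ → ℕ.≤-refl)))
    where
    entry : Fin n → Fin n → Counted ℝ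
    entry i j = mul ζ (X i j) >>= λ x → mul (value (sub (SignComponents.1# ℛ) ζ)) (Y i j) >>= λ y → add x y

  extend-cost : ∀ {n k} (u : Fin k → Vector ℝ n) w q z → cost (extend u w q z) ≤ 1 + (1 + n * 1)
  extend-cost u w q true  = z≤n
  extend-cost u w q false = ℕ.+-monoʳ-≤ 1 (ℕ.+-monoʳ-≤ 1 (m+0≤ (scale-cost _ w)))

  extend-size : ∀ {n k m} (u : Fin k → Vector ℝ n) w q z → k ≤ m → proj₁ (value (extend u w q z)) ≤ suc m
  extend-size u w q true  k≤m = ℕ.m≤n⇒m≤1+n k≤m
  extend-size u w q false k≤m = s≤s k≤m

  gramSchmidt-size : ∀ {n m} (v : Fin m → Vector ℝ n) → proj₁ (value (gramSchmidt v)) ≤ m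
  gramSchmidt-size {m = zero}  v = z≤n
  gramSchmidt-size {m = suc m} v = extend-size u w (value (inner w w)) (value (isZero (value (inner w w))))
      (gramSchmidt-size (tail v))
    where
    u = proj₂ (value (gramSchmidt (tail v)))
    c = value (each λ j → inner (u j) (head v))
    w = value (subtract (head v) (value (combine c u)))

  gramSchmidt-step : ℕ → ℕ → ℕ
  gramSchmidt-step n M = M * (n * 1 + n) + (n * (M * 1 + M) + (n * 1 + ((n * 1 + n) + (1 + (1 + (1 + n * 1))))))

  -- m counts the vectors still to be treated, whereas M bounds the length of the basis throughout.
  -- With M fixed all steps share one bound, and the total is linear in m.
  gramSchmidt-cost : ∀ {n m M} (v : Fin m → Vector ℝ n) → m ≤ M → cost (gramSchmidt v) ≤ m * gramSchmidt-step n M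
  gramSchmidt-cost {m = zero}  v m≤M = z≤n
  gramSchmidt-cost {n} {suc m} {M} v m<M = ℕ.≤-trans
    (ℕ.+-mono-≤ (gramSchmidt-cost (tail v) (ℕ.<⇒≤ m<M))
      (ℕ.+-mono-≤ (ℕ.≤-trans (each-cost (λ j → inner (u j) (head v)) _ (λ j → inner-cost (u j) (head v))) (ℕ.*-monoˡ-≤ _ k≤M))
        (ℕ.+-mono-≤ (combine-cost c u k≤M)
          (ℕ.+-mono-≤ (subtract-cost (head v) p)
            (ℕ.+-mono-≤ (inner-cost w w)
              (ℕ.+-monoʳ-≤ 1 (extend-cost u w (value (inner w w)) (value (isZero (value (inner w w)))))))))))
    (ℕ.≤-reflexive (ℕ.+-comm (m * gramSchmidt-step n M) _))
    where
    u = proj₂ (value (gramSchmidt (tail v)))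
    k≤M : proj₁ (value (gramSchmidt (tail v))) ≤ M
    k≤M = ℕ.≤-trans (gramSchmidt-size (tail v)) (ℕ.<⇒≤ m<M)
    c = value (each λ j → inner (u j) (head v))
    p = value (combine c u)
    w = value (subtract (head v) p)

  firstNonzero-cost : ∀ {n} (x : Vector ℝ n) → cost (firstNonzero x) ≤ n
  firstNonzero-cost {zero}  x = z≤n
  firstNonzero-cost {suc n} x = branch (does (head x ≟ 0#))
    where
    branch : ∀ z → 1 + cost (if z then (firstNonzero (tail x) >>= λ i → return (maybe′ (λ j → just (suc j)) nothing i))
                             else return (just zero)) ≤ suc n
    branch true  = ℕ.+-monoʳ-≤ 1 (m+0≤ (firstNonzero-cost (tail x)))
    branch false = s≤s z≤n

  factorise-cost : ∀ {n} (X : Matrix n n) → cost (factorise X) ≤ n + (1 + (1 + n * 1))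
  factorise-cost {n} X = ℕ.+-mono-≤ (firstNonzero-cost (diag X)) (branch (value (firstNonzero (diag X))))
    where
    branch : ∀ j → cost (maybe′ (λ j → sqrt (X j j) >>= λ l → inv l >>= λ l⁻¹ → scale l⁻¹ (λ i → X i j))
                          (return λ _ → 0#) j) ≤ 1 + (1 + n * 1)
    branch (just j) = ℕ.+-monoʳ-≤ 1 (ℕ.+-monoʳ-≤ 1 (scale-cost _ (λ i → X i j)))
    branch nothing  = z≤n

  reduce-bound : ℕ → ℕ
  reduce-bound N = (N * 1 + N) + (1 + (N * 1 + N * 1))

  reduce-cost : ∀ {N} (v₀ : Vector ℝ N) q⁻¹ x → cost (reduce v₀ q⁻¹ x) ≤ reduce-bound N
  reduce-cost v₀ q⁻¹ x = ℕ.+-mono-≤ (inner-cost x v₀) (ℕ.+-monoʳ-≤ 1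
    (ℕ.+-mono-≤ (scale-cost _ v₀) (subtract-cost x _)))

  linearSolve-step : ℕ → ℕ → ℕ
  linearSolve-step N M = (N * 1 + N) + (1 + (M * reduce-bound N + (reduce-bound N +
    (N * (M * 1 + M) + (N * 1 + ((N * 1 + N) + 1))))))

  linearSolve-cost : ∀ {N m M} (v : Fin m → Vector ℝ N) a → m ≤ M → cost (linearSolve v a) ≤ m * linearSolve-step N M
  linearSolve-cost {m = zero} v a m≤M = z≤n
  linearSolve-cost {N} {suc m} {M} v a m<M = ℕ.≤-trans
    (ℕ.+-mono-≤ (inner-cost v₀ v₀)
      (ℕ.+-monoʳ-≤ 1
        (ℕ.+-mono-≤ (ℕ.≤-trans (each-cost (λ j → reduce v₀ q⁻¹ (tail v j)) (reduce-bound N) (λ j → reduce-cost v₀ q⁻¹ (tail v j)))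
                      (ℕ.*-monoˡ-≤ (reduce-bound N) m≤M))
          (ℕ.+-mono-≤ (reduce-cost v₀ q⁻¹ a)
            (ℕ.+-mono-≤ (linearSolve-cost w a′ m≤M)
              (ℕ.+-mono-≤ (combine-cost τ (tail v) m≤M)
                (ℕ.+-mono-≤ (subtract-cost a p)
                  (ℕ.+-monoˡ-≤ 1 (inner-cost b v₀)))))))))
    (ℕ.≤-reflexive (rearrange (N * 1 + N) 1 (M * reduce-bound N) (reduce-bound N) (m * linearSolve-step N M) _))
    where
    v₀ = head v
    q⁻¹ = value (inv (value (inner v₀ v₀)))
    w = value (each λ j → reduce v₀ q⁻¹ (tail v j))
    a′ = value (reduce v₀ q⁻¹ a)
    τ = value (linearSolve w a′)
    p = value (combine τ (tail v))
    b = value (subtract a p)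
    m≤M : m ≤ M
    m≤M = ℕ.<⇒≤ m<M
    rearrange : ∀ a b c d r e → a + (b + (c + (d + (r + e)))) ≡ (a + (b + (c + (d + e)))) + r
    rearrange = solve-∀

  module _ (solver : SDPSolver) where

    open SDPSolver solver

    private
      c₁ = proj₁ time₁
      d₁ = proj₁ (proj₂ time₁)
      c₂ = proj₁ time₂
      d₂ = proj₁ (proj₂ time₂)

    -- The summands follow the order of the program. The power of n + n arises because the basis has
    -- at most n columns, so the size n + k of the first program is at most 2n.
    iteration-bound : ℕ → ℕ
    iteration-bound n = n * gramSchmidt-step n n + (n + ((c₁ * (n + n) ^ d₁ + c₁) +
      ((n + (1 + (1 + n * 1))) + ((c₂ * n ^ d₂ + c₂) + (1 + n * (n * 3))))))

    iteration-cost : ∀ {n} (B : Matrix n n) g → cost (iteration solver B g) ≤ iteration-bound n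
    iteration-cost {n} B g = ℕ.+-mono-≤ (m+0≤ (gramSchmidt-cost (λ j i → B i j) ℕ.≤-refl))
      (ℕ.+-monoʳ-≤ n (ℕ.+-mono-≤ (ℕ.≤-trans (proj₂ (proj₂ time₁) (_ , _ , V , g))
          (ℕ.+-monoˡ-≤ c₁ (ℕ.*-monoʳ-≤ c₁ (ℕ.^-monoˡ-≤ d₁ (ℕ.+-monoʳ-≤ n (gramSchmidt-size (λ j i → B i j)))))))
        (ℕ.+-mono-≤ (factorise-cost X)
          (ℕ.+-mono-≤ (proj₂ (proj₂ time₂) (_ , B , X))
            (m+0≤ (affineᶜ-cost (value (solve₂ B X)) B X))))))
      where
      V : Matrix n (proj₁ (value (gramSchmidt (λ j i → B i j))))
      V i j = proj₂ (value (gramSchmidt (λ j i → B i j))) j i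
      X = value (solve₁ V g)

    loop-bound : ℕ → ℕ
    loop-bound n = iteration-bound n + (n + (1 + (1 + n * 1)))

    loop-cost : ∀ {n} r (B : Matrix n n) g → cost (loop solver r B g) ≤ r * loop-bound n
    loop-cost zero B g = z≤n
    loop-cost {n} (suc zero) B g = m+0≤ (ℕ.≤-trans (factorise-cost B)
      (ℕ.≤-trans (ℕ.m≤n+m _ (iteration-bound n)) (ℕ.m≤m+n (loop-bound n) 0)))
    loop-cost {n} (suc (suc r)) B g = ℕ.+-mono-≤
      (ℕ.≤-trans (iteration-cost B (head g)) (ℕ.m≤m+n (iteration-bound n) _))
      (m+0≤ (loop-cost (suc r) (proj₂ (value (iteration solver B (head g)))) (tail g)))

    -- Mirrors the bounds above symbol by symbol, so that ⟦ `bound` ⟧ n unfolds to them; r is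
    -- replaced by n, and the linear system has vectors of length n², the flattened matrices.
    bound : Expression
    bound = var ⊗ (iterating ⊕ factor) ⊕ (var ⊗ (var ⊗ (var ⊗ con 1)) ⊕ var ⊗ solving)
      where
      twice : Expression → Expression
      twice e = e ⊗ con 1 ⊕ e
      factor = var ⊕ (con 1 ⊕ (con 1 ⊕ var ⊗ con 1))
      gram = var ⊗ twice var ⊕ (var ⊗ twice var ⊕ (var ⊗ con 1 ⊕ (twice var ⊕ (con 1 ⊕ (con 1 ⊕ (con 1 ⊕ var ⊗ con 1))))))
      iterating = var ⊗ gram ⊕ (var ⊕ ((con c₁ ⊗ (var ⊕ var) ↑ d₁ ⊕ con c₁) ⊕
        (factor ⊕ ((con c₂ ⊗ var ↑ d₂ ⊕ con c₂) ⊕ (con 1 ⊕ var ⊗ (var ⊗ con 3))))))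
      size = var ⊗ var
      reducing = twice size ⊕ (con 1 ⊕ (size ⊗ con 1 ⊕ size ⊗ con 1))
      solving = twice size ⊕ (con 1 ⊕ (var ⊗ reducing ⊕ (reducing ⊕
        (size ⊗ twice var ⊕ (size ⊗ con 1 ⊕ (twice size ⊕ con 1))))))

    run-cost : ∀ {n r} (A : Matrix n n) g → r ≤ n → cost (signComponentDecomposition solver r A g) ≤ ⟦ bound ⟧ n
    run-cost {n} {r} A g r≤n = ℕ.+-mono-≤ (ℕ.≤-trans (loop-cost r A g) (ℕ.*-monoˡ-≤ (loop-bound n) r≤n))
      (ℕ.+-mono-≤ (ℕ.≤-trans (each-cost (λ k → dyadᶜ (s k)) (n * (n * 1)) (λ k → dyadᶜ-cost (s k))) (ℕ.*-monoˡ-≤ (n * (n * 1)) r≤n))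
        (m+0≤ (ℕ.≤-trans (linearSolve-cost (λ k → flatten (value (each λ k → dyadᶜ (s k)) k)) (flatten A) r≤n)
          (ℕ.*-monoˡ-≤ (linearSolve-step (n * n) n) r≤n))))
      where
      s = value (loop solver r A g)

    run-polynomial : ∃₂ λ c d → ∀ {n r} (A : Matrix n n) g → r ≤ n →
                     cost (signComponentDecomposition solver r A g) ≤ c * n ^ d + c
    run-polynomial = let (c , d , p) = bounded⇒polynomial {⟦ bound ⟧} (expression-bounded bound) in
      c , d , λ {n} A g r≤n → ℕ.≤-trans (run-cost A g r≤n) (p n)

-- Closure properties shared by events and Borel sets.

module SigmaAlgebra (em : ExcludedMiddle 0ℓ) {X : Set} (Measurable : Pred X 0ℓ → Set₁)
  (resp-≐ : ∀ {E F} → E ≐ F → Measurable E → Measurable F)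
  (complement : ∀ {E} → Measurable E → Measurable (∁ E))
  (countable-union : ∀ {E : ℕ → Pred X 0ℓ} → (∀ k → Measurable (E k)) → Measurable (⋃ ℕ E)) where

  ¬¬-elim : ∀ {P : Set} → ¬ ¬ P → P
  ¬¬-elim {P} ¬¬p with em {P = P}
  ... | yes p = p
  ... | no ¬p = ⊥-elim (¬¬p ¬p)

  two : Pred X 0ℓ → Pred X 0ℓ → ℕ → Pred X 0ℓ
  two A B zero    = A
  two A B (suc _) = B

  union : ∀ {A B} → Measurable A → Measurable B → Measurable (A ∪ B)
  union {A} {B} a b = resp-≐
    ((λ { (zero , p) → inj₁ p ; (suc _ , p) → inj₂ p }) , (λ { (inj₁ p) → 0 , p ; (inj₂ p) → 1 , p }))
    (countable-union {two A B} (λ { zero → a ; (suc _) → b }))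

  -- De Morgan; excluded middle brings the double complement back to E k.
  countable-intersection : ∀ {E : ℕ → Pred X 0ℓ} → (∀ k → Measurable (E k)) → Measurable (λ x → ∀ k → E k x)
  countable-intersection e = resp-≐
    ((λ p k → ¬¬-elim (λ ¬q → p (k , ¬q))) , (λ p (k , ¬q) → ¬q (p k)))
    (complement (countable-union (λ k → complement (e k))))

  intersection : ∀ {A B} → Measurable A → Measurable B → Measurable (A ∩ B)
  intersection {A} {B} a b = resp-≐ ((λ p → p 0 , p 1) , λ { (p , q) zero → p ; (p , q) (suc _) → q })
    (countable-intersection {two A B} (λ { zero → a ; (suc _) → b }))

  finite-intersection : ∀ {n} {E : Fin n → Pred X 0ℓ} → Measurable U → (∀ i → Measurable (E i)) →
                        Measurable (λ x → ∀ i → E i x)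
  finite-intersection {zero}  u e = resp-≐ ((λ _ ()) , (λ _ → _)) u
  finite-intersection {suc n} {E} u e = resp-≐
    ((λ { (p , q) zero → p ; (p , q) (suc i) → q i }) , (λ p → p zero , p ∘ suc))
    (intersection (e zero) (finite-intersection {E = E ∘ suc} u (e ∘ suc)))

-- Limits and finite products.

module Limits (ℛ : RealNumbers) where

  open SignComponents ℛ
  open OrderedField ℛ
  open Summation ℛ

  -- If y < x, the hypothesis at half the gap, ε = (x - y) / 2, would give ε ≤ 0.
  ≤-by-approximation : ∀ {x y} → (∀ ε → 0# < ε → x ≤ y + ε) → x ≤ y
  ≤-by-approximation {x} {y} p with x ≤? y
  ... | yes x≤y = x≤y
  ... | no  x≰y = ⊥-elim (<⇒≱ 0<ε (0≤y-x⇒≤ (≤-respʳ-≈ (begin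
      y + ε - x          ≈⟨ solve 3 (λ x y e → y :+ e :- x := e :- (x :- y)) refl x y ε ⟩
      ε - (x - y)        ≈⟨ +-congˡ (-‿cong ε+ε) ⟨
      ε - (ε + ε)        ≈⟨ solve 1 (λ e → e :- (e :+ e) := con (+ 0) :- e) refl ε ⟩
      0# - ε             ∎) (≤⇒0≤y-x (p ε 0<ε)))))
    where
    open ≈-Reasoning
    0<2 : 0# < 1# + 1#
    0<2 = +-positive 0<1 0≤1
    ε = (x - y) * (1# + 1#) ⁻¹
    0<ε : 0# < ε
    0<ε = *-positive (<⇒0<y-x (≰⇒> x≰y)) (⁻¹-positive 0<2)
    ε+ε : ε + ε ≈ x - y
    ε+ε = trans (solve 2 (λ d i → d :* i :+ d :* i := d :* ((con (+ 1) :+ con (+ 1)) :* i)) refl (x - y) ((1# + 1#) ⁻¹))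
      (trans (*-congˡ (*-inverseʳ (>⇒≉ 0<2))) (*-identityʳ _))

  limit-≤ : ∀ {u l b} → ConvergesTo u l → ∀ N → (∀ k → N ℕ.≤ k → u k ≤ b) → l ≤ b
  limit-≤ u→l N u≤b = ≤-by-approximation (λ ε 0<ε →
    let (N′ , p) = u→l ε 0<ε in
    ≤-trans (proj₂ (p (N ℕ.+ N′) (ℕ.m≤n+m N′ N))) (+-monoˡ-≤ ε (u≤b (N ℕ.+ N′) (ℕ.m≤m+n N N′))))

  limit-≥ : ∀ {u l b} → ConvergesTo u l → ∀ N → (∀ k → N ℕ.≤ k → b ≤ u k) → b ≤ l
  limit-≥ u→l N b≤u = ≤-by-approximation (λ ε 0<ε →
    let (N′ , p) = u→l ε 0<ε in
    ≤-trans (b≤u (N ℕ.+ N′) (ℕ.m≤m+n N N′)) (proj₁ (p (N ℕ.+ N′) (ℕ.m≤n+m N′ N))))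

  limit-constant : ∀ {u l b} → ConvergesTo u l → ∀ N → (∀ k → N ℕ.≤ k → u k ≈ b) → l ≈ b
  limit-constant u→l N u≈b = antisym (limit-≤ u→l N (λ k N≤k → ≤-reflexive (u≈b k N≤k)))
    (limit-≥ u→l N (λ k N≤k → ≤-reflexive (sym (u≈b k N≤k))))

  sum-constant : ∀ n x → sum {n} (λ _ → x) ≈ n · 1# * x
  sum-constant zero    x = sym (zeroˡ x)
  sum-constant (suc n) x = trans (+-congˡ (sum-constant n x))
    (solve 2 (λ n x → x :+ n :* x := (con (+ 1) :+ n) :* x) refl (n · 1#) x)

  ·1-mono-≤ : ∀ {m n} → m ℕ.≤ n → m · 1# ≤ n · 1#
  ·1-mono-≤ {n = n} ℕ.z≤n = ·1-nonNegative n
  ·1-mono-≤ (ℕ.s≤s p)     = +-monoʳ-≤ 1# (·1-mono-≤ p)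

  open MonoidSum *-commutativeMonoid
    using () renaming (sum-cong-≋ to product-cong; sum-remove to product-remove; ∑-distrib-+ to product-distrib) public

  product-one : ∀ {n} {f : Vector ℝ n} → (∀ i → f i ≈ 1#) → product f ≈ 1#
  product-one {zero}  p = refl
  product-one {suc n} p = trans (*-cong (p zero) (product-one (p ∘ suc))) (*-identityˡ 1#)

  product-single : ∀ {n} {f : Vector ℝ n} k → (∀ i → i ≢ k → f i ≈ 1#) → product f ≈ f k
  product-single {suc n} {f} k p = trans (product-remove {i = k} f)
    (trans (*-congˡ (product-one (λ i → p (punchIn k i) (punchInᵢ≢i k i)))) (*-identityʳ _))

  product-nonNegative : ∀ {n} {f : Vector ℝ n} → (∀ i → 0# ≤ f i) → 0# ≤ product f
  product-nonNegative {zero}  p = 0≤1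
  product-nonNegative {suc n} p = *-nonNegative (p zero) (product-nonNegative (p ∘ suc))

  product-mono-≤ : ∀ {n} {f g : Vector ℝ n} → (∀ i → 0# ≤ f i) → (∀ i → f i ≤ g i) → product f ≤ product g
  product-mono-≤ {zero}  0≤f f≤g = ≤-refl
  product-mono-≤ {suc n} 0≤f f≤g = *-mono-≤ (≤-trans (0≤f zero) (f≤g zero))
    (product-nonNegative (0≤f ∘ suc)) (f≤g zero) (product-mono-≤ (0≤f ∘ suc) (f≤g ∘ suc))

-- Finite additivity, coverings and null sets.

module NullSets (em : ExcludedMiddle 0ℓ) (ℛ : RealNumbers)
  (𝒫 : SignComponents.ProbabilitySpace ℛ) where

  open SignComponents ℛ
  open OrderedField ℛ
  open Summation ℛ
  open Limits ℛ
  open ProbabilitySpace 𝒫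
  open SigmaAlgebra em Event Event-≐ Event-∁ Event-⋃ public

  Empty : Pred Ω 0ℓ
  Empty = ∁ U

  Event-Empty : Event Empty
  Event-Empty = Event-∁ Event-U

  sum-zero-tail : ∀ (f : ℕ → ℝ) N → (∀ k → N ℕ.≤ k → f k ≈ 0#) → ∀ k → N ℕ.≤ k →
                  sum {k} (λ i → f (toℕ i)) ≈ sum {N} (λ i → f (toℕ i))
  sum-zero-tail f zero    p k       _           = sum-zero {k} (λ i → p (toℕ i) ℕ.z≤n)
  sum-zero-tail f (suc N) p (suc k) (ℕ.s≤s N≤k) = +-congˡ (sum-zero-tail (f ∘ suc) N (λ k N≤k → p (suc k) (ℕ.s≤s N≤k)) k N≤k)

  -- The partial sums of a constant series are unbounded unless its terms vanish.
  ℙ-Empty : ℙ Empty ≈ 0#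
  ℙ-Empty = antisym (≤-by-approximation p≤ε) 0≤p
    where
    p = ℙ Empty
    0≤p : 0# ≤ p
    0≤p = ℙ-nonNeg Event-Empty
    converges : ConvergesTo (λ N → sum {N} (λ _ → p)) (ℙ (⋃ ℕ (λ _ → Empty)))
    converges = ℙ-⋃ (λ _ → Event-Empty) (λ _ _ _ ω ω∈∅ _ → ω∈∅ _)
    ⋃≈p : ℙ (⋃ ℕ (λ _ → Empty)) ≈ p
    ⋃≈p = ℙ-≐ (Event-⋃ (λ _ → Event-Empty)) (proj₂ , λ e → 0 , e)
    -- The union of copies of the empty event is empty again, so the series of copies of p converges
    -- to p itself. Two of its terms are at most a partial sum, hence p + p ≤ p + ε.
    p≤ε : ∀ ε → 0# < ε → p ≤ 0# + ε
    p≤ε ε 0<ε = let (N , q) = converges ε 0<ε in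
      0≤y-x⇒≤ (≤-respʳ-≈ (solve 2 (λ p ε → p :+ ε :- (p :+ p) := con (+ 0) :+ ε :- p) refl p ε)
        (≤⇒0≤y-x (≤-trans (+-monoʳ-≤ p (term≤sum {suc N} {λ _ → p} (λ _ → 0≤p) zero))
          (≤-trans (proj₁ (q (suc (suc N)) (ℕ.m≤n+m N 2))) (+-monoˡ-≤ ε (≤-reflexive ⋃≈p))))))

  ℙ-disjoint : ∀ {E F} → Event E → Event F → (∀ ω → E ω → ¬ F ω) → ℙ (E ∪ F) ≈ ℙ E + ℙ F
  ℙ-disjoint {E} {F} e f E∩F≡∅ = trans
    (ℙ-≐ (union e f) ((λ { (inj₁ p) → 0 , p ; (inj₂ p) → 1 , p }) , from))
    (limit-constant (ℙ-⋃ G-event G-disjoint) 2 (λ k 2≤k →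
      trans (sum-zero-tail (λ k → ℙ (G k)) 2 (λ { (suc (suc k)) _ → ℙ-Empty ; (suc zero) (ℕ.s≤s ()) }) k 2≤k) (+-congˡ (+-identityʳ (ℙ F)))))
    where
    G : ℕ → Pred Ω 0ℓ
    G 0             = E
    G 1             = F
    G (suc (suc _)) = Empty
    G-event : ∀ k → Event (G k)
    G-event 0             = e
    G-event 1             = f
    G-event (suc (suc _)) = Event-Empty
    from : ⋃ ℕ G ⊆ E ∪ F
    from (0 , p)           = inj₁ p
    from (1 , p)           = inj₂ p
    from (suc (suc _) , p) = ⊥-elim (p _)
    G-disjoint : ∀ i j → i ≢ j → ∀ ω → G i ω → ¬ G j ω
    G-disjoint 0 0 i≢j ω p q = i≢j ≡.refl
    G-disjoint 0 1 i≢j ω p q = E∩F≡∅ ω p q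
    G-disjoint 1 0 i≢j ω p q = E∩F≡∅ ω q p
    G-disjoint 1 1 i≢j ω p q = i≢j ≡.refl
    G-disjoint (suc (suc _)) j i≢j ω p q = p _
    G-disjoint 0 (suc (suc _)) i≢j ω p q = q _
    G-disjoint 1 (suc (suc _)) i≢j ω p q = q _

  ℙ-difference : ∀ {E F} → Event E → Event F → E ⊆ F → ℙ F ≈ ℙ E + ℙ (F ∩ ∁ E)
  ℙ-difference {E} {F} e f E⊆F = trans
    (ℙ-≐ f ((λ {ω} p → split ω p) , λ { (inj₁ p) → E⊆F p ; (inj₂ (p , _)) → p }))
    (ℙ-disjoint e (intersection f (Event-∁ e)) (λ ω p q → proj₂ q p))
    where
    split : ∀ ω → F ω → (E ∪ (F ∩ ∁ E)) ω
    split ω p with em {P = E ω}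
    ... | yes q = inj₁ q
    ... | no ¬q = inj₂ (p , ¬q)

  ℙ-mono : ∀ {E F} → Event E → Event F → E ⊆ F → ℙ E ≤ ℙ F
  ℙ-mono e f E⊆F = ≤-respʳ-≈ (sym (ℙ-difference e f E⊆F))
    (≤-respˡ-≈ (+-identityʳ _) (+-monoʳ-≤ _ (ℙ-nonNeg (intersection f (Event-∁ e)))))

  ℙ-union-≤ : ∀ {E F} → Event E → Event F → ℙ (E ∪ F) ≤ ℙ E + ℙ F
  ℙ-union-≤ {E} {F} e f = ≤-respˡ-≈ (sym (ℙ-difference e (union e f) inj₁))
    (+-monoʳ-≤ (ℙ E) (ℙ-mono (intersection (union e f) (Event-∁ e)) f
      (λ { (inj₁ p , ¬p) → ⊥-elim (¬p p) ; (inj₂ p , _) → p })))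

  -- A bound on the outer measure: S itself need not be an event.
  Cover : ℝ → Pred Ω 0ℓ → Set₁
  Cover δ S = ∃ λ E → Event E × ℙ E ≤ δ × S ⊆ E

  Null : Pred Ω 0ℓ → Set₁
  Null S = ∃ λ E → Event E × ℙ E ≈ 0# × S ⊆ E

  cover-mono : ∀ {δ ε S} → δ ≤ ε → Cover δ S → Cover ε S
  cover-mono δ≤ε (E , e , p , q) = E , e , ≤-trans p δ≤ε , q

  cover-union : ∀ {m δ} {S : Fin m → Pred Ω 0ℓ} → (∀ i → Cover δ (S i)) → Cover (m · 1# * δ) (λ ω → ∃ λ i → S i ω)
  cover-union {zero} {δ} c = Empty , Event-Empty , ≤-reflexive (trans ℙ-Empty (sym (zeroˡ δ))) , λ ()
  cover-union {suc m} {δ} c =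
    let (E , e , p , q) = c zero
        (F , f , p′ , q′) = cover-union (c ∘ suc)
    in E ∪ F , union e f ,
      ≤-trans (ℙ-union-≤ e f) (≤-trans (+-mono-≤ p p′) (≤-reflexive
        (solve 2 (λ m δ → δ :+ m :* δ := (con (+ 1) :+ m) :* δ) refl (m · 1#) δ))) ,
      λ { (zero , s) → inj₁ (q s) ; (suc i , s) → inj₂ (q′ (i , s)) }

  -- The intersection of all the covers is a single event containing S, with probability below each
  -- δ k.
  covers⇒null : ∀ {S} (δ : ℕ → ℝ) → (∀ k → Cover (δ k) S) → (∀ ε → 0# < ε → ∃ λ k → δ k ≤ ε) → Null S
  covers⇒null δ c small = E , e , antisym (≤-by-approximation ℙE≤ε) (ℙ-nonNeg e) ,
    λ s k → proj₂ (proj₂ (proj₂ (c k))) s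
    where
    E : Pred Ω 0ℓ
    E ω = ∀ k → proj₁ (c k) ω
    e : Event E
    e = countable-intersection (λ k → proj₁ (proj₂ (c k)))
    ℙE≤ε : ∀ ε → 0# < ε → ℙ E ≤ 0# + ε
    ℙE≤ε ε 0<ε = let (k , δₖ≤ε) = small ε 0<ε
                     (F , f , p , _) = c k in
      ≤-respʳ-≈ (sym (+-identityˡ ε)) (≤-trans (ℙ-mono e f (λ p → p k)) (≤-trans p δₖ≤ε))

  null-⊆ : ∀ {S T} → S ⊆ T → Null T → Null S
  null-⊆ S⊆T (E , e , p , q) = E , e , p , q ∘ S⊆T

  -- Countable additivity is about disjoint events, so F k is replaced by its part D k outside the
  -- earlier ones, still of probability 0. A point of the union lies in D k for the first k at which
  -- it lies in F k.
  null-countable-union : ∀ {S : ℕ → Pred Ω 0ℓ} → (∀ k → Null (S k)) → Null (⋃ ℕ S)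
  null-countable-union {S} n = ⋃ ℕ D , Event-⋃ D-event ,
      limit-constant (ℙ-⋃ D-event D-disjoint) 0 (λ k _ → sum-zero {k} (λ i → D-null (toℕ i))) ,
      λ (k , s) → earlier (suc k) (inj₂ (proj₂ (proj₂ (proj₂ (n k))) s))
    where
    F : ℕ → Pred Ω 0ℓ
    F k = proj₁ (n k)
    F-event : ∀ k → Event (F k)
    F-event k = proj₁ (proj₂ (n k))
    Before : ℕ → Pred Ω 0ℓ
    Before zero    = Empty
    Before (suc k) = Before k ∪ F k
    Before-event : ∀ k → Event (Before k)
    Before-event zero    = Event-Empty
    Before-event (suc k) = union (Before-event k) (F-event k)
    D : ℕ → Pred Ω 0ℓ
    D k = F k ∩ ∁ (Before k)
    D-event : ∀ k → Event (D k)
    D-event k = intersection (F-event k) (Event-∁ (Before-event k))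
    D-null : ∀ k → ℙ (D k) ≈ 0#
    D-null k = antisym (≤-trans (ℙ-mono (D-event k) (F-event k) proj₁) (≤-reflexive (proj₁ (proj₂ (proj₂ (n k))))))
      (ℙ-nonNeg (D-event k))
    earlier : ∀ k {ω} → Before k ω → ⋃ ℕ D ω
    earlier zero p = ⊥-elim (p _)
    earlier (suc k) (inj₁ p) = earlier k p
    earlier (suc k) {ω} (inj₂ p) with em {P = Before k ω}
    ... | yes q = earlier k q
    ... | no ¬q = k , p , ¬q
    before : ∀ {i j ω} → i ℕ.< j → F i ω → Before j ω
    before {i} {suc j} (ℕ.s≤s i≤j) p with ℕ.m≤n⇒m<n∨m≡n i≤j
    ... | inj₁ i<j    = inj₁ (before i<j p)
    ... | inj₂ ≡.refl = inj₂ p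
    D-disjoint : ∀ i j → i ≢ j → ∀ ω → D i ω → ¬ D j ω
    D-disjoint i j i≢j ω (p , ¬p) (q , ¬q) with ℕ.<-cmp i j
    ... | tri< i<j _ _ = ¬q (before i<j p)
    ... | tri≈ _ i≡j _ = i≢j i≡j
    ... | tri> _ _ j<i = ¬p (before j<i q)

  null-empty : ∀ {S : Pred Ω 0ℓ} → (∀ ω → ¬ S ω) → Null S
  null-empty ¬s = Empty , Event-Empty , ℙ-Empty , λ {ω} s → ⊥-elim (¬s ω s)

  null-union : ∀ {S T} → Null S → Null T → Null (S ∪ T)
  null-union {S} {T} s t = null-⊆ (λ { (inj₁ p) → 0 , p ; (inj₂ p) → 1 , p })
    (null-countable-union {two S T} (λ { zero → s ; (suc _) → t }))

  null-finite-union : ∀ {m} {S : Fin m → Pred Ω 0ℓ} → (∀ i → Null (S i)) → Null (λ ω → ∃ λ i → S i ω)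
  null-finite-union {zero}  n = null-empty (λ ω ())
  null-finite-union {suc m} n = null-⊆ (λ { (zero , p) → inj₁ p ; (suc i , p) → inj₂ (i , p) })
    (null-union (n zero) (null-finite-union (n ∘ suc)))

  null⇒almostSurely : ∀ {S Q : Pred Ω 0ℓ} → Null S → (∀ {ω} → ¬ S ω → Q ω) → AlmostSurely Q
  null⇒almostSurely (E , e , ℙE≈0 , S⊆E) q = ∁ E , Event-∁ e , ℙ∁E≈1 , λ ω∉E → q (ω∉E ∘ S⊆E)
    where
    open ≈-Reasoning
    ℙ∁E≈1 : ℙ (∁ E) ≈ 1#
    ℙ∁E≈1 = begin
      ℙ (∁ E)              ≈⟨ ℙ-≐ (Event-∁ e) ((λ p → _ , p) , proj₂) ⟩
      ℙ (U ∩ ∁ E)          ≈⟨ +-identityˡ _ ⟨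
      0# + ℙ (U ∩ ∁ E)     ≈⟨ +-congʳ ℙE≈0 ⟨
      ℙ E + ℙ (U ∩ ∁ E)    ≈⟨ ℙ-difference e Event-U _ ⟨
      ℙ U                  ≈⟨ ℙ-U ⟩
      1#                   ∎

-- Hyperplanes are null for Gaussian vectors.

module GaussianHyperplanes (em : ExcludedMiddle 0ℓ) (ℛ : RealNumbers)
  (𝒫 : SignComponents.ProbabilitySpace ℛ) where

  open SignComponents ℛ
  open OrderedField ℛ
  open Summation ℛ
  open LinearAlgebra ℛ
  open Limits ℛ
  open ProbabilitySpace 𝒫
  open NullSets em ℛ 𝒫
  open import Data.Nat.Base using (_!)

  module B = SigmaAlgebra em Borel resp-≐ ∁-borel ⋃-borel

  Interval : ℝ → ℝ → Pred ℝ 0ℓ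
  Interval a b y = a < y × y ≤ b

  interval-borel : ∀ a b → Borel (Interval a b)
  interval-borel a b = resp-≐ ((λ (p , q) → ≰⇒> p , q) , (λ (p , q) → <⇒≱ p , q))
    (B.intersection (∁-borel (half-line a)) (half-line b))

  U-borel : Borel U
  U-borel = resp-≐ ((λ _ → _) , (λ {y} _ → either y)) (B.union (half-line 0#) (∁-borel (half-line 0#)))
    where
    either : ∀ y → ((_≤ 0#) ∪ ∁ (_≤ 0#)) y
    either y with y ≤? 0#
    ... | yes p = inj₁ p
    ... | no ¬p = inj₂ ¬p

  ^-nonNegative : ∀ {x} n → 0# ≤ x → 0# ≤ x ^ n
  ^-nonNegative zero    0≤x = 0≤1
  ^-nonNegative (suc n) 0≤x = *-nonNegative 0≤x (^-nonNegative n 0≤x)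

  1≤n! : ∀ n → 1 ℕ.≤ n !
  1≤n! zero    = ℕ.s≤s ℕ.z≤n
  1≤n! (suc n) = ℕ.≤-trans (1≤n! n) (ℕ.m≤m+n (n !) (n ℕ.* n !))

  -- All terms of the series are nonnegative, and the one of index 0 equals 1.
  exp≥1 : ∀ {e x} → 0# ≤ x → e IsExpOf x → 1# ≤ e
  exp≥1 {e} {x} 0≤x converges = limit-≥ converges 1 (λ { (suc k) _ →
      ≤-respˡ-≈ term₀≈1 (term≤sum {suc k} {λ i → term (toℕ i)} (λ i → term-nonNegative (toℕ i)) zero) })
    where
    term : ℕ → ℝ
    term k = x ^ k * ((k !) · 1#) ⁻¹
    term₀≈1 : term 0 ≈ 1#
    term₀≈1 = begin
      1# * (1# + 0#) ⁻¹           ≈⟨ *-congʳ (+-identityʳ 1#) ⟨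
      (1# + 0#) * (1# + 0#) ⁻¹    ≈⟨ *-inverseʳ (>⇒≉ (·1-positive 0)) ⟩
      1#                          ∎
      where open ≈-Reasoning
    term-nonNegative : ∀ k → 0# ≤ term k
    term-nonNegative k = *-nonNegative (^-nonNegative k 0≤x)
      (proj₁ (⁻¹-positive (<-≤-trans (·1-positive 0) (·1-mono-≤ (1≤n! k)))))

  -- φ(x) exp (x²/2) = c and exp (x²/2) ≥ 1. `IsGaussian` does not fix the sign of c, hence L = max
  -- (c, 0) and the separate case φ(x) ≤ 0.
  gaussian-bounded : ∀ {φ} → IsGaussian φ → ∃ λ L → 0# ≤ L × (∀ x → φ x ≤ L)
  gaussian-bounded {φ} (c , gaussian) = L , 0≤L , φ≤L
    where
    bound : ∃ λ L → 0# ≤ L × c ≤ L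
    bound = [ (λ 0≤c → c , 0≤c , ≤-refl) , (λ c≤0 → 0# , ≤-refl , c≤0) ]′ (total 0# c)
    L = proj₁ bound
    0≤L = proj₁ (proj₂ bound)
    φ≤L : ∀ x → φ x ≤ L
    φ≤L x with total (φ x) 0# | gaussian x
    ... | inj₁ φ≤0 | _ = ≤-trans φ≤0 0≤L
    ... | inj₂ 0≤φ | (e , e-exp , φe≈c) = ≤-trans (≤-respˡ-≈ (*-identityʳ (φ x)) (*-monoˡ-≤ 0≤φ (exp≥1
      (*-nonNegative (square-nonNegative x) (proj₁ (⁻¹-positive (+-positive 0<1 0≤1)))) e-exp)))
      (≤-trans (≤-reflexive φe≈c) (proj₂ (proj₂ bound)))

  integral-≤ : ∀ {f a b l L} → a ≤ b → (∀ x → f x ≤ L) → IsIntegral f a b l → l ≤ L * (b - a)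
  -- Riemann sums are taken from one subinterval on: the mesh contains the inverse of N, which is
  -- unspecified at 0.
  integral-≤ {f} {a} {b} {l} {L} a≤b f≤L integral = limit-≤ integral 1 (λ { (suc k) _ → riemann k })
    where
    open ≤-Reasoning
    riemann : ∀ k → let h = (b - a) * (suc k · 1#) ⁻¹ in sum {suc k} (λ i → f (a + toℕ i · h) * h) ≤ L * (b - a)
    riemann k = begin
      sum {suc k} (λ i → f (a + toℕ i · h) * h)
        ≤⟨ sum-mono-≤ {suc k} {λ i → f (a + toℕ i · h) * h} (λ i → *-monoʳ-≤ 0≤h (f≤L _)) ⟩
      sum {suc k} (λ _ → L * h)                        ≈⟨ sum-constant (suc k) (L * h) ⟩
      N * (L * ((b - a) * N ⁻¹))
        ≈⟨ solve 4 (λ n l d i → n :* (l :* (d :* i)) := l :* d :* (n :* i)) refl N L (b - a) (N ⁻¹) ⟩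
      L * (b - a) * (N * N ⁻¹)
        ≈⟨ trans (*-congˡ (*-inverseʳ (>⇒≉ (·1-positive k)))) (*-identityʳ _) ⟩
      L * (b - a)                                      ∎
      where
      N = suc k · 1#
      h = (b - a) * N ⁻¹
      0≤h : 0# ≤ h
      0≤h = *-nonNegative (≤⇒0≤y-x a≤b) (proj₁ (⁻¹-positive (·1-positive k)))

  -- The form in which normality enters the covering argument: a linear bound on the probabilities
  -- of intervals, without reference to the density.
  HasBoundedDensity : ℝ → (Ω → ℝ) → Set
  HasBoundedDensity L x = ∀ a b → a ≤ b → ℙ (λ ω → Interval a b (x ω)) ≤ L * (b - a)

  normal-bounded : ∀ {x} → IsStandardNormal 𝒫 x → ∃ λ L → 0# ≤ L × HasBoundedDensity L x
  normal-bounded (_ , φ , gaussian , integral) =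
    let (L , 0≤L , φ≤L) = gaussian-bounded gaussian in
    L , 0≤L , λ a b a≤b → integral-≤ a≤b φ≤L (integral a b a≤b)

  Cell : ∀ {M} → ℝ → ℝ → Fin M → Pred ℝ 0ℓ
  Cell a h t = Interval (a + toℕ t · 1# * h) (a + toℕ t · 1# * h + h)

  -- Either y lies in the first cell, or the left end moves on by h and one cell fewer remains.
  grid : ∀ M {a h y} → Interval a (a + M · 1# * h) y → ∃ λ (t : Fin M) → Cell a h t y
  grid zero {a} {h} {y} (a<y , y≤a) = ⊥-elim (<⇒≱ a<y (≤-respʳ-≈ (trans (+-congˡ (zeroˡ h)) (+-identityʳ a)) y≤a))
  grid (suc M) {a} {h} {y} (a<y , y≤b) with y ≤? a + h
  ... | yes y≤a+h = zero , <-respˡ-≈ (sym start) a<y , ≤-respʳ-≈ (+-congʳ (sym start)) y≤a+h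
    where
    start : a + 0# * h ≈ a
    start = trans (+-congˡ (zeroˡ h)) (+-identityʳ a)
  ... | no  y≰a+h =
    let (t , p , q) = grid M {a + h} {h} {y} (≰⇒> y≰a+h , ≤-respʳ-≈ (advance (M · 1#)) y≤b) in
    suc t , <-respˡ-≈ (sym (advance (toℕ t · 1#))) p , ≤-respʳ-≈ (+-congʳ (sym (advance (toℕ t · 1#)))) q
    where
    advance : ∀ m → a + (1# + m) * h ≈ a + h + m * h
    advance m = solve 3 (λ a m h → a :+ (con (+ 1) :+ m) :* h := a :+ h :+ m :* h) refl a m h

  -- M^k β, with one factor for each use of `cover-union` in `cover-cells`.
  scaled : ℕ → ℕ → ℝ → ℝ
  scaled zero    M β = β
  scaled (suc k) M β = M · 1# * scaled k M β

  scaled-product : ∀ k M β → scaled k M β ≈ product {k} (λ _ → M · 1#) * β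
  scaled-product zero    M β = sym (*-identityˡ β)
  scaled-product (suc k) M β = trans (*-congˡ (scaled-product k M β)) (sym (*-assoc _ _ _))

  -- Induction on the coordinates: S is split according to the cell of the first one, and the choice
  -- already made is kept as part of the set to be covered. In all there are M^k choices c.
  cover-cells : ∀ {k M β} {S : Pred Ω 0ℓ} (C : Fin k → Fin M → Pred Ω 0ℓ) →
    (∀ ω → S ω → ∀ j → ∃ λ t → C j t ω) →
    (∀ (c : Fin k → Fin M) → Cover β (λ ω → S ω × ∀ j → C j (c j) ω)) → Cover (scaled k M β) S
  cover-cells {zero} C S∈C cover = let (E , e , p , q) = cover (λ ()) in E , e , p , λ s → q (s , λ ())
  cover-cells {suc k} {M} {β} {S} C S∈C cover =
    let (E , e , p , q) = cover-union (λ t → cover-cells {k} {M} {β} {λ ω → S ω × C zero t ω} (C ∘ suc)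
          (λ ω (s , _) j → S∈C ω s (suc j))
          (λ c → let (E , e , p , q) = cover (t ∷ c) in E , e , p ,
            λ ((s , z) , cs) → q (s , λ { zero → z ; (suc j) → cs j })))
    in E , e , p , λ {ω} s → let (t , z) = S∈C ω s zero in q (t , s , z)

  bounded-vector : ∀ {n} (y : Vector ℝ n) → ∃ λ K → ∀ j → Interval (- (K · 1#)) (K · 1#) (y j)
  bounded-vector {zero}  y = 0 , λ ()
  bounded-vector {suc n} y =
    let (K , p) = bounded-vector (tail y)
        (a , y<a) = archimedean em (y zero)
        (b , -y<b) = archimedean em (- y zero)
        N = K ℕ.+ (a ℕ.+ b)
    in N , λ { zero → <-respʳ-≈ (⁻¹-involutive (y zero)) (neg-mono-< (<-≤-trans -y<b
                        (·1-mono-≤ (ℕ.≤-trans (ℕ.m≤n+m b a) (ℕ.m≤n+m (a ℕ.+ b) K))))) ,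
                      ≤-trans (proj₁ y<a) (·1-mono-≤ (ℕ.≤-trans (ℕ.m≤m+n a b) (ℕ.m≤n+m (a ℕ.+ b) K)))
             ; (suc j) → ≤-<-trans (neg-mono-≤ (·1-mono-≤ (ℕ.m≤m+n K (a ℕ.+ b)))) (proj₁ (p j)) ,
                         ≤-trans (proj₂ (p j)) (·1-mono-≤ (ℕ.m≤m+n K (a ℕ.+ b))) }

  -- Applied to u and to -u this bounds the absolute value, so that the sum W of the 1 + u_j² can
  -- stand for the sum of the |u_j|.
  x≤1+x² : ∀ x → x ≤ 1# + x * x
  x≤1+x² x = [ (λ x≤1 → ≤-trans x≤1 (≤-respˡ-≈ (+-identityʳ 1#) (+-monoʳ-≤ 1# (square-nonNegative x))))
             , (λ 1≤x → ≤-trans (≤-respˡ-≈ (*-identityʳ x) (*-monoˡ-≤ (≤-trans 0≤1 1≤x) 1≤x))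
                 (≤-respˡ-≈ (+-identityˡ (x * x)) (+-monoˡ-≤ (x * x) 0≤1))) ]′ (total x 1#)

  -- One coordinate y is an affine function of the others: as these vary in cells
  -- of side h, y stays in an interval of length h (2W + 1).
  slab : ∀ {k} (u : Vector ℝ k) (h : ℝ) (a x : Vector ℝ k) {y} → 0# < h →
    (∀ j → Interval (a j) (a j + h) (x j)) → y ≈ ⟨ u , x ⟩ →
    let W = sum (λ j → 1# + u j * u j) in
    Interval (⟨ u , a ⟩ - W * h - h) (⟨ u , a ⟩ + W * h) y
  slab {k} u h a x {y} 0<h x∈ y≈ux = lower , upper
    where
    W = sum (λ j → 1# + u j * u j)
    d : Vector ℝ k
    d j = x j - a j
    0≤d : ∀ j → 0# ≤ d j
    0≤d j = ≤⇒0≤y-x (proj₁ (proj₁ (x∈ j)))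
    d≤h : ∀ j → d j ≤ h
    d≤h j = ≤-respʳ-≈ (solve 2 (λ a h → a :+ h :- a := h) refl (a j) h) (+-monoˡ-≤ (- a j) (proj₂ (x∈ j)))
    term : ∀ v w → v * v ≈ w * w → ∀ j → v * d j ≤ (1# + w * w) * h
    term v w vv≈ww j = ≤-trans (*-monoʳ-≤ (0≤d j) (≤-respʳ-≈ (+-congˡ vv≈ww) (x≤1+x² v)))
      (*-monoˡ-≤ (+-nonNegative 0≤1 (square-nonNegative w)) (d≤h j))
    -- Used for v = u and for v = - u, which give the upper and the lower end; the bound W h depends
    -- on the squares only.
    sum≤ : ∀ (v : Vector ℝ k) → (∀ j → v j * v j ≈ u j * u j) → ⟨ v , d ⟩ ≤ W * h
    sum≤ v vv≈uu = ≤-respʳ-≈ (sym (*-distribʳ-sum {k} h _)) (sum-mono-≤ {k} (λ j → term (v j) (u j) (vv≈uu j) j))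
    ⟨u,d⟩ : ⟨ u , d ⟩ ≈ y - ⟨ u , a ⟩
    ⟨u,d⟩ = trans (⟨⟩-subʳ u x a) (+-congʳ (sym y≈ux))
    upper : y ≤ ⟨ u , a ⟩ + W * h
    upper = ≤-respˡ-≈ (trans (+-congˡ ⟨u,d⟩) (solve 2 (λ m y → m :+ (y :- m) := y) refl ⟨ u , a ⟩ y))
      (+-monoʳ-≤ ⟨ u , a ⟩ (sum≤ u (λ _ → refl)))
    -ud≤ : - (y - ⟨ u , a ⟩) ≤ W * h
    -ud≤ = ≤-respˡ-≈ (trans (sum-cong {k} (λ j → sym (-‿distribˡ-* (u j) (d j)))) (trans (sum-neg {k} _) (-‿cong ⟨u,d⟩)))
      (sum≤ (λ j → - u j) (λ j → solve 1 (λ u → (:- u) :* (:- u) := u :* u) refl (u j)))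
    -- The additional h makes the inequality strict, as the open left end of `Interval` demands.
    lower : ⟨ u , a ⟩ - W * h - h < y
    lower = <-≤-trans
      (<-respʳ-≈ (solve 2 (λ z h → z :- h :+ h := z) refl (⟨ u , a ⟩ - W * h) h)
        (<-respˡ-≈ (+-identityʳ _) (+-monoʳ-< _ 0<h)))
      (0≤y-x⇒≤ (≤-respʳ-≈ (solve 3 (λ m w y → w :- :- (y :- m) := y :- (m :- w)) refl ⟨ u , a ⟩ (W * h) y) (≤⇒0≤y-x -ud≤)))

  pick : ∀ {P : Set} → Dec P → Pred ℝ 0ℓ → Pred ℝ 0ℓ
  pick (yes _) S = S
  pick (no _)  S = U

  module Draws {m n} (g : Ω → Fin m → Vector ℝ n) (normal : AreIndependentStandardNormal 𝒫 g) where

    coordinate-event : ∀ i j {S} → Borel S → Event (λ ω → S (g ω i j))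
    coordinate-event i j = proj₁ (proj₁ normal i j)

    box-event : ∀ i {S : Fin n → Pred ℝ 0ℓ} → (∀ j → Borel (S j)) → Event (λ ω → ∀ j → S j (g ω i j))
    box-event i borel = finite-intersection Event-U (λ j → coordinate-event i j (borel j))

    -- Independence speaks of all draws at once. The other draws are given the trivial condition U,
    -- whose factors in the product are 1.
    box-probability : ∀ i (S : Fin n → Pred ℝ 0ℓ) → (∀ j → Borel (S j)) →
      ℙ (λ ω → ∀ j → S j (g ω i j)) ≈ product (λ j → ℙ (λ ω → S j (g ω i j)))
    box-probability i S borel = begin
      ℙ (λ ω → ∀ j → S j (g ω i j))
        ≈⟨ ℙ-≐ (box-event i borel) ((λ {ω} p l j → extend-box ω l j (p j)) , λ p j → restrict (p i j)) ⟩
      ℙ (λ ω → ∀ l j → S′ l j (g ω l j))                        ≈⟨ proj₂ normal S′ borel′ ⟩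
      product (λ l → product (λ j → ℙ (λ ω → S′ l j (g ω l j))))
        ≈⟨ product-single i (λ l l≢i → product-one {n} (λ j → other l l≢i j)) ⟩
      product (λ j → ℙ (λ ω → S′ i j (g ω i j)))
        ≈⟨ product-cong {n} (λ j → reflexive (≡.cong (λ T → ℙ (λ ω → T (g ω i j))) (pick-same j))) ⟩
      product (λ j → ℙ (λ ω → S j (g ω i j)))                   ∎
      where
      open ≈-Reasoning
      S′ : Fin m → Fin n → Pred ℝ 0ℓ
      S′ l j = pick (l Fin.≟ i) (S j)
      borel′ : ∀ l j → Borel (S′ l j)
      borel′ l j with l Fin.≟ i
      ... | yes _ = borel j
      ... | no  _ = U-borel
      extend-box : ∀ ω l j → S j (g ω i j) → S′ l j (g ω l j)
      extend-box ω l j p with l Fin.≟ i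
      ... | yes ≡.refl = p
      ... | no  _      = _
      pick-same : ∀ j → S′ i j ≡ S j
      pick-same j with i Fin.≟ i
      ... | yes _  = ≡.refl
      ... | no i≢i = ⊥-elim (i≢i ≡.refl)
      restrict : ∀ {j y} → S′ i j y → S j y
      restrict {j} {y} = ≡.subst (λ T → T y) (pick-same j)
      other : ∀ l → l ≢ i → ∀ j → ℙ (λ ω → S′ l j (g ω l j)) ≈ 1#
      other l l≢i j with l Fin.≟ i
      ... | yes l≡i = ⊥-elim (l≢i l≡i)
      ... | no  _   = ℙ-U

    common-bound : ∀ i → ∃ λ L → 0# ≤ L × (∀ j → HasBoundedDensity L (λ ω → g ω i j))
    common-bound i = sum L , sum-nonNegative {n} 0≤L , λ j a b a≤b →
      ≤-trans (density j a b a≤b) (*-monoʳ-≤ (≤⇒0≤y-x a≤b) (term≤sum {n} 0≤L j))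
      where
      L : Vector ℝ n
      L j = proj₁ (normal-bounded (proj₁ normal i j))
      0≤L : ∀ j → 0# ≤ L j
      0≤L j = proj₁ (proj₂ (normal-bounded (proj₁ normal i j)))
      density : ∀ j → HasBoundedDensity (L j) (λ ω → g ω i j)
      density j = proj₂ (proj₂ (normal-bounded (proj₁ normal i j)))

  -- The part of the hyperplane in the cube (-K, K]ⁿ is covered by M^(n-1) boxes with sides
  -- h = 2K / M, except for one side which is a constant multiple of h.
  module Hyperplane {m k} (g : Ω → Fin m → Vector ℝ (suc k)) (normal : AreIndependentStandardNormal 𝒫 g)
    (i : Fin m) (v : Vector ℝ (suc k)) (j₀ : Fin (suc k)) (vⱼ≉0 : ¬ (v j₀ ≈ 0#)) where

    open Draws g normal

    L : ℝ
    L = proj₁ (common-bound i)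

    0≤L : 0# ≤ L
    0≤L = proj₁ (proj₂ (common-bound i))

    density : ∀ j → HasBoundedDensity L (λ ω → g ω i j)
    density = proj₂ (proj₂ (common-bound i))

    u : Vector ℝ k
    u j = - (v j₀ ⁻¹ * v (punchIn j₀ j))

    solve-for : ∀ x → ⟨ v , x ⟩ ≈ 0# → x j₀ ≈ ⟨ u , removeAt x j₀ ⟩
    solve-for x vx≈0 = begin
      x j₀                                               ≈⟨ trans (*-congʳ (*-inverseˡ vⱼ≉0)) (*-identityˡ _) ⟨
      v j₀ ⁻¹ * v j₀ * x j₀
        ≈⟨ solve 4 (λ ι v x s → ι :* v :* x := ι :* (v :* x :+ s) :+ :- ι :* s) refl (v j₀ ⁻¹) (v j₀) (x j₀) S ⟩
      v j₀ ⁻¹ * (v j₀ * x j₀ + S) + - v j₀ ⁻¹ * S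
        ≈⟨ +-congʳ (trans (*-congˡ (trans (sym (sum-remove {i = j₀} (λ j → v j * x j))) vx≈0)) (zeroʳ _)) ⟩
      0# + - v j₀ ⁻¹ * S                                 ≈⟨ trans (+-identityˡ _) (*-distribˡ-sum {k} (- v j₀ ⁻¹) _) ⟩
      sum (λ j → - v j₀ ⁻¹ * (v (punchIn j₀ j) * x (punchIn j₀ j)))
        ≈⟨ sum-cong {k} (λ j → solve 3 (λ ι v x → :- ι :* (v :* x) := :- (ι :* v) :* x) refl (v j₀ ⁻¹) (v (punchIn j₀ j)) (x (punchIn j₀ j))) ⟩
      ⟨ u , removeAt x j₀ ⟩                              ∎
      where
      open ≈-Reasoning
      S = sum (λ j → v (punchIn j₀ j) * x (punchIn j₀ j))

    W : ℝ
    W = sum (λ j → 1# + u j * u j)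

    0≤W : 0# ≤ W
    0≤W = sum-nonNegative {k} (λ j → +-nonNegative 0≤1 (square-nonNegative (u j)))

    module Truncated (K : ℕ) where

      R D C : ℝ
      -- The successor keeps the side D of the cube positive when K = 0.
      R = suc K · 1#
      D = R + R
      -- M^k boxes of probability at most β weigh at most C / M together: each of the k free
      -- directions contributes M L h = L D, and the dependent one L h (2W + 1) = L (2W + 1) D / M.
      C = product {k} (λ _ → L * D) * (L * ((W + W + 1#) * D))

      0<D : 0# < D
      0<D = +-positive (·1-positive K) (·1-nonNegative (suc K))

      Part : Pred Ω 0ℓ
      Part ω = ⟨ v , g ω i ⟩ ≈ 0# × (∀ j → Interval (- R) R (g ω i j))

      module Mesh (M′ : ℕ) where

        M : ℕ
        M = suc M′

        N h β : ℝ
        N = M · 1#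
        h = D * N ⁻¹
        β = L * (h * (W + W + 1#)) * product {k} (λ _ → L * h)

        N≉0 : ¬ (N ≈ 0#)
        N≉0 = >⇒≉ (·1-positive M′)

        0<h : 0# < h
        0<h = *-positive 0<D (⁻¹-positive (·1-positive M′))

        N*h≈D : N * h ≈ D
        N*h≈D = trans (solve 3 (λ n d i → n :* (d :* i) := d :* (n :* i)) refl N D (N ⁻¹))
          (trans (*-congˡ (*-inverseʳ N≉0)) (*-identityʳ D))

        total-measure : scaled k M β ≈ C * N ⁻¹
        total-measure = begin
          scaled k M β                                   ≈⟨ scaled-product k M β ⟩
          product {k} (λ _ → N) * (s * product {k} (λ _ → L * h))
            ≈⟨ solve 3 (λ a s b → a :* (s :* b) := a :* b :* s) refl (product {k} (λ _ → N)) s (product {k} (λ _ → L * h)) ⟩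
          product {k} (λ _ → N) * product {k} (λ _ → L * h) * s
            ≈⟨ *-congʳ (trans (sym (product-distrib {k} _ _)) (product-cong {k} (λ _ →
                trans (solve 3 (λ n l h → n :* (l :* h) := l :* (n :* h)) refl N L h) (*-congˡ N*h≈D)))) ⟩
          product {k} (λ _ → L * D) * s
            ≈⟨ solve 5 (λ p l d i w → p :* (l :* (d :* i :* w)) := p :* (l :* (w :* d)) :* i) refl (product {k} (λ _ → L * D)) L D (N ⁻¹) (W + W + 1#) ⟩
          C * N ⁻¹                                       ∎
          where
          open ≈-Reasoning
          s = L * (h * (W + W + 1#))

        InCell : Fin k → Fin M → Pred Ω 0ℓ
        InCell j t ω = Cell (- R) h t (g ω i (punchIn j₀ j))

        in-cell : ∀ ω → Part ω → ∀ j → ∃ λ t → InCell j t ω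
        in-cell ω (_ , bounded) j = grid M (proj₁ (bounded (punchIn j₀ j)) ,
          ≤-respʳ-≈ (sym (trans (+-congˡ N*h≈D) (solve 1 (λ r → :- r :+ (r :+ r) := r) refl R))) (proj₂ (bounded (punchIn j₀ j))))

        box-cover : ∀ (c : Fin k → Fin M) → Cover β (λ ω → Part ω × ∀ j → InCell j (c j) ω)
        box-cover c = (λ ω → ∀ j → Box j (g ω i j)) , box-event i Box-borel , ℙ≤β , λ {ω} p j → inside ω p j
          where
          a : Vector ℝ k
          a j = - R + toℕ (c j) · 1# * h
          lo hi : ℝ
          lo = ⟨ u , a ⟩ - W * h - h
          hi = ⟨ u , a ⟩ + W * h
          sides : Fin k → Pred ℝ 0ℓ
          sides j = Interval (a j) (a j + h)
          Box : Fin (suc k) → Pred ℝ 0ℓ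
          Box = insertAt sides j₀ (Interval lo hi)
          Box-j₀ : Box j₀ ≡ Interval lo hi
          Box-j₀ = insertAt-lookup sides j₀ (Interval lo hi)
          Box-punchIn : ∀ j → Box (punchIn j₀ j) ≡ sides j
          Box-punchIn = insertAt-punchIn sides j₀ (Interval lo hi)
          by-cases : ∀ {ℓ} (P : Fin (suc k) → Set ℓ) → P j₀ → (∀ j → P (punchIn j₀ j)) → ∀ j → P j
          by-cases P p q j with j₀ Fin.≟ j
          ... | yes ≡.refl = p
          ... | no  j₀≢j   = ≡.subst P (punchIn-punchOut j₀≢j) (q (punchOut j₀≢j))
          Box-borel : ∀ j → Borel (Box j)
          Box-borel = by-cases (λ j → Borel (Box j)) (≡.subst Borel (≡.sym Box-j₀) (interval-borel lo hi))
            (λ j → ≡.subst Borel (≡.sym (Box-punchIn j)) (interval-borel (a j) (a j + h)))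
          inside : ∀ ω → Part ω × (∀ j → InCell j (c j) ω) → ∀ j → Box j (g ω i j)
          inside ω ((on , _) , cells) = by-cases (λ j → Box j (g ω i j))
            (≡.subst (λ T → T (g ω i j₀)) (≡.sym Box-j₀)
              (slab u h a (removeAt (g ω i) j₀) 0<h cells (solve-for (g ω i) on)))
            (λ j → ≡.subst (λ T → T (g ω i (punchIn j₀ j))) (≡.sym (Box-punchIn j)) (cells j))
          length : hi - lo ≈ h * (W + W + 1#)
          length = solve 3 (λ m w h → m :+ w :* h :- (m :- w :* h :- h) := h :* (w :+ w :+ con (+ 1))) refl ⟨ u , a ⟩ W h
          lo≤hi : lo ≤ hi
          lo≤hi = 0≤y-x⇒≤ (≤-respʳ-≈ (sym length) (*-nonNegative (proj₁ 0<h)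
            (+-nonNegative (+-nonNegative 0≤W 0≤W) 0≤1)))
          a≤a+h : ∀ j → a j ≤ a j + h
          a≤a+h j = ≤-respˡ-≈ (+-identityʳ _) (+-monoʳ-≤ (a j) (proj₁ 0<h))
          q : Fin (suc k) → ℝ
          q j = ℙ (λ ω → Box j (g ω i j))
          0≤q : ∀ j → 0# ≤ q j
          0≤q j = ℙ-nonNeg (coordinate-event i j (Box-borel j))
          q-j₀ : q j₀ ≤ L * (h * (W + W + 1#))
          q-j₀ = ≤-respʳ-≈ (*-congˡ length) (≤-respˡ-≈ (reflexive (≡.cong (λ T → ℙ (λ ω → T (g ω i j₀))) (≡.sym Box-j₀)))
            (density j₀ lo hi lo≤hi))
          q-other : ∀ j → q (punchIn j₀ j) ≤ L * h
          q-other j = ≤-respʳ-≈ (*-congˡ (solve 2 (λ a h → a :+ h :- a := h) refl (a j) h))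
            (≤-respˡ-≈ (reflexive (≡.cong (λ T → ℙ (λ ω → T (g ω i (punchIn j₀ j)))) (≡.sym (Box-punchIn j))))
              (density (punchIn j₀ j) (a j) (a j + h) (a≤a+h j)))
          ℙ≤β : ℙ (λ ω → ∀ j → Box j (g ω i j)) ≤ β
          ℙ≤β = ≤-respˡ-≈ (sym (trans (box-probability i Box Box-borel) (product-remove {i = j₀} q)))
            (*-mono-≤ (≤-trans (0≤q j₀) q-j₀) (product-nonNegative (λ j → 0≤q (punchIn j₀ j))) q-j₀
              (product-mono-≤ (λ j → 0≤q (punchIn j₀ j)) q-other))

        mesh-cover : Cover (C * N ⁻¹) Part
        mesh-cover = cover-mono (≤-reflexive total-measure) (cover-cells InCell in-cell box-cover)

      part-null : Null Part
      part-null = covers⇒null (λ M′ → C * (suc M′ · 1#) ⁻¹) Mesh.mesh-cover small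
        where
        small : ∀ ε → 0# < ε → ∃ λ M′ → C * (suc M′ · 1#) ⁻¹ ≤ ε
        small ε 0<ε with archimedean em (C * ε ⁻¹)
        ... | M′ , C/ε<M′ = M′ , ≤-respʳ-≈ (trans (*-assoc _ _ _) (trans (*-congˡ (*-inverseʳ (>⇒≉ (·1-positive M′)))) (*-identityʳ ε)))
          (*-monoʳ-≤ (proj₁ (⁻¹-positive (·1-positive M′))) C≤εN)
          where
          C≤εN : C ≤ ε * suc M′ · 1#
          C≤εN = ≤-respˡ-≈ (trans (solve 3 (λ e c i → e :* (c :* i) := c :* (e :* i)) refl ε C (ε ⁻¹))
              (trans (*-congˡ (*-inverseʳ (>⇒≉ 0<ε))) (*-identityʳ C)))
            (*-monoˡ-≤ (proj₁ 0<ε) (≤-trans (proj₁ C/ε<M′) (·1-mono-≤ (ℕ.n≤1+n M′))))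

    -- Each vector lies in some cube, so the hyperplane is the union of countably many of the null
    -- parts.
    hyperplane-null : Null (λ ω → ⟨ v , g ω i ⟩ ≈ 0#)
    hyperplane-null = null-⊆ (λ {ω} on → let (K , p) = bounded-vector (g ω i) in
        K , on , λ j → ≤-<-trans (neg-mono-≤ (·1-mono-≤ (ℕ.n≤1+n K))) (proj₁ (p j)) ,
                       ≤-trans (proj₂ (p j)) (·1-mono-≤ (ℕ.n≤1+n K)))
      (null-countable-union Truncated.part-null)

-- Almost sure correctness and the theorem.

module AlmostSureCorrectness (em : ExcludedMiddle 0ℓ) (ℛ : RealNumbers) where

  open SignComponents ℛ
  open OrderedField ℛ
  open Summation ℛ
  open LinearAlgebra ℛ
  open SchurIndependence ℛ
  open Uniqueness ℛ
  open AlgorithmAnalysis ℛ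
  open LoopAnalysis ℛ

  infixl 6 _+ᵥ_
  _+ᵥ_ : ∀ {n} → Vector ℝ n → Vector ℝ n → Vector ℝ n
  (x +ᵥ y) i = x i + y i

  ⟨⟩-addˡ : ∀ {n} (y z x : Vector ℝ n) → ⟨ y +ᵥ z , x ⟩ ≈ ⟨ y , x ⟩ + ⟨ z , x ⟩
  ⟨⟩-addˡ {n} y z x = trans (sum-cong {n} (λ i → distribʳ (x i) (y i) (z i))) (∑-distrib-+ {n} _ _)

  -- Distinct dyads rule out s = t and, in the next lemma, s = - t. The nonzero entry found is the
  -- coordinate for which the equation of the hyperplane is solved.
  difference-nonzero : ∀ {n} {s t : Vector ℝ n} → ¬ (dyad s ≈ₘ dyad t) → ∃ λ j → ¬ ((s -ᵥ t) j ≈ 0#)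
  difference-nonzero {s = s} {t} distinct = nonzero-entry (λ s-t≈0 → distinct (λ i j →
    *-cong (x-y≈0⇒x≈y _ _ (s-t≈0 i)) (x-y≈0⇒x≈y _ _ (s-t≈0 j))))

  sum-nonzero : ∀ {n} {s t : Vector ℝ n} → ¬ (dyad s ≈ₘ dyad t) → ∃ λ j → ¬ ((s +ᵥ t) j ≈ 0#)
  sum-nonzero {s = s} {t} distinct = nonzero-entry (λ s+t≈0 → distinct (λ i j →
    trans (*-cong (opposite i (s+t≈0 i)) (opposite j (s+t≈0 j)))
      (solve 2 (λ a b → :- a :* :- b := a :* b) refl (t i) (t j))))
    where
    opposite : ∀ i → s i + t i ≈ 0# → s i ≈ - t i
    opposite i p = trans (solve 2 (λ a b → a := a :+ b :+ :- b) refl (s i) (t i)) (trans (+-congʳ p) (+-identityˡ _))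

  module _ (𝒫 : ProbabilitySpace) where

    open ProbabilitySpace 𝒫
    open NullSets em ℛ 𝒫
    open GaussianHyperplanes em ℛ 𝒫 using (module Hyperplane)

    -- The two hyperplanes make up the set ⟨s_k, g⟩² = ⟨s_l, g⟩². The condition k ≢ l belongs to the
    -- set, so that finite unions may run over all k and l.
    Tied : ∀ {m r n} → (Ω → Fin m → Vector ℝ n) → (Fin r → Vector ℝ n) → Fin m → Fin r → Fin r → Pred Ω 0ℓ
    Tied g s i k l ω = k ≢ l × (⟨ s k -ᵥ s l , g ω i ⟩ ≈ 0# ⊎ ⟨ s k +ᵥ s l , g ω i ⟩ ≈ 0#)

    separates-almost-surely : ∀ {m r n} (g : Ω → Fin m → Vector ℝ (suc n)) → AreIndependentStandardNormal 𝒫 g →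
      (s : Fin r → Vector ℝ (suc n)) → (∀ i j → i ≢ j → ¬ (dyad (s i) ≈ₘ dyad (s j))) →
      ∀ {Q : Pred Ω 0ℓ} → (∀ {ω} → (∀ i → Separates (g ω i) s) → Q ω) → AlmostSurely Q
    separates-almost-surely g normal s distinct q = null⇒almostSurely
      (null-finite-union (λ i → null-finite-union (λ k → null-finite-union (λ l → tied-null i k l))))
      (λ {ω} untied → q (λ i k l k≢l e → separate ω untied i k l k≢l e))
      where
      tied-null : ∀ i k l → Null (Tied g s i k l)
      tied-null i k l with k Fin.≟ l
      ... | yes k≡l = null-empty (λ ω (k≢l , _) → k≢l k≡l)
      ... | no  k≢l =
        let (j , p) = difference-nonzero (distinct k l k≢l)
            (j′ , p′) = sum-nonzero (distinct k l k≢l)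
        in null-⊆ proj₂ (null-union (Hyperplane.hyperplane-null g normal i (s k -ᵥ s l) j p)
             (Hyperplane.hyperplane-null g normal i (s k +ᵥ s l) j′ p′))
      separate : ∀ ω → ¬ (∃ λ i → ∃ λ k → ∃ λ l → Tied g s i k l ω) → ∀ i → Separates (g ω i) s
      separate ω untied i k l k≢l e with ⟨ s k -ᵥ s l , g ω i ⟩ ≟ 0#
      ... | yes p = untied (i , k , l , k≢l , inj₁ p)
      ... | no ¬p = untied (i , k , l , k≢l , inj₂ (*-zero-product (begin
          ⟨ s k -ᵥ s l , g ω i ⟩ * ⟨ s k +ᵥ s l , g ω i ⟩
            ≈⟨ *-cong (⟨⟩-subˡ (s k) (s l) (g ω i)) (⟨⟩-addˡ (s k) (s l) (g ω i)) ⟩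
          (a - b) * (a + b)
            ≈⟨ solve 2 (λ a b → (a :- b) :* (a :+ b) := a :* a :- b :* b) refl a b ⟩
          a * a - b * b                                     ≈⟨ trans (+-congʳ e) (-‿inverseʳ _) ⟩
          0#                                                ∎) ¬p))
        where
        open ≈-Reasoning
        a = ⟨ s k , g ω i ⟩
        b = ⟨ s l , g ω i ⟩

  -- An empty sum cannot be 1, so a component exists, and r ≤ n then provides a coordinate.
  index : ∀ {r n} {τ : Vector ℝ r} → sum τ ≈ 1# → r ℕ.≤ n → Fin n
  index {zero}  0≈1 _             = ⊥-elim (0≉1 0≈1)
  index {suc r} _   (ℕ.s≤s r≤n) = zero

  initial-state : ∀ {n r} {A : Matrix n n} {τ} {s : Fin r → Vector ℝ n} → HasRank A r →
    IsSignComponentDecomposition A (τ , s) → SchurIndependent s → State A τ s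
  initial-state rank ((0<τ , τ≈1) , s-signs , _ , A≈) schur = record
    { positive    = 0<τ
    ; total≈1     = τ≈1
    ; signs       = s-signs
    ; schurFree   = schurIndependent⇒schurFree s-signs schur
    ; independent = rank⇒independent rank A≈
    ; represents  = A≈ }

  unique : ∀ {n r} {A : Matrix n n} {τ} {s : Fin r → Vector ℝ n} → State A τ s → HasUniqueDecomposition A
  unique state = uniqueness (index total≈1 (independent⇒≤ independent)) positive signs schurFree independent represents
    where open State state

  correct-almost-surely : ∀ (solver : SDPSolver) {n r} {A : Matrix n n} {τ} {s : Fin r → Vector ℝ n} →
    State A τ s → (∀ i j → i ≢ j → ¬ (dyad (s i) ≈ₘ dyad (s j))) →
    (𝒫 : ProbabilitySpace) (let open ProbabilitySpace 𝒫) (g : Ω → Fin (pred r) → Vector ℝ n) →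
    AreIndependentStandardNormal 𝒫 g →
    AlmostSurely λ ω →
      IsRun A (g ω) (value (signComponentDecomposition solver r A (g ω)))
      × (∀ (out : Parametric r n) → IsRun A (g ω) out → (τ , s) ∼ out)
  correct-almost-surely solver {zero} state distinct 𝒫 g normal
    with index (State.total≈1 state) (independent⇒≤ (State.independent state))
  ... | ()
  correct-almost-surely solver {suc n} {A = A} {τ} {s} state distinct 𝒫 g normal =
    separates-almost-surely 𝒫 g normal s distinct (λ {ω} sep →
      run-correct solver state (g ω) sep , run-decomposition zero state distinct (g ω) sep)

theorem1 : ExcludedMiddle 0ℓ →
    (ℛ : RealNumbers) →
    let open SignComponents ℛ in
    (solver : SDPSolver) →
    ∃₂ λ (c d : ℕ) →
    ∀ {n r : ℕ} (A : Matrix n n) (τ : Vector ℝ r) (s : Fin r → Vector ℝ n) →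
    IsCorrelationMatrix A →
    HasRank A r →
    IsSignComponentDecomposition A (τ , s) →
    SchurIndependent s →
    HasUniqueDecomposition A
    × ((𝒫 : ProbabilitySpace) (let open ProbabilitySpace 𝒫)
    (g : Ω → Fin (pred r) → Vector ℝ n) →
    AreIndependentStandardNormal 𝒫 g →
    AlmostSurely λ ω →
    let output = value (signComponentDecomposition solver r A (g ω)) in
    IsRun A (g ω) output
    × (∀ (out : Parametric r n) → IsRun A (g ω) out → (τ , s) ∼ out))
    × (∀ (g : Fin (pred r) → Vector ℝ n) →
    cost (signComponentDecomposition solver r A g) ℕ.≤ c ℕ.* n ℕ.^ d ℕ.+ c)
theorem1 em ℛ solver = c , d , λ A τ s A-correlation rank decomposition schur →
    let state = initial-state rank decomposition schur in
    unique state ,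
    correct-almost-surely solver state (proj₁ (proj₂ (proj₂ decomposition))) ,
    λ g → cost≤ A g (independent⇒≤ (State.independent state))
  where
  open AlmostSureCorrectness em ℛ
  open Uniqueness ℛ using (independent⇒≤)
  open AlgorithmAnalysis ℛ using (module State)
  polynomial = CostBounds.run-polynomial ℛ solver
  c = proj₁ polynomial
  d = proj₁ (proj₂ polynomial)
  cost≤ = proj₂ (proj₂ polynomial)
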